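{- Let $\mathsf{M}$ be an elementary split matroid of rank $k$ and cardinality $n$, and let $f$ be a valuative invariant (with values in an abelian group). Then \[ f(\mathsf{M}) = f(\mathsf{U}_{k,n}) - \sum_{r,h}\lambda_{r,h}\left(f(\mathsf{\Lambda}_{r,k,h,n}) - f(\mathsf{U}_{k-r,n-h}\oplus\mathsf{U}_{r,h})\right),\] where each $\lambda_{r,h}$ denotes the number of stressed subsets of $\mathsf{M}$ with non-empty cover of size $h$ and rank $r$.
   Context: All matroids have finite ground sets contained in the positive integers. $\mathsf{U}_{k,n}$ is the uniform matroid of rank $k$ on $n$ elements (invariants are evaluated on any matroid in the isomorphism class). Valuative invariants: the base polytope of a matroid $\mathsf{M}$ on $E$ with set of bases $\mathscr{B}$ is $\mathscr{P}(\mathsf{M})=\operatorname{conv}\{\sum_{i\in B}e_i : B\in\mathscr{B}\}\subseteq\mathbb{R}^E$; its indicator function $\mathbb{R}^E\to\mathbb{Z}$ is denoted $\mathbf{1}_{\mathscr{P}(\mathsf{M})}$. A map $f$ from matroids to an abelian group is a valuation if $\sum_{i}a_if(\mathsf{M}_i)=0$ whenever $\mathsf{M}_1,\dots,\mathsf{M}_s$ are matroids on a common ground set $E$ and $a_i\in\mathbb{Z}$ satisfy $\sum_i a_i\mathbf{1}_{\mathscr{P}(\mathsf{M}_i)}=0$. (This is known to be equivalent to the inclusion–exclusion property under matroid subdivisions.) It is an invariant if $f(\mathsf{M})=f(\mathsf{N})$ whenever $\mathsf{M}\cong\mathsf{N}$; a valuative invariant is a valuation that is an invariant. Stressed subsets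 and relaxation: let $\mathsf{M}$ be a matroid on $E$ of rank $k$ with rank function $\operatorname{rk}$ and bases $\mathscr{B}$. A subset $A\subseteq E$ is stressed if both $\mathsf{M}|_A$ and $\mathsf{M}/A$ are uniform. The cover of $A$ is $\operatorname{cover}(A)=\{S\subseteq E: |S|=k,\ |S\cap A|\ge \operatorname{rk}(A)+1\}$. If $A$ is stressed, $\operatorname{Rel}(\mathsf{M},A)$ is the matroid with bases $\mathscr{B}\sqcup\operatorname{cover}(A)$. For $0\le r\le h$, $0\le k-r\le n-h$, $\mathsf{\Lambda}_{r,k,h,n}$ is the relaxation of $\mathsf{U}_{k-r,n-h}\oplus\mathsf{U}_{r,h}$ by the ground set $F$ of the summand $\mathsf{U}_{r,h}$; its bases are the $k$-subsets $B$ of the $n$-element ground set with $|B\cap F|\ge r$, where $|F|=h$. Elementary split matroids: a matroid is connected if it is not a direct sum of two matroids with non-empty ground sets. For a connected matroid $\mathsf{M}$ on $E$, a flacet is a flat $F$ such that $\mathsf{M}|_F$ and $\mathsf{M}/F$ are connected; a flacet $F$ is a split flacet if $0<\operatorname{rk}(F)<|F|$ and $E\smallsetminus F$ contains at least one element that is not a coloop of $\mathsf{M}$. A connected split matroid is a connected matroid all of whose split flacets are stressed. A matroid is elementary split if it is either a connected split matroid or a direct sum of two uniform matroids. -}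

module Defs where

open import Algebra.Bundles using (AbelianGroup)
import Algebra.Definitions.RawMonoid as RawMonoid
import Algebra.Properties.Monoid.Sum as Sum
open import Data.Bool.Base using (if_then_else_)
import Data.Bool.Properties as Bool
open import Data.Empty using (⊥-elim)
open import Data.Fin.Base using (Fin; zero; suc)
import Data.Fin.Properties as Fin
open import Data.Fin.Subset
open import Data.Fin.Subset.Properties
open import Data.Integer.Base as ℤ using (ℤ; 0ℤ; 1ℤ)
open import Data.List.Base as List using (List; filter; foldr; length)
open import Data.List.Extrema.Nat using (max; max≤v⁺; v≤max⁺)
import Data.List.Membership.Propositional as List
import Data.List.Membership.Propositional.Properties as List
import Data.List.Relation.Unary.All as All
import Data.List.Relation.Unary.All.Properties as All
import Data.List.Relation.Unary.Any as Any
open import Data.Nat.Base as ℕ using (ℕ; zero; suc; _+_; _∸_; _≤_; _<_; z≤n; s≤s)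
import Data.Nat.Properties as ℕ
open import Data.Product.Base using (∃; _×_; _,_; proj₁; proj₂)
open import Data.Rational.Base as ℚ using (ℚ; 0ℚ; 1ℚ; ½)
import Data.Rational.Properties as ℚ
open import Data.Rational.Solver using (module +-*-Solver)
open import Data.Sum.Base using (_⊎_; inj₁; inj₂)
open import Data.Vec.Base using ([]; _∷_; here; there)
open import Data.Vec.Properties using (≡-dec)
open import Function.Base using (_∘_)
open import Function.Bundles using (_⇔_; _↔_; module Inverse)
open import Level using (0ℓ)
open import Relation.Binary.PropositionalEquality
open import Relation.Nullary.Decidable as Dec using (Dec; yes; no; does; _×-dec_; _⊎-dec_; _→-dec_; ¬?)
open import Relation.Nullary.Negation.Core using (¬_)
open import Relation.Unary using (Pred; Decidable; _≐_)

-- A finite set of positive integers is a subset E of some {1,…,N}, encoded as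
-- E : Subset N with i : Fin N standing for toℕ i + 1.  The same E occurs for
-- every large N; the resulting copies of a matroid are isomorphic under _≅_.

_≟ˢ_ : ∀ {N} (A B : Subset N) → Dec (A ≡ B)
_≟ˢ_ = ≡-dec Bool._≟_

subsets : ∀ N → List (Subset N)
subsets zero    = List.[ [] ]
subsets (suc N) = List.map (outside ∷_) (subsets N) List.++ List.map (inside ∷_) (subsets N)

∈-subsets : ∀ {N} (A : Subset N) → A List.∈ subsets N
∈-subsets []            = Any.here refl
∈-subsets (outside ∷ A) = List.∈-++⁺ˡ (List.∈-map⁺ (outside ∷_) (∈-subsets A))
∈-subsets (inside  ∷ A) =
  List.∈-++⁺ʳ (List.map (outside ∷_) (subsets _)) (List.∈-map⁺ (inside ∷_) (∈-subsets A))

allSubsets? : ∀ {N p} {P : Pred (Subset N) p} → Decidable P → Dec (∀ {A} → P A)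
allSubsets? {N} P? = Dec.map′
  (λ all {A} → All.lookup all (∈-subsets A))
  (λ p → All.universal (λ A → p {A}) (subsets N))
  (All.all? P? (subsets N))

≐-dec : ∀ {N p q} {P : Pred (Subset N) p} {Q : Pred (Subset N) q} →
        Decidable P → Decidable Q → Dec (P ≐ Q)
≐-dec P? Q? = allSubsets? (λ A → P? A →-dec Q? A) ×-dec allSubsets? (λ A → Q? A →-dec P? A)

Disjoint : ∀ {N} → Subset N → Subset N → Set
Disjoint A B = Empty (A ∩ B)

-- Restriction, contraction and relaxation are formed for arbitrary set systems,
-- so that they can be stated without first showing that the result is a matroid.
record SetSystem {N} (E : Subset N) : Set₁ where
  field
    Basis  : Pred (Subset N) 0ℓ
    Basis? : Decidable Basis
    Basis⊆ : ∀ {B} → Basis B → B ⊆ E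

  bases : List (Subset N)
  bases = filter Basis? (subsets N)

open SetSystem public

record IsMatroid {N} {E : Subset N} (S : SetSystem E) : Set where
  field
    nonempty : ∃ (Basis S)
    exchange : ∀ {B₁ B₂ x} → Basis S B₁ → Basis S B₂ → x ∈ B₁ → x ∉ B₂ →
               ∃ λ y → y ∈ B₂ × y ∉ B₁ × Basis S ((B₁ - x) ∪ ⁅ y ⁆)

record Matroid {N} (E : Subset N) : Set₁ where
  field
    system    : SetSystem E
    isMatroid : IsMatroid system

open Matroid public

rk : ∀ {N} {E : Subset N} → SetSystem E → Subset N → ℕ
rk S A = max 0 (List.map (λ B → ∣ B ∩ A ∣) (bases S))

rank : ∀ {N} {E : Subset N} → SetSystem E → ℕ
rank {E = E} S = rk S E

rank≤∣E∣ : ∀ {N} {E : Subset N} (S : SetSystem E) → rank S ≤ ∣ E ∣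
rank≤∣E∣ {E = E} S = max≤v⁺ z≤n (All.map⁺ (All.universal (λ B → ∣p∩q∣≤∣q∣ B E) (bases S)))

uniform : ∀ {N} → ℕ → (E : Subset N) → SetSystem E
uniform k E .Basis B  = B ⊆ E × ∣ B ∣ ≡ k
uniform k E .Basis? B = (B ⊆? E) ×-dec (∣ B ∣ ℕ.≟ k)
uniform k E .Basis⊆   = proj₁

-- The bases of M|A are the sets B ∩ A, and those of M/A the sets B ∖ A, where
-- B runs over the bases of M meeting A in as many elements as possible.

restrict : ∀ {N} {E : Subset N} → SetSystem E → (A : Subset N) → SetSystem A
restrict S A .Basis C  = ∃ λ B → Basis S B × ∣ B ∩ A ∣ ≡ rk S A × C ≡ B ∩ A
restrict S A .Basis? C = anySubset? λ B →
  Basis? S B ×-dec (∣ B ∩ A ∣ ℕ.≟ rk S A) ×-dec (C ≟ˢ (B ∩ A))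
restrict S A .Basis⊆ (B , _ , _ , refl) = p∩q⊆q B A

contract : ∀ {N} {E : Subset N} → SetSystem E → (A : Subset N) → SetSystem (E ─ A)
contract S A .Basis C  = ∃ λ B → Basis S B × ∣ B ∩ A ∣ ≡ rk S A × C ≡ B ─ A
contract S A .Basis? C = anySubset? λ B →
  Basis? S B ×-dec (∣ B ∩ A ∣ ℕ.≟ rk S A) ×-dec (C ≟ˢ (B ─ A))
contract S A .Basis⊆ (B , b , _ , refl) x∈ =
  x∈p∧x∉q⇒x∈p─q (Basis⊆ S b (p─q⊆p B A x∈)) (∉-─ B A x∈)
  where
  ∉-─ : ∀ {N} (p q : Subset N) {x} → x ∈ p ─ q → x ∉ q
  ∉-─ (_ ∷ p) (_ ∷ q) (there x∈) (there x∈q) = ∉-─ p q x∈ x∈q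

infixr 6 _⊕_

_⊕_ : ∀ {N} {E₁ E₂ : Subset N} → SetSystem E₁ → SetSystem E₂ → SetSystem (E₁ ∪ E₂)
(S₁ ⊕ S₂) .Basis B  = ∃ λ B₁ → ∃ λ B₂ → Basis S₁ B₁ × Basis S₂ B₂ × B ≡ B₁ ∪ B₂
(S₁ ⊕ S₂) .Basis? B = anySubset? λ B₁ → anySubset? λ B₂ →
  Basis? S₁ B₁ ×-dec Basis? S₂ B₂ ×-dec (B ≟ˢ (B₁ ∪ B₂))
(S₁ ⊕ S₂) .Basis⊆ (B₁ , B₂ , b₁ , b₂ , refl) x∈ with x∈p∪q⁻ B₁ B₂ x∈
... | inj₁ x∈B₁ = x∈p∪q⁺ (inj₁ (Basis⊆ S₁ b₁ x∈B₁))
... | inj₂ x∈B₂ = x∈p∪q⁺ (inj₂ (Basis⊆ S₂ b₂ x∈B₂))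

IsUniform : ∀ {N} {E : Subset N} → SetSystem E → Set
IsUniform {E = E} S = ∃ λ k → k ≤ ∣ E ∣ × Basis S ≐ Basis (uniform k E)

isUniform? : ∀ {N} {E : Subset N} (S : SetSystem E) → Dec (IsUniform S)
isUniform? {E = E} S = Dec.map′
  (λ (k , k<1+n , eq) → k , ℕ.≤-pred k<1+n , eq)
  (λ (k , k≤n , eq) → k , s≤s k≤n , eq)
  (ℕ.anyUpTo? (λ k → ≐-dec (Basis? S) (Basis? (uniform k E))) (suc ∣ E ∣))

IsDirectSum : ∀ {N} {E E₁ E₂ : Subset N} → SetSystem E → SetSystem E₁ → SetSystem E₂ → Set
IsDirectSum {E = E} {E₁} {E₂} S S₁ S₂ =
  Disjoint E₁ E₂ × E₁ ∪ E₂ ≡ E × Basis S ≐ Basis (S₁ ⊕ S₂)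

Connected : ∀ {N} {E : Subset N} → SetSystem E → Set₁
Connected {N} S = ¬ ∃ λ (E₁ : Subset N) → ∃ λ (E₂ : Subset N) →
  Nonempty E₁ × Nonempty E₂ ×
  ∃ λ (M₁ : Matroid E₁) → ∃ λ (M₂ : Matroid E₂) → IsDirectSum S (system M₁) (system M₂)

Stressed : ∀ {N} {E : Subset N} → SetSystem E → Subset N → Set
Stressed {E = E} S A = A ⊆ E × IsUniform (restrict S A) × IsUniform (contract S A)

stressed? : ∀ {N} {E : Subset N} (S : SetSystem E) → Decidable (Stressed S)
stressed? {E = E} S A = (A ⊆? E) ×-dec isUniform? (restrict S A) ×-dec isUniform? (contract S A)

Cover : ∀ {N} {E : Subset N} → SetSystem E → Subset N → Pred (Subset N) 0ℓ
Cover {E = E} S A B = B ⊆ E × ∣ B ∣ ≡ rank S × rk S A + 1 ≤ ∣ B ∩ A ∣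

cover? : ∀ {N} {E : Subset N} (S : SetSystem E) (A : Subset N) → Decidable (Cover S A)
cover? {E = E} S A B = (B ⊆? E) ×-dec (∣ B ∣ ℕ.≟ rank S) ×-dec (rk S A + 1 ℕ.≤? ∣ B ∩ A ∣)

relax : ∀ {N} {E : Subset N} → SetSystem E → Subset N → SetSystem E
relax S A .Basis B  = Basis S B ⊎ Cover S A B
relax S A .Basis? B = Basis? S B ⊎-dec cover? S A B
relax S A .Basis⊆ (inj₁ b)         = Basis⊆ S b
relax S A .Basis⊆ (inj₂ (B⊆E , _)) = B⊆E

stressedCount : ∀ {N} {E : Subset N} → SetSystem E → (r h : ℕ) → ℕ
stressedCount {N} S r h = length (filter counted? (subsets N))
  where
  counted? : Decidable λ A → Stressed S A × ∃ (Cover S A) × ∣ A ∣ ≡ h × rk S A ≡ r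
  counted? A =
    stressed? S A ×-dec anySubset? (cover? S A) ×-dec (∣ A ∣ ℕ.≟ h) ×-dec (rk S A ℕ.≟ r)

Flat : ∀ {N} {E : Subset N} → SetSystem E → Subset N → Set
Flat {E = E} S F = F ⊆ E × (∀ {x} → x ∈ E → x ∉ F → rk S F < rk S (F ∪ ⁅ x ⁆))

Coloop : ∀ {N} {E : Subset N} → SetSystem E → Fin N → Set
Coloop S x = ∀ {B} → Basis S B → x ∈ B

Flacet : ∀ {N} {E : Subset N} → SetSystem E → Subset N → Set₁
Flacet S F = Flat S F × Connected (restrict S F) × Connected (contract S F)

SplitFlacet : ∀ {N} {E : Subset N} → SetSystem E → Subset N → Set₁
SplitFlacet {E = E} S F =
  Flacet S F × 0 < rk S F × rk S F < ∣ F ∣ × (∃ λ x → x ∈ E ─ F × ¬ Coloop S x)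

ConnectedSplit : ∀ {N} {E : Subset N} → SetSystem E → Set₁
ConnectedSplit S = Connected S × (∀ F → SplitFlacet S F → Stressed S F)

ElementarySplit : ∀ {N} {E : Subset N} → Matroid E → Set₁
ElementarySplit {N} M = ConnectedSplit (system M) ⊎
  ∃ λ (E₁ : Subset N) → ∃ λ (E₂ : Subset N) →
  ∃ λ (M₁ : Matroid E₁) → ∃ λ (M₂ : Matroid E₂) →
  IsUniform (system M₁) × IsUniform (system M₂) × IsDirectSum (system M) (system M₁) (system M₂)

-- The third premise says that φ maps B onto B′.
infix 4 _≅_
_≅_ : ∀ {N N′} {E : Subset N} {E′ : Subset N′} → Matroid E → Matroid E′ → Set
_≅_ {E = E} {E′} M M′ = ∃ λ (φ : (∃ λ i → i ∈ E) ↔ (∃ λ j → j ∈ E′)) →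
  ∀ {B B′} → B ⊆ E → B′ ⊆ E′ →
  (∀ e → proj₁ e ∈ B ⇔ proj₁ (Inverse.to φ e) ∈ B′) →
  Basis (system M) B ⇔ Basis (system M′) B′

swap : ∀ {N} → Subset N → Fin N → Fin N → Subset N
swap B x y = (B - x) ∪ ⁅ y ⁆

∈-swap-old : ∀ {N} {B : Subset N} {x y z} → z ∈ B → z ≢ x → z ∈ swap B x y
∈-swap-old z∈B z≢x = x∈p∪q⁺ (inj₁ (x∈p∧x≢y⇒x∈p-y z∈B z≢x))

∈-swap-new : ∀ {N} (B : Subset N) x y → y ∈ swap B x y
∈-swap-new B x y = x∈p∪q⁺ {p = B - x} (inj₂ (x∈⁅x⁆ y))

x∉p-x : ∀ {N} (B : Subset N) x → x ∉ B - x
x∉p-x (_ ∷ B) (suc x) (there x∈) = x∉p-x B x x∈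

∈-swap⁻ : ∀ {N} (B : Subset N) x y {z} → z ∈ swap B x y → (z ∈ B × z ≢ x) ⊎ z ≡ y
∈-swap⁻ B x y z∈ with x∈p∪q⁻ (B - x) ⁅ y ⁆ z∈
... | inj₁ z∈B-x = inj₁ (p─q⊆p B ⁅ x ⁆ z∈B-x , λ { refl → x∉p-x B x z∈B-x })
... | inj₂ z∈y   = inj₂ (x∈⁅y⁆⇒x≡y y z∈y)

∣p-x∣ : ∀ {N} {B : Subset N} {x} → x ∈ B → suc ∣ B - x ∣ ≡ ∣ B ∣
∣p-x∣ {B = inside  ∷ B} here       = cong (suc ∘ ∣_∣) (p─⊥≡p B)
∣p-x∣ {B = inside  ∷ B} (there x∈) = cong suc (∣p-x∣ x∈)
∣p-x∣ {B = outside ∷ B} (there x∈) = ∣p-x∣ x∈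

∣p∪x∣ : ∀ {N} {B : Subset N} {x} → x ∉ B → ∣ B ∪ ⁅ x ⁆ ∣ ≡ suc ∣ B ∣
∣p∪x∣ {B = inside  ∷ B} {zero}  x∉ = ⊥-elim (x∉ here)
∣p∪x∣ {B = outside ∷ B} {zero}  x∉ = cong (suc ∘ ∣_∣) (∪-identityʳ B)
∣p∪x∣ {B = inside  ∷ B} {suc x} x∉ = cong suc (∣p∪x∣ (x∉ ∘ there))
∣p∪x∣ {B = outside ∷ B} {suc x} x∉ = ∣p∪x∣ (x∉ ∘ there)

∣swap∣ : ∀ {N} {B : Subset N} {x y} → x ∈ B → y ∉ B → ∣ swap B x y ∣ ≡ ∣ B ∣
∣swap∣ {B = B} {x} x∈ y∉ = trans (∣p∪x∣ (y∉ ∘ p─q⊆p B ⁅ x ⁆)) (∣p-x∣ x∈)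

differ : ∀ {N} {A B : Subset N} {x} → ∣ A ∣ ≤ ∣ B ∣ → x ∈ A → x ∉ B → ∃ λ y → y ∈ B × y ∉ A
differ {A = A} {B} {x} A≤B x∈A x∉B with Fin.any? (λ y → (y ∈? B) ×-dec ¬? (y ∈? A))
... | yes found = found
... | no none   = ⊥-elim (ℕ.<⇒≱ (p⊂q⇒∣p∣<∣q∣ (B⊆A , x , x∈A , x∉B)) A≤B)
  where
  B⊆A : B ⊆ A
  B⊆A {y} y∈B with y ∈? A
  ... | yes y∈A = y∈A
  ... | no y∉A  = ⊥-elim (none (y , y∈B , y∉A))

choose : ∀ {N} k (E : Subset N) → k ≤ ∣ E ∣ → ∃ λ B → B ⊆ E × ∣ B ∣ ≡ k
choose {N} zero E            _        = ⊥ , (λ x∈ → ⊥-elim (∉⊥ x∈)) , ∣⊥∣≡0 N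
choose (suc k) (outside ∷ E) k≤       =
  let B , B⊆E , eq = choose (suc k) E k≤ in outside ∷ B , out⊆ B⊆E , eq
choose (suc k) (inside  ∷ E) (s≤s k≤) =
  let B , B⊆E , eq = choose k E k≤ in inside ∷ B , s⊆s B⊆E , cong suc eq

swap-⊆ : ∀ {N} {E B : Subset N} {x y} → B ⊆ E → y ∈ E → swap B x y ⊆ E
swap-⊆ {B = B} {x} {y} B⊆E y∈E z∈ with ∈-swap⁻ B x y z∈
... | inj₁ (z∈B , _) = B⊆E z∈B
... | inj₂ refl      = y∈E

swap-∪ : ∀ {N} (B₁ B₂ : Subset N) {x y} → x ∉ B₂ → swap (B₁ ∪ B₂) x y ≡ swap B₁ x y ∪ B₂
swap-∪ B₁ B₂ {x} {y} x∉ = ⊆-antisym to from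
  where
  to : swap (B₁ ∪ B₂) x y ⊆ swap B₁ x y ∪ B₂
  to z∈ with ∈-swap⁻ (B₁ ∪ B₂) x y z∈
  ... | inj₂ refl = x∈p∪q⁺ (inj₁ (∈-swap-new B₁ x y))
  ... | inj₁ (z∈B , z≢x) with x∈p∪q⁻ B₁ B₂ z∈B
  ...   | inj₁ z∈B₁ = x∈p∪q⁺ (inj₁ (∈-swap-old z∈B₁ z≢x))
  ...   | inj₂ z∈B₂ = x∈p∪q⁺ (inj₂ z∈B₂)
  from : swap B₁ x y ∪ B₂ ⊆ swap (B₁ ∪ B₂) x y
  from z∈ with x∈p∪q⁻ (swap B₁ x y) B₂ z∈
  ... | inj₂ z∈B₂ = ∈-swap-old (x∈p∪q⁺ (inj₂ z∈B₂)) (λ { refl → x∉ z∈B₂ })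
  ... | inj₁ z∈s with ∈-swap⁻ B₁ x y z∈s
  ...   | inj₁ (z∈B₁ , z≢x) = ∈-swap-old (x∈p∪q⁺ (inj₁ z∈B₁)) z≢x
  ...   | inj₂ refl         = ∈-swap-new (B₁ ∪ B₂) x y

uniform-isMatroid : ∀ {N k} {E : Subset N} → k ≤ ∣ E ∣ → IsMatroid (uniform k E)
uniform-isMatroid {k = k} {E} k≤ = record
  { nonempty = choose k E k≤
  ; exchange = λ { (B₁⊆ , refl) (B₂⊆ , eq) x∈ x∉ →
      let y , y∈ , y∉ = differ (ℕ.≤-reflexive (sym eq)) x∈ x∉
      in y , y∈ , y∉ , swap-⊆ B₁⊆ (B₂⊆ y∈) , ∣swap∣ x∈ y∉ }
  }

⊕-isMatroid : ∀ {N} {E₁ E₂ : Subset N} {S₁ : SetSystem E₁} {S₂ : SetSystem E₂} →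
              Disjoint E₁ E₂ → IsMatroid S₁ → IsMatroid S₂ → IsMatroid (S₁ ⊕ S₂)
⊕-isMatroid {N} {S₁ = S₁} {S₂} disjoint m₁ m₂ = record
  { nonempty = let B₁ , b₁ = nonempty m₁ ; B₂ , b₂ = nonempty m₂
               in B₁ ∪ B₂ , B₁ , B₂ , b₁ , b₂ , refl
  ; exchange = exchange-⊕
  }
  where
  open IsMatroid
  apart : ∀ {B₁ B₂ x} → Basis S₁ B₁ → Basis S₂ B₂ → x ∈ B₁ → x ∉ B₂
  apart b₁ b₂ x∈₁ x∈₂ = disjoint (_ , x∈p∩q⁺ (Basis⊆ S₁ b₁ x∈₁ , Basis⊆ S₂ b₂ x∈₂))
  ∉-∪ : ∀ {B B′ : Subset N} {x} → x ∉ B → x ∉ B′ → x ∉ B ∪ B′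
  ∉-∪ {B} {B′} x∉ x∉′ x∈ with x∈p∪q⁻ B B′ x∈
  ... | inj₁ x∈B  = x∉ x∈B
  ... | inj₂ x∈B′ = x∉′ x∈B′
  exchange-⊕ : ∀ {B C x} → Basis (S₁ ⊕ S₂) B → Basis (S₁ ⊕ S₂) C → x ∈ B → x ∉ C →
               ∃ λ y → y ∈ C × y ∉ B × Basis (S₁ ⊕ S₂) (swap B x y)
  exchange-⊕ (B₁ , B₂ , b₁ , b₂ , refl) (C₁ , C₂ , c₁ , c₂ , refl) x∈ x∉ with x∈p∪q⁻ B₁ B₂ x∈
  ... | inj₁ x∈₁ =
    let y , y∈ , y∉ , b = exchange m₁ b₁ c₁ x∈₁ (x∉ ∘ x∈p∪q⁺ ∘ inj₁)
    in y , x∈p∪q⁺ (inj₁ y∈) , ∉-∪ y∉ (apart c₁ b₂ y∈) ,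
       _ , _ , b , b₂ , swap-∪ B₁ B₂ (apart b₁ b₂ x∈₁)
  ... | inj₂ x∈₂ =
    let y , y∈ , y∉ , b = exchange m₂ b₂ c₂ x∈₂ (x∉ ∘ x∈p∪q⁺ ∘ inj₂)
    in y , x∈p∪q⁺ (inj₂ y∈) , ∉-∪ (λ y∈₁ → apart b₁ c₂ y∈₁ y∈) y∉ ,
       _ , _ , b₁ , b ,
       trans (cong (λ B → swap B _ y) (∪-comm B₁ B₂))
         (trans (swap-∪ B₂ B₁ (λ x∈₁ → apart b₁ b₂ x∈₁ x∈₂)) (∪-comm _ B₁))

rk-const : ∀ {N} {E : Subset N} (S : SetSystem E) {A m} → ∃ (Basis S) →
           (∀ {B} → Basis S B → ∣ B ∩ A ∣ ≡ m) → rk S A ≡ m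
rk-const S {A} {m} (B , b) const = ℕ.≤-antisym
  (max≤v⁺ z≤n (All.map⁺ (All.map (ℕ.≤-reflexive ∘ const) (All.all-filter (Basis? S) (subsets _)))))
  (subst (_≤ rk S A) (const b)
    (v≤max⁺ 0 _ (inj₂ (Any.map ℕ.≤-reflexive
      (List.∈-map⁺ (λ B → ∣ B ∩ A ∣) (List.∈-filter⁺ (Basis? S) (∈-subsets B) b))))))

∣p∣≡∣p∩∁q∣+∣p∩q∣ : ∀ {N} (p q : Subset N) → ∣ p ∣ ≡ ∣ p ∩ ∁ q ∣ + ∣ p ∩ q ∣
∣p∣≡∣p∩∁q∣+∣p∩q∣ []            []            = refl
∣p∣≡∣p∩∁q∣+∣p∩q∣ (outside ∷ p) (_       ∷ q) = ∣p∣≡∣p∩∁q∣+∣p∩q∣ p q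
∣p∣≡∣p∩∁q∣+∣p∩q∣ (inside  ∷ p) (outside ∷ q) = cong suc (∣p∣≡∣p∩∁q∣+∣p∩q∣ p q)
∣p∣≡∣p∩∁q∣+∣p∩q∣ (inside  ∷ p) (inside  ∷ q) =
  trans (cong suc (∣p∣≡∣p∩∁q∣+∣p∩q∣ p q)) (sym (ℕ.+-suc ∣ p ∩ ∁ q ∣ ∣ p ∩ q ∣))

∁-disjoint : ∀ {N} (F : Subset N) → Disjoint (∁ F) F
∁-disjoint F (x , x∈) = let x∈∁F , x∈F = x∈p∩q⁻ (∁ F) F x∈ in x∈∁p⇒x∉p x∈∁F x∈F

module _ {N a r : ℕ} (F : Subset N) (a≤ : a ≤ ∣ ∁ F ∣) (r≤ : r ≤ ∣ F ∣) where

  private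
    S : SetSystem (∁ F ∪ F)
    S = uniform a (∁ F) ⊕ uniform r F

  uniform⊕uniform-isMatroid : IsMatroid S
  uniform⊕uniform-isMatroid =
    ⊕-isMatroid (∁-disjoint F) (uniform-isMatroid a≤) (uniform-isMatroid r≤)

  private
    parts : ∀ {B} → Basis S B → ∣ B ∩ ∁ F ∣ ≡ a × ∣ B ∩ F ∣ ≡ r
    parts (B₁ , B₂ , (B₁⊆ , refl) , (B₂⊆ , refl) , refl) =
      cong ∣_∣ (⊆-antisym to₁ (λ x∈ → x∈p∩q⁺ (x∈p∪q⁺ (inj₁ x∈) , B₁⊆ x∈))) ,
      cong ∣_∣ (⊆-antisym to₂ (λ x∈ → x∈p∩q⁺ (x∈p∪q⁺ (inj₂ x∈) , B₂⊆ x∈)))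
      where
      to₁ : (B₁ ∪ B₂) ∩ ∁ F ⊆ B₁
      to₁ x∈ with x∈p∩q⁻ (B₁ ∪ B₂) (∁ F) x∈
      ... | x∈B , x∈∁F with x∈p∪q⁻ B₁ B₂ x∈B
      ...   | inj₁ x∈B₁ = x∈B₁
      ...   | inj₂ x∈B₂ = ⊥-elim (x∈∁p⇒x∉p x∈∁F (B₂⊆ x∈B₂))
      to₂ : (B₁ ∪ B₂) ∩ F ⊆ B₂
      to₂ x∈ with x∈p∩q⁻ (B₁ ∪ B₂) F x∈
      ... | x∈B , x∈F with x∈p∪q⁻ B₁ B₂ x∈B
      ...   | inj₁ x∈B₁ = ⊥-elim (x∈∁p⇒x∉p (B₁⊆ x∈B₁) x∈F)
      ...   | inj₂ x∈B₂ = x∈B₂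

    ∣basis∣ : ∀ {B} → Basis S B → ∣ B ∣ ≡ a + r
    ∣basis∣ {B} b = trans (∣p∣≡∣p∩∁q∣+∣p∩q∣ B F) (cong₂ _+_ (proj₁ (parts b)) (proj₂ (parts b)))

    ∁F∪F≡⊤ : ∁ F ∪ F ≡ ⊤
    ∁F∪F≡⊤ = trans (∪-comm (∁ F) F) (p∪∁p≡⊤ F)

    ⊆∁F∪F : ∀ {B} → B ⊆ ∁ F ∪ F
    ⊆∁F∪F _ = subst (_ ∈_) (sym ∁F∪F≡⊤) ∈⊤

    rank≡ : rank S ≡ a + r
    rank≡ = rk-const S (IsMatroid.nonempty uniform⊕uniform-isMatroid) λ {B} b →
      trans (cong ∣_∣ (trans (cong (B ∩_) ∁F∪F≡⊤) (∩-identityʳ B))) (∣basis∣ b)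

    rkF≡ : rk S F ≡ r
    rkF≡ = rk-const S (IsMatroid.nonempty uniform⊕uniform-isMatroid) (proj₂ ∘ parts)

  relax⇒ : ∀ {B} → Basis (relax S F) B → ∣ B ∣ ≡ a + r × r ≤ ∣ B ∩ F ∣
  relax⇒ (inj₁ b) = ∣basis∣ b , ℕ.≤-reflexive (sym (proj₂ (parts b)))
  relax⇒ {B} (inj₂ (_ , ∣B∣≡ , rk<)) =
    trans ∣B∣≡ rank≡ , ℕ.m+n≤o⇒m≤o r (subst (λ m → m + 1 ≤ ∣ B ∩ F ∣) rkF≡ rk<)

  relax⇐ : ∀ {B} → ∣ B ∣ ≡ a + r → r ≤ ∣ B ∩ F ∣ → Basis (relax S F) B
  relax⇐ {B} ∣B∣≡ r≤∣B∩F∣ with ∣ B ∩ F ∣ ℕ.≟ r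
  ... | no ≢r  = inj₂ (⊆∁F∪F , trans ∣B∣≡ (sym rank≡) ,
    subst (_≤ ∣ B ∩ F ∣) (trans (ℕ.+-comm 1 r) (cong (_+ 1) (sym rkF≡)))
      (ℕ.≤∧≢⇒< r≤∣B∩F∣ (≢r ∘ sym)))
  ... | yes ≡r = inj₁ (B ∩ ∁ F , B ∩ F , (p∩q⊆q B (∁ F) , ≡a) , (p∩q⊆q B F , ≡r) , split)
    where
    ≡a : ∣ B ∩ ∁ F ∣ ≡ a
    ≡a = ℕ.+-cancelʳ-≡ r _ a
      (trans (cong (∣ B ∩ ∁ F ∣ +_) (sym ≡r)) (trans (sym (∣p∣≡∣p∩∁q∣+∣p∩q∣ B F)) ∣B∣≡))
    split : B ≡ (B ∩ ∁ F) ∪ (B ∩ F)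
    split = trans (sym (∩-identityʳ B))
      (trans (cong (B ∩_) (sym ∁F∪F≡⊤)) (∩-distribˡ-∪ B (∁ F) F))

  relax-isMatroid : IsMatroid (relax S F)
  relax-isMatroid = record
    { nonempty = let B , b = IsMatroid.nonempty uniform⊕uniform-isMatroid in B , inj₁ b
    ; exchange = λ b₁ b₂ x∈ x∉ →
        let ∣B₁∣≡ , ≥r = relax⇒ b₁ ; ∣B₂∣≡ , ≥r′ = relax⇒ b₂
            y , y∈ , y∉ , ≥r″ = exchange-∩ (trans ∣B₁∣≡ (sym ∣B₂∣≡)) ≥r ≥r′ x∈ x∉
        in y , y∈ , y∉ , relax⇐ (trans (∣swap∣ x∈ y∉) ∣B₁∣≡) ≥r″
    }
    where
    exchange-∩ : ∀ {B C : Subset N} {x} → ∣ B ∣ ≡ ∣ C ∣ → r ≤ ∣ B ∩ F ∣ → r ≤ ∣ C ∩ F ∣ →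
                 x ∈ B → x ∉ C → ∃ λ y → y ∈ C × y ∉ B × r ≤ ∣ swap B x y ∩ F ∣
    exchange-∩ {B} {C} {x} ∣B∣≡∣C∣ r≤B r≤C x∈B x∉C with x ∈? F | ∣ B ∩ F ∣ ℕ.≟ r
    ... | no x∉F | _ =
      let y , y∈ , y∉ = differ (ℕ.≤-reflexive ∣B∣≡∣C∣) x∈B x∉C
      in y , y∈ , y∉ , ℕ.≤-trans r≤B (p⊆q⇒∣p∣≤∣q∣ {p = B ∩ F} {q = swap B x y ∩ F} λ z∈ →
           let z∈B , z∈F = x∈p∩q⁻ B F z∈
           in x∈p∩q⁺ (∈-swap-old {y = y} z∈B (λ { refl → x∉F z∈F }) , z∈F))
    ... | yes x∈F | no ≢r =
      let y , y∈ , y∉ = differ (ℕ.≤-reflexive ∣B∣≡∣C∣) x∈B x∉C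
      in y , y∈ , y∉ , ℕ.≤-trans
           (ℕ.≤-pred (subst (r <_) (sym (∣p-x∣ (x∈p∩q⁺ (x∈B , x∈F)))) (ℕ.≤∧≢⇒< r≤B (≢r ∘ sym))))
           (p⊆q⇒∣p∣≤∣q∣ {p = (B ∩ F) - x} {q = swap B x y ∩ F} λ z∈ →
             let z∈B , z∈F = x∈p∩q⁻ B F (p─q⊆p (B ∩ F) ⁅ x ⁆ z∈)
             in x∈p∩q⁺ (∈-swap-old {y = y} z∈B (λ { refl → x∉p-x (B ∩ F) x z∈ }) , z∈F))
    ... | yes x∈F | yes ≡r =
      let y , y∈C∩F , y∉B∩F = differ (ℕ.≤-trans (ℕ.≤-reflexive ≡r) r≤C)
                                (x∈p∩q⁺ (x∈B , x∈F)) (x∉C ∘ proj₁ ∘ x∈p∩q⁻ C F)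
          y∈C , y∈F = x∈p∩q⁻ C F y∈C∩F
      in y , y∈C , (λ y∈B → y∉B∩F (x∈p∩q⁺ (y∈B , y∈F))) , ℕ.≤-trans
           (ℕ.≤-reflexive (trans (sym ≡r) (sym (∣swap∣ (x∈p∩q⁺ (x∈B , x∈F)) y∉B∩F))))
           (p⊆q⇒∣p∣≤∣q∣ (swap-∩ y∈F))
      where
      swap-∩ : ∀ {y} → y ∈ F → swap (B ∩ F) x y ⊆ swap B x y ∩ F
      swap-∩ {y} y∈F z∈ with ∈-swap⁻ (B ∩ F) x y z∈
      ... | inj₂ refl = x∈p∩q⁺ (∈-swap-new B x y , y∈F)
      ... | inj₁ (z∈B∩F , z≢x) =
        let z∈B , z∈F = x∈p∩q⁻ B F z∈B∩F in x∈p∩q⁺ (∈-swap-old z∈B z≢x , z∈F)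

initial : ℕ → ∀ n → Subset n
initial _       zero    = []
initial zero    (suc n) = outside ∷ initial zero n
initial (suc h) (suc n) = inside ∷ initial h n

∣initial∣ : ∀ {h n} → h ≤ n → ∣ initial h n ∣ ≡ h
∣initial∣ {n = zero}  z≤n       = refl
∣initial∣ {n = suc n} z≤n       = ∣initial∣ {n = n} z≤n
∣initial∣             (s≤s h≤n) = cong suc (∣initial∣ h≤n)

U : ∀ k n → k ≤ n → Matroid (⊤ {n})
U k n k≤n = record
  { system    = uniform k ⊤
  ; isMatroid = uniform-isMatroid (subst (k ≤_) (sym (∣⊤∣≡n n)) k≤n)
  }

-- The first two conditions are implicit in 0 ≤ k - r and 0 ≤ n - h.
Admissible : (r k h n : ℕ) → Set
Admissible r k h n = r ≤ k × h ≤ n × r ≤ h × k ∸ r ≤ n ∸ h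

admissible? : ∀ r k h n → Dec (Admissible r k h n)
admissible? r k h n = (r ℕ.≤? k) ×-dec (h ℕ.≤? n) ×-dec (r ℕ.≤? h) ×-dec (k ∸ r ℕ.≤? n ∸ h)

module _ r k h n (adm : Admissible r k h n) where

  private
    F : Subset n
    F = initial h n

    ∣F∣ : ∣ F ∣ ≡ h
    ∣F∣ = ∣initial∣ (proj₁ (proj₂ adm))

    r≤ : r ≤ ∣ F ∣
    r≤ = subst (r ≤_) (sym ∣F∣) (proj₁ (proj₂ (proj₂ adm)))

    k∸r≤ : k ∸ r ≤ ∣ ∁ F ∣
    k∸r≤ = subst (k ∸ r ≤_) (sym (trans (∣∁p∣≡n∸∣p∣ F) (cong (n ∸_) ∣F∣))) (proj₂ (proj₂ (proj₂ adm)))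

  U⊕U : Matroid (∁ F ∪ F)
  U⊕U = record
    { system    = uniform (k ∸ r) (∁ F) ⊕ uniform r F
    ; isMatroid = uniform⊕uniform-isMatroid F k∸r≤ r≤
    }

  Λ : Matroid (∁ F ∪ F)
  Λ = record
    { system    = relax (system U⊕U) F
    ; isMatroid = relax-isMatroid F k∸r≤ r≤
    }

private
  halves : ∀ ε → ½ ℚ.* ε ℚ.+ ½ ℚ.* ε ≡ ε
  halves ε = trans (sym (ℚ.*-distribʳ-+ ε ½ ½)) (ℚ.*-identityˡ ε)

  half-pos : ∀ {ε} → 0ℚ ℚ.< ε → 0ℚ ℚ.< ½ ℚ.* ε
  half-pos {ε} 0<ε = ℚ.positive⁻¹ (½ ℚ.* ε)
    where instance _ = ℚ.positive 0<ε
                   _ = ℚ.pos*pos⇒pos ½ ε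

  ∣-∣-sum : ∀ {p q r ε} → r ≡ p ℚ.+ q → ℚ.∣ p ∣ ℚ.< ½ ℚ.* ε → ℚ.∣ q ∣ ℚ.< ½ ℚ.* ε → ℚ.∣ r ∣ ℚ.< ε
  ∣-∣-sum {p} {q} {ε = ε} refl p< q< = ℚ.≤-<-trans (ℚ.∣p+q∣≤∣p∣+∣q∣ p q)
    (subst (_ ℚ.<_) (halves ε) (ℚ.+-mono-< p< q<))

  ∣-∣-product : ∀ {a b K δ} → ℚ.∣ a ∣ ℚ.< K → ℚ.∣ b ∣ ℚ.< δ → ℚ.∣ a ℚ.* b ∣ ℚ.< K ℚ.* δ
  ∣-∣-product {a} {b} {K} {δ} a<K b<δ = subst (ℚ._< K ℚ.* δ) (sym (ℚ.∣p*q∣≡∣p∣*∣q∣ a b))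
    (ℚ.≤-<-trans (ℚ.*-monoʳ-≤-nonNeg ℚ.∣ b ∣ (ℚ.<⇒≤ a<K)) (ℚ.*-monoʳ-<-pos K b<δ))
    where instance _ = ℚ.∣-∣-nonNeg b
                   _ = ℚ.positive (ℚ.≤-<-trans (ℚ.0≤∣p∣ a) a<K)

-- Cauchy sequences of rationals; equality of real numbers is _≈ℝ_, not _≡_.
record ℝ : Set where
  field
    seq    : ℕ → ℚ
    cauchy : ∀ ε → 0ℚ ℚ.< ε →
             ∃ λ N → ∀ m n → N ℕ.≤ m → N ℕ.≤ n → ℚ.∣ seq m ℚ.- seq n ∣ ℚ.< ε

open ℝ

infix  4 _≤ℝ_ _≈ℝ_
infixl 6 _+ℝ_
infixl 7 _*ℝ_

_≤ℝ_ : ℝ → ℝ → Set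
x ≤ℝ y = ∀ ε → 0ℚ ℚ.< ε → ∃ λ N → ∀ n → N ℕ.≤ n → seq x n ℚ.≤ seq y n ℚ.+ ε

_≈ℝ_ : ℝ → ℝ → Set
x ≈ℝ y = x ≤ℝ y × y ≤ℝ x

fromℚ : ℚ → ℝ
fromℚ p .seq _ = p
fromℚ p .cauchy ε 0<ε = 0 , λ _ _ _ _ → subst (λ d → ℚ.∣ d ∣ ℚ.< ε) (sym (ℚ.+-inverseʳ p)) 0<ε

0ℝ 1ℝ : ℝ
0ℝ = fromℚ 0ℚ
1ℝ = fromℚ 1ℚ

_+ℝ_ : ℝ → ℝ → ℝ
(x +ℝ y) .seq n = seq x n ℚ.+ seq y n
(x +ℝ y) .cauchy ε 0<ε with cauchy x (½ ℚ.* ε) (half-pos 0<ε) | cauchy y (½ ℚ.* ε) (half-pos 0<ε)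
... | N₁ , close₁ | N₂ , close₂ = N₁ ℕ.⊔ N₂ , λ m n m≥ n≥ →
  ∣-∣-sum (rearrange (seq x m) (seq y m) (seq x n) (seq y n))
    (close₁ m n (ℕ.m⊔n≤o⇒m≤o N₁ N₂ m≥) (ℕ.m⊔n≤o⇒m≤o N₁ N₂ n≥))
    (close₂ m n (ℕ.m⊔n≤o⇒n≤o N₁ N₂ m≥) (ℕ.m⊔n≤o⇒n≤o N₁ N₂ n≥))
  where
  open +-*-Solver
  rearrange : ∀ a b c d → (a ℚ.+ b) ℚ.- (c ℚ.+ d) ≡ (a ℚ.- c) ℚ.+ (b ℚ.- d)
  rearrange = solve 4 (λ a b c d → (a :+ b) :- (c :+ d) := (a :- c) :+ (b :- d)) refl

eventually-bounded : ∀ x → ∃ λ K → ∃ λ N → ∀ n → N ℕ.≤ n → ℚ.∣ seq x n ∣ ℚ.< K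
eventually-bounded x with cauchy x 1ℚ (ℚ.positive⁻¹ 1ℚ)
... | N , close = ℚ.∣ seq x N ∣ ℚ.+ 1ℚ , N , λ n n≥ →
  ℚ.≤-<-trans
    (subst (λ p → ℚ.∣ p ∣ ℚ.≤ ℚ.∣ seq x N ∣ ℚ.+ ℚ.∣ seq x n ℚ.- seq x N ∣)
      (cancel (seq x N) (seq x n)) (ℚ.∣p+q∣≤∣p∣+∣q∣ (seq x N) (seq x n ℚ.- seq x N)))
    (ℚ.+-monoʳ-< ℚ.∣ seq x N ∣ (close n N n≥ ℕ.≤-refl))
  where
  open +-*-Solver
  cancel : ∀ a b → a ℚ.+ (b ℚ.- a) ≡ b
  cancel = solve 2 (λ a b → a :+ (b :- a) := b) refl

shrink : ∀ {K ε} → 0ℚ ℚ.< K → 0ℚ ℚ.< ε → ∃ λ δ → 0ℚ ℚ.< δ × K ℚ.* δ ≡ ε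
shrink {K} {ε} 0<K 0<ε = 1/K ℚ.* ε , 0<δ , cancel
  where
  K>0   = ℚ.positive 0<K
  K≢0   = ℚ.pos⇒nonZero K {{K>0}}
  1/K   = ℚ.1/_ K {{K≢0}}
  1/K>0 = ℚ.1/pos⇒pos K {{K>0}}
  0<δ : 0ℚ ℚ.< 1/K ℚ.* ε
  0<δ = ℚ.positive⁻¹ (1/K ℚ.* ε) {{ℚ.pos*pos⇒pos 1/K {{1/K>0}} ε {{ℚ.positive 0<ε}}}}
  cancel : K ℚ.* (1/K ℚ.* ε) ≡ ε
  cancel = trans (sym (ℚ.*-assoc K 1/K ε))
    (trans (cong (ℚ._* ε) (ℚ.*-inverseʳ K {{K≢0}})) (ℚ.*-identityˡ ε))

product-close : ∀ x y ε → 0ℚ ℚ.< ε →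
                ∃ λ N → ∀ l m n → N ℕ.≤ l → N ℕ.≤ m → N ℕ.≤ n →
                ℚ.∣ seq x l ℚ.* (seq y m ℚ.- seq y n) ∣ ℚ.< ε
product-close x y ε 0<ε =
  let K , A , x<K   = eventually-bounded x
      δ , 0<δ , Kδ≡ε = shrink (ℚ.≤-<-trans (ℚ.0≤∣p∣ (seq x A)) (x<K A ℕ.≤-refl)) 0<ε
      B , close     = cauchy y δ 0<δ
  in A ℕ.⊔ B , λ l m n l≥ m≥ n≥ →
  subst (ℚ.∣ seq x l ℚ.* (seq y m ℚ.- seq y n) ∣ ℚ.<_) Kδ≡ε
    (∣-∣-product {a = seq x l} {b = seq y m ℚ.- seq y n}
      (x<K l (ℕ.m⊔n≤o⇒m≤o A B l≥))
      (close m n (ℕ.m⊔n≤o⇒n≤o A B m≥) (ℕ.m⊔n≤o⇒n≤o A B n≥)))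

_*ℝ_ : ℝ → ℝ → ℝ
(x *ℝ y) .seq n = seq x n ℚ.* seq y n
(x *ℝ y) .cauchy ε 0<ε =
  let N₁ , close₁ = product-close x y (½ ℚ.* ε) (half-pos 0<ε)
      N₂ , close₂ = product-close y x (½ ℚ.* ε) (half-pos 0<ε)
  in N₁ ℕ.⊔ N₂ , λ m n m≥ n≥ →
  ∣-∣-sum (split (seq x m) (seq y m) (seq x n) (seq y n))
    (close₁ m m n (ℕ.m⊔n≤o⇒m≤o N₁ N₂ m≥) (ℕ.m⊔n≤o⇒m≤o N₁ N₂ m≥) (ℕ.m⊔n≤o⇒m≤o N₁ N₂ n≥))
    (close₂ n m n (ℕ.m⊔n≤o⇒n≤o N₁ N₂ n≥) (ℕ.m⊔n≤o⇒n≤o N₁ N₂ m≥) (ℕ.m⊔n≤o⇒n≤o N₁ N₂ n≥))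
  where
  open +-*-Solver
  split : ∀ a b c d → a ℚ.* b ℚ.- c ℚ.* d ≡ a ℚ.* (b ℚ.- d) ℚ.+ d ℚ.* (a ℚ.- c)
  split = solve 4 (λ a b c d → a :* b :- c :* d := a :* (b :- d) :+ d :* (a :- c)) refl

Point : ∀ {N} → Subset N → Set
Point E = ∀ i → i ∈ E → ℝ

vertex : ∀ {N} (E B : Subset N) → Point E
vertex E B i _ = if does (i ∈? B) then 1ℝ else 0ℝ

sumℝ : List ℝ → ℝ
sumℝ = foldr _+ℝ_ 0ℝ

basePolytope : ∀ {N} {E : Subset N} → Matroid E → Pred (Point E) 0ℓ
basePolytope {N} {E} M x = ∃ λ (c : Subset N → ℝ) →
  (∀ {B} → Basis (system M) B → 0ℝ ≤ℝ c B) ×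
  sumℝ (List.map c (bases (system M))) ≈ℝ 1ℝ ×
  (∀ i (i∈E : i ∈ E) →
    x i i∈E ≈ℝ sumℝ (List.map (λ B → c B *ℝ vertex E B i i∈E) (bases (system M))))

indicator : ∀ {p} {P : Set p} → Dec P → ℤ
indicator P? = if does P? then 1ℤ else 0ℤ

open RawMonoid ℤ.+-0-rawMonoid using () renaming (sum to sumℤ)

-- Membership of a real point in a polytope is not decidable constructively, so
-- the value Σᵢ aᵢ 1_{P(Mᵢ)}(x) is taken with respect to a given decision of
-- each x ∈ P(Mᵢ).  It does not depend on which decision is given, and some
-- decision is never refutable, so classically this is exactly Σᵢ aᵢ 1_{P(Mᵢ)} = 0.
IndicatorRelation : ∀ {N s} {E : Subset N} → (Fin s → ℤ) → (Fin s → Matroid E) → Set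
IndicatorRelation a M = ∀ x (x∈P? : ∀ i → Dec (basePolytope (M i) x)) →
  sumℤ (λ i → a i ℤ.* indicator (x∈P? i)) ≡ 0ℤ

module Invariants {c ℓ} (G : AbelianGroup c ℓ) where

  open AbelianGroup G public using (_≈_) renaming (_-_ to infixl 6 _-ᴳ_)
  open AbelianGroup G using (Carrier; ε; _⁻¹)
  open RawMonoid (AbelianGroup.rawMonoid G) public using () renaming (_×_ to infixr 8 _×ᴳ_)
  open Sum (AbelianGroup.monoid G) public using (sum; sum-syntax)

  _·_ : ℤ → Carrier → Carrier
  (ℤ.+ n)    · x = n ×ᴳ x
  ℤ.-[1+ n ] · x = (suc n ×ᴳ x) ⁻¹

  MatroidMap : Set _
  MatroidMap = ∀ {N} {E : Subset N} → Matroid E → Carrier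

  IsInvariant : MatroidMap → Set _
  IsInvariant f = ∀ {N N′} {E : Subset N} {E′ : Subset N′} (M : Matroid E) (M′ : Matroid E′) →
                  M ≅ M′ → f M ≈ f M′

  IsValuation : MatroidMap → Set _
  IsValuation f = ∀ {N s} {E : Subset N} (a : Fin s → ℤ) (M : Fin s → Matroid E) →
                  IndicatorRelation a M → sum (λ i → a i · f (M i)) ≈ ε

  -- A stressed subset of rank r and size h in a matroid of rank k and cardinality n
  -- forces (r , k , h , n) to be admissible, so the default value ε is only ever
  -- multiplied by λ_{r,h} = 0.
  relaxationTerm : MatroidMap → (r k h n : ℕ) → Carrier
  relaxationTerm f r k h n with admissible? r k h n
  ... | yes adm = f (Λ r k h n adm) -ᴳ f (U⊕U r k h n adm)
  ... | no _    = ε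

{-# OPTIONS --safe #-}
-- Relaxing a stressed subset A of rank r in M gives a matroid M′ on the same ground
-- set, in which the other stressed subsets with non-empty cover keep their role,
-- because their covers are disjoint from that of A.  On base polytopes,
--   1_{P(M′)} - 1_{P(M)} = 1_{P(Λ)} - 1_{P(U ⊕ U)},
-- where the bases of Λ and U ⊕ U are the k-subsets B with |B ∩ A| ≥ r and = r: a convex
-- combination of bases of M′ can be rewritten, by basis exchanges that balance |B ∩ A|
-- against |C ∩ A|, so that all its terms lie in M or all in Λ, according to the side of
-- the hyperplane x(A) = r on which the point lies.  In an elementary split matroid
-- every k-subset that is not a basis lies in some cover: in the connected case, a
-- maximal F with M|F connected and |B ∩ F| > rk F is a split flacet.  So relaxing all
-- stressed subsets with non-empty cover leads to a uniform matroid.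

module Submission where

open import Defs
open import Algebra.Bundles using (AbelianGroup)
import Algebra.Properties.AbelianGroup as AbelianGroupProperties
import Algebra.Properties.CommutativeMonoid.Sum as CommutativeMonoidSum
import Algebra.Properties.Monoid.Mult as MonoidMult
import Algebra.Properties.Monoid.Sum as MonoidSum
import Algebra.Solver.CommutativeMonoid as CommutativeMonoidSolver
open import Data.Bool.Base using (Bool; true; false; T; if_then_else_; _∧_; _∨_; not)
open import Data.Bool.Properties using (T-∧; T-∨)
open import Data.Empty using (⊥-elim) renaming (⊥ to 𝟘)
open import Data.Fin.Base using (Fin; zero; suc; toℕ; fromℕ<)
import Data.Fin.Properties as Fin
open import Data.Fin.Subset
open import Data.Fin.Subset.Properties
open import Data.Integer.Base as ℤ using (ℤ; 0ℤ; 1ℤ)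
open import Data.List.Base as List using (List; []; _∷_; _++_; filter; length)
import Data.List.Membership.Propositional as List
import Data.List.Membership.Propositional.Properties as List
open import Data.List.Relation.Unary.All as All using (All; []; _∷_)
import Data.List.Relation.Unary.All.Properties as All
import Data.List.Properties as List
open import Data.List.Extrema.Nat using (max≤v⁺; v≤max⁺)
open import Data.List.Relation.Unary.Any as Any using (Any)
open import Data.List.Relation.Unary.Unique.Propositional using (Unique)
import Data.List.Relation.Unary.Unique.Propositional.Properties as Unique
open import Data.List.Relation.Unary.AllPairs using ([]; _∷_)
open import Data.Nat.Base as ℕ using (ℕ; zero; suc; _+_; _*_; _∸_; _≤_; _<_; z≤n; s≤s; _≤ᵇ_)
open import Data.Nat.ListAction using () renaming (sum to sumℕ)
import Data.Nat.Properties as ℕ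
open import Data.Nat.Solver using () renaming (module +-*-Solver to ℕ-Solver)
open import Data.Product.Base using (∃; ∃₂; _×_; _,_; proj₁; proj₂)
open import Data.Maybe.Base using (Maybe; just; nothing)
open import Data.Rational.Base as ℚ using (ℚ; 0ℚ; 1ℚ; ½)
import Data.Rational.Properties as ℚ
open import Data.Rational.Solver using () renaming (module +-*-Solver to ℚ-Solver)
open import Data.Sum.Base using (_⊎_; inj₁; inj₂; [_,_]′)
open import Data.Sum.Function.Propositional using (_⊎-↔_)
open import Data.Unit.Base using (tt) renaming (⊤ to Unit)
open import Data.Vec.Base as Vec using (Vec; []; _∷_; here; there; lookup; head; tail)
import Data.Vec.Properties as Vec
open import Function.Base using (_∘_; id; case_of_)
open import Function.Bundles using (_⇔_; _↔_; mk⇔; mk↔ₛ′; module Equivalence; module Inverse)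
open import Function.Properties.Inverse using (↔-sym; ↔-trans)
open import Relation.Binary.PropositionalEquality
open import Relation.Nullary.Decidable as Dec using (Dec; yes; no; does; _×-dec_; _⊎-dec_; ¬?)
open import Relation.Nullary.Negation.Core using (¬_)
open import Relation.Unary using (Pred; Decidable)

-- Two obstacles shape the proof. A real number is a Cauchy sequence, so neither the side of the
-- hyperplane on which a point lies nor the larger of two weights can be decided. The rewriting of
-- convex combinations is therefore obtained under double negation. This suffices:
-- `IndicatorRelation` hands over decisions of membership, and the rewriting only has to refute one
-- pattern of answers. Secondly, ranks, restrictions and contractions are awkward to follow through
-- a chain of relaxations. So `Relaxable` describes a stressed subset by conditions on the bases,
-- with numbers k and r fixed once and for all by the initial matroid; in this form the conditions
-- survive the other relaxations. The balancing of B against C is integral. With c = |C ∩ A| - r and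
-- b = r - |B ∩ A|, a multiset of b copies of C and c copies of B has mean intersection r with A,
-- and exchanges turn it into bases of U ⊕ U with the same sum of incidence vectors. Real weights
-- enter only as multiples of such identities.

open ℝ

-- A decision procedure for linear inequalities between cardinalities.

infixr 9 _∩ᶠ_
infixr 8 _∪ᶠ_
infixl 7 _─ᶠ_
infixl 7 _+ᵉ_
infix  6 _⊆ᶠ_ _≡ᶠ_ _≤ᵉ_ _<ᵉ_ _≡ᵉ_
infix  2 _⊢_

data Form (n : ℕ) : Set where
  var            : Fin n → Form n
  _∩ᶠ_ _∪ᶠ_ _─ᶠ_ : Form n → Form n → Form n
  ∁ᶠ             : Form n → Form n

data Expr (n m : ℕ) : Set where
  ∣_∣ᵉ : Form n → Expr n m
  num  : Fin m → Expr n m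
  lit  : ℕ → Expr n m
  _+ᵉ_ : Expr n m → Expr n m → Expr n m

data Fact (n m : ℕ) : Set where
  _⊆ᶠ_ _≡ᶠ_ : Form n → Form n → Fact n m
  _≤ᵉ_ _≡ᵉ_ : Expr n m → Expr n m → Fact n m

-- `lit 1 +ᵉ a` evaluates definitionally to a successor, so hypotheses of type `_<_` fit without
-- conversion.
_<ᵉ_ : ∀ {n m} → Expr n m → Expr n m → Fact n m
a <ᵉ b = lit 1 +ᵉ a ≤ᵉ b

data Problem (n m : ℕ) : Set where
  _⊢_ : List (Fact n m) → Fact n m → Problem n m

⟦_⟧ᶠ : ∀ {n N} → Form n → Vec (Subset N) n → Subset N
⟦ var i ⟧ᶠ  Xs = lookup Xs i
⟦ φ ∩ᶠ ψ ⟧ᶠ Xs = ⟦ φ ⟧ᶠ Xs ∩ ⟦ ψ ⟧ᶠ Xs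
⟦ φ ∪ᶠ ψ ⟧ᶠ Xs = ⟦ φ ⟧ᶠ Xs ∪ ⟦ ψ ⟧ᶠ Xs
⟦ φ ─ᶠ ψ ⟧ᶠ Xs = ⟦ φ ⟧ᶠ Xs ─ ⟦ ψ ⟧ᶠ Xs
⟦ ∁ᶠ φ ⟧ᶠ   Xs = ∁ (⟦ φ ⟧ᶠ Xs)

⟦_⟧ᵉ : ∀ {n m N} → Expr n m → Vec (Subset N) n → Vec ℕ m → ℕ
⟦ ∣ φ ∣ᵉ ⟧ᵉ Xs ks = ∣ ⟦ φ ⟧ᶠ Xs ∣
⟦ num j ⟧ᵉ  Xs ks = lookup ks j
⟦ lit k ⟧ᵉ  Xs ks = k
⟦ a +ᵉ b ⟧ᵉ Xs ks = ⟦ a ⟧ᵉ Xs ks + ⟦ b ⟧ᵉ Xs ks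

⟦_⟧ : ∀ {n m N} → Fact n m → Vec (Subset N) n → Vec ℕ m → Set
⟦ φ ⊆ᶠ ψ ⟧ Xs ks = ⟦ φ ⟧ᶠ Xs ⊆ ⟦ ψ ⟧ᶠ Xs
⟦ φ ≡ᶠ ψ ⟧ Xs ks = ⟦ φ ⟧ᶠ Xs ≡ ⟦ ψ ⟧ᶠ Xs
⟦ a ≤ᵉ b ⟧ Xs ks = ⟦ a ⟧ᵉ Xs ks ≤ ⟦ b ⟧ᵉ Xs ks
⟦ a ≡ᵉ b ⟧ Xs ks = ⟦ a ⟧ᵉ Xs ks ≡ ⟦ b ⟧ᵉ Xs ks

Entails : ∀ {n m N} → Problem n m → Vec (Subset N) n → Vec ℕ m → Set
Entails (Γ ⊢ goal) Xs ks = List.foldr (λ h P → ⟦ h ⟧ Xs ks → P) (⟦ goal ⟧ Xs ks) Γ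

private
  variable
    sv nv N : ℕ

-- Sizes are sums over the points of the ground set, so an inequality follows from
-- the inequalities at the finitely many membership patterns ρ of a point.
eval : Form sv → Vec Bool sv → Bool
eval (var i)  ρ = lookup ρ i
eval (φ ∩ᶠ ψ) ρ = eval φ ρ ∧ eval ψ ρ
eval (φ ∪ᶠ ψ) ρ = eval φ ρ ∨ eval ψ ρ
eval (φ ─ᶠ ψ) ρ = head ((eval φ ρ ∷ []) ─ (eval ψ ρ ∷ []))
eval (∁ᶠ φ)   ρ = not (eval φ ρ)

evalᵉ : Expr sv nv → Vec Bool sv → ℕ
evalᵉ ∣ φ ∣ᵉ   ρ = if eval φ ρ then 1 else 0
evalᵉ (num _)  ρ = 0
evalᵉ (lit _)  ρ = 0
evalᵉ (a +ᵉ b) ρ = evalᵉ a ρ + evalᵉ b ρ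

coefficients : Expr sv nv → Vec ℕ nv
coefficients ∣ _ ∣ᵉ   = Vec.replicate _ 0
coefficients (num j)  = Vec.replicate _ 0 Vec.[ j ]≔ 1
coefficients (lit _)  = Vec.replicate _ 0
coefficients (a +ᵉ b) = Vec.zipWith _+_ (coefficients a) (coefficients b)

constant : Expr sv nv → ℕ
constant ∣ _ ∣ᵉ   = 0
constant (num _)  = 0
constant (lit k)  = k
constant (a +ᵉ b) = constant a + constant b

-- Numerical hypotheses constrain totals, not the membership pattern of a single point; they enter
-- through `search` instead.
consistent : Fact sv nv → Vec Bool sv → Bool
consistent (φ ⊆ᶠ ψ) ρ = not (eval φ ρ) ∨ eval ψ ρ
consistent (φ ≡ᶠ ψ) ρ = if eval φ ρ then eval ψ ρ else not (eval ψ ρ)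
consistent _        ρ = true

everywhere : ∀ sv → (Vec Bool sv → Bool) → Bool
everywhere zero    p = p []
everywhere (suc sv) p = everywhere sv (p ∘ (true ∷_)) ∧ everywhere sv (p ∘ (false ∷_))

_≤ᵛ_ : Vec ℕ nv → Vec ℕ nv → Bool
[]       ≤ᵛ []       = true
(a ∷ as) ≤ᵛ (b ∷ bs) = (a ≤ᵇ b) ∧ (as ≤ᵛ bs)

-- A sufficient test: the numbers range over ℕ, so it is enough to compare separately the
-- contribution of each possible point, the coefficient of each number and the constants.
immediate : List (Fact sv nv) → Expr sv nv → Expr sv nv → Bool
immediate Γ a b =
  everywhere _ (λ ρ → not (List.foldr (λ h → consistent h ρ ∧_) true Γ) ∨ (evalᵉ a ρ ≤ᵇ evalᵉ b ρ)) ∧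
  ((coefficients a ≤ᵛ coefficients b) ∧ (constant a ≤ᵇ constant b))

-- A hypothesis c ≤ d may be used once to replace the goal a ≤ b by a + d ≤ b + c.
search : List (Fact sv nv) → List (Fact sv nv) → Expr sv nv → Expr sv nv → Bool
search Γ []             a b = immediate Γ a b
search Γ (c ≤ᵉ d ∷ Δ)   a b = search Γ Δ (a +ᵉ d) (b +ᵉ c) ∨ search Γ Δ a b
search Γ (c ≡ᵉ d ∷ Δ)   a b =
  search Γ Δ (a +ᵉ d) (b +ᵉ c) ∨ (search Γ Δ (a +ᵉ c) (b +ᵉ d) ∨ search Γ Δ a b)
search Γ (_ ⊆ᶠ _ ∷ Δ)   a b = search Γ Δ a b
search Γ (_ ≡ᶠ _ ∷ Δ)   a b = search Γ Δ a b

valid : Problem sv nv → Bool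
valid (Γ ⊢ a ≤ᵉ b) = search Γ Γ a b
valid (Γ ⊢ a ≡ᵉ b) = search Γ Γ a b ∧ search Γ Γ b a
-- An inclusion is the vanishing of a size, so that equations between sizes can prove inclusions and
-- equalities of sets.
valid (Γ ⊢ φ ⊆ᶠ ψ) = search Γ Γ ∣ φ ∩ᶠ ∁ᶠ ψ ∣ᵉ (lit 0)
valid (Γ ⊢ φ ≡ᶠ ψ) = search Γ Γ ∣ φ ∩ᶠ ∁ᶠ ψ ∣ᵉ (lit 0) ∧ search Γ Γ ∣ ψ ∩ᶠ ∁ᶠ φ ∣ᵉ (lit 0)

Nonempty⇒0<∣p∣ : {p : Subset N} → Nonempty p → 0 < ∣ p ∣
Nonempty⇒0<∣p∣ {p = p} (x , x∈p) = subst (_≤ ∣ p ∣) (∣⁅x⁆∣≡1 x)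
  (p⊆q⇒∣p∣≤∣q∣ λ y∈ → subst (_∈ p) (sym (x∈⁅y⁆⇒x≡y x y∈)) x∈p)

0<∣p∣⇒Nonempty : {p : Subset N} → 0 < ∣ p ∣ → Nonempty p
0<∣p∣⇒Nonempty {N} {p} 0<p with nonempty? p
... | yes ne = ne
... | no e   = ⊥-elim (ℕ.<-irrefl (sym (trans (cong ∣_∣ (Empty-unique e)) (∣⊥∣≡0 N))) 0<p)

-- Soundness of the decision procedure.

private
  T-∧⁻ : ∀ {x y} → T (x ∧ y) → T x × T y
  T-∧⁻ = Equivalence.to T-∧

  everywhere-sound : ∀ sv p → T (everywhere sv p) → ∀ ρ → T (p ρ)
  everywhere-sound zero    p t []          = t
  everywhere-sound (suc sv) p t (true  ∷ ρ) = everywhere-sound sv _ (proj₁ (T-∧⁻ t)) ρ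
  everywhere-sound (suc sv) p t (false ∷ ρ) =
    everywhere-sound sv _ (proj₂ (T-∧⁻ {everywhere sv (p ∘ (true ∷_))} t)) ρ

  -- The case of a difference needs only congruence because `eval` takes its bit from the difference
  -- of one-point subsets.
  ⟦⟧ᶠ-∷ : ∀ (φ : Form sv) (Xs : Vec (Subset (suc N)) sv) →
          ⟦ φ ⟧ᶠ Xs ≡ eval φ (Vec.map head Xs) ∷ ⟦ φ ⟧ᶠ (Vec.map tail Xs)
  ⟦⟧ᶠ-∷ (var i) Xs with lookup Xs i | Vec.lookup-map i head Xs | Vec.lookup-map i tail Xs
  ... | x ∷ X | eq | eq′ = cong₂ _∷_ (sym eq) (sym eq′)
  ⟦⟧ᶠ-∷ (φ ∩ᶠ ψ) Xs = cong₂ _∩_ (⟦⟧ᶠ-∷ φ Xs) (⟦⟧ᶠ-∷ ψ Xs)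
  ⟦⟧ᶠ-∷ (φ ∪ᶠ ψ) Xs = cong₂ _∪_ (⟦⟧ᶠ-∷ φ Xs) (⟦⟧ᶠ-∷ ψ Xs)
  ⟦⟧ᶠ-∷ (φ ─ᶠ ψ) Xs = cong₂ _─_ (⟦⟧ᶠ-∷ φ Xs) (⟦⟧ᶠ-∷ ψ Xs)
  ⟦⟧ᶠ-∷ (∁ᶠ φ)   Xs = cong ∁ (⟦⟧ᶠ-∷ φ Xs)

  ∣∷∣ : ∀ b (X : Subset N) → ∣ b ∷ X ∣ ≡ (if b then 1 else 0) + ∣ X ∣
  ∣∷∣ true  X = refl
  ∣∷∣ false X = refl

  -- The part of the value of an expression that is additive over the points of the ground set.
  sets : Expr sv nv → Vec (Subset N) sv → ℕ
  sets ∣ φ ∣ᵉ   Xs = ∣ ⟦ φ ⟧ᶠ Xs ∣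
  sets (num _)  Xs = 0
  sets (lit _)  Xs = 0
  sets (a +ᵉ b) Xs = sets a Xs + sets b Xs

  interchange : ∀ a b c d → (a + b) + (c + d) ≡ (a + c) + (b + d)
  interchange = solve 4 (λ a b c d → (a :+ b) :+ (c :+ d) := (a :+ c) :+ (b :+ d)) refl
    where open ℕ-Solver

  sets-∷ : ∀ (e : Expr sv nv) (Xs : Vec (Subset (suc N)) sv) →
           sets e Xs ≡ evalᵉ e (Vec.map head Xs) + sets e (Vec.map tail Xs)
  sets-∷ ∣ φ ∣ᵉ   Xs = trans (cong ∣_∣ (⟦⟧ᶠ-∷ φ Xs)) (∣∷∣ (eval φ (Vec.map head Xs)) (⟦ φ ⟧ᶠ (Vec.map tail Xs)))
  sets-∷ (num _)  Xs = refl
  sets-∷ (lit _)  Xs = refl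
  sets-∷ (a +ᵉ b) Xs = trans (cong₂ _+_ (sets-∷ a Xs) (sets-∷ b Xs))
    (interchange (evalᵉ a (Vec.map head Xs)) _ (evalᵉ b (Vec.map head Xs)) _)

  sets-[] : ∀ (e : Expr sv nv) (Xs : Vec (Subset 0) sv) → sets e Xs ≡ 0
  sets-[] ∣ φ ∣ᵉ   Xs with ⟦ φ ⟧ᶠ Xs
  ... | [] = refl
  sets-[] (num _)  Xs = refl
  sets-[] (lit _)  Xs = refl
  sets-[] (a +ᵉ b) Xs = cong₂ _+_ (sets-[] a Xs) (sets-[] b Xs)

  dot : Vec ℕ nv → Vec ℕ nv → ℕ
  dot []       []       = 0
  dot (c ∷ cs) (k ∷ ks) = c * k + dot cs ks

  dot-0 : ∀ (ks : Vec ℕ nv) → dot (Vec.replicate nv 0) ks ≡ 0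
  dot-0 []       = refl
  dot-0 (k ∷ ks) = dot-0 ks

  dot-1 : ∀ (j : Fin nv) ks → dot (Vec.replicate nv 0 Vec.[ j ]≔ 1) ks ≡ lookup ks j
  dot-1 zero    (k ∷ ks) = trans (cong₂ _+_ (ℕ.*-identityˡ k) (dot-0 ks)) (ℕ.+-identityʳ k)
  dot-1 (suc j) (k ∷ ks) = dot-1 j ks

  dot-+ : ∀ (as bs ks : Vec ℕ nv) → dot (Vec.zipWith _+_ as bs) ks ≡ dot as ks + dot bs ks
  dot-+ []       []       []       = refl
  dot-+ (a ∷ as) (b ∷ bs) (k ∷ ks) =
    trans (cong₂ _+_ (ℕ.*-distribʳ-+ k a b) (dot-+ as bs ks)) (interchange (a * k) _ _ _)

  dot-mono : ∀ (as bs ks : Vec ℕ nv) → T (as ≤ᵛ bs) → dot as ks ≤ dot bs ks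
  dot-mono []       []       []       _ = z≤n
  dot-mono (a ∷ as) (b ∷ bs) (k ∷ ks) t = ℕ.+-mono-≤
    (ℕ.*-monoˡ-≤ k (ℕ.≤ᵇ⇒≤ a b (proj₁ (T-∧⁻ t)))) (dot-mono as bs ks (proj₂ (T-∧⁻ {a ≤ᵇ b} t)))

  separate : ∀ (e : Expr sv nv) (Xs : Vec (Subset N) sv) ks →
             ⟦ e ⟧ᵉ Xs ks ≡ sets e Xs + (dot (coefficients e) ks + constant e)
  separate ∣ φ ∣ᵉ  Xs ks = sym (trans (cong (λ d → ∣ ⟦ φ ⟧ᶠ Xs ∣ + (d + 0)) (dot-0 ks)) (ℕ.+-identityʳ _))
  separate (num j) Xs ks = sym (trans (ℕ.+-identityʳ _) (dot-1 j ks))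
  separate (lit k) Xs ks = sym (cong (_+ k) (dot-0 ks))
  separate (a +ᵉ b) Xs ks = begin
    ⟦ a ⟧ᵉ Xs ks + ⟦ b ⟧ᵉ Xs ks
      ≡⟨ cong₂ _+_ (separate a Xs ks) (separate b Xs ks) ⟩
    (sa + (da + ca)) + (sb + (db + cb))
      ≡⟨ rearrange sa da ca sb db cb ⟩
    (sa + sb) + ((da + db) + (ca + cb))
      ≡⟨ cong (λ d → (sa + sb) + (d + (ca + cb))) (dot-+ (coefficients a) (coefficients b) ks) ⟨
    (sa + sb) + (dot (coefficients (a +ᵉ b)) ks + (ca + cb))
      ∎
    where
    open ≡-Reasoning
    sa = sets a Xs
    sb = sets b Xs
    da = dot (coefficients a) ks
    db = dot (coefficients b) ks
    ca = constant a
    cb = constant b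
    rearrange : ∀ sa da ca sb db cb → (sa + (da + ca)) + (sb + (db + cb)) ≡ (sa + sb) + ((da + db) + (ca + cb))
    rearrange = solve 6 (λ sa da ca sb db cb →
      (sa :+ (da :+ ca)) :+ (sb :+ (db :+ cb)) := (sa :+ sb) :+ ((da :+ db) :+ (ca :+ cb))) refl
      where open ℕ-Solver

  SetFact : Fact sv nv → Vec (Subset N) sv → Set
  SetFact (φ ⊆ᶠ ψ) Xs = ⟦ φ ⟧ᶠ Xs ⊆ ⟦ ψ ⟧ᶠ Xs
  SetFact (φ ≡ᶠ ψ) Xs = ⟦ φ ⟧ᶠ Xs ≡ ⟦ ψ ⟧ᶠ Xs
  SetFact (_ ≤ᵉ _) Xs = Unit
  SetFact (_ ≡ᵉ _) Xs = Unit

  allConsistent : List (Fact sv nv) → Vec Bool sv → Bool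
  allConsistent Γ ρ = List.foldr (λ h → consistent h ρ ∧_) true Γ

  ⊆⇒T : ∀ a b {p q : Subset N} → a ∷ p ⊆ b ∷ q → T (not a ∨ b)
  ⊆⇒T false b     a⊆b = tt
  ⊆⇒T true  true  a⊆b = tt
  ⊆⇒T true  false a⊆b with a⊆b here
  ... | ()

  ≡⇒T : ∀ a b → a ≡ b → T (if a then b else not b)
  ≡⇒T true  _ refl = tt
  ≡⇒T false _ refl = tt

  ⊆-∷ : ∀ (φ ψ : Form sv) (Xs : Vec (Subset (suc N)) sv) → ⟦ φ ⟧ᶠ Xs ⊆ ⟦ ψ ⟧ᶠ Xs →
        (eval φ (Vec.map head Xs) ∷ ⟦ φ ⟧ᶠ (Vec.map tail Xs)) ⊆ (eval ψ (Vec.map head Xs) ∷ ⟦ ψ ⟧ᶠ (Vec.map tail Xs))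
  ⊆-∷ φ ψ Xs h = subst₂ _⊆_ (⟦⟧ᶠ-∷ φ Xs) (⟦⟧ᶠ-∷ ψ Xs) h

  ≡-∷ : ∀ (φ ψ : Form sv) (Xs : Vec (Subset (suc N)) sv) → ⟦ φ ⟧ᶠ Xs ≡ ⟦ ψ ⟧ᶠ Xs →
        eval φ (Vec.map head Xs) ∷ ⟦ φ ⟧ᶠ (Vec.map tail Xs) ≡ eval ψ (Vec.map head Xs) ∷ ⟦ ψ ⟧ᶠ (Vec.map tail Xs)
  ≡-∷ φ ψ Xs h = trans (sym (⟦⟧ᶠ-∷ φ Xs)) (trans h (⟦⟧ᶠ-∷ ψ Xs))

  head-consistent : ∀ (h : Fact sv nv) (Xs : Vec (Subset (suc N)) sv) → SetFact h Xs →
                    T (consistent h (Vec.map head Xs))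
  head-consistent (φ ⊆ᶠ ψ) Xs h = ⊆⇒T _ _ {⟦ φ ⟧ᶠ (Vec.map tail Xs)} {⟦ ψ ⟧ᶠ (Vec.map tail Xs)} (⊆-∷ φ ψ Xs h)
  head-consistent (φ ≡ᶠ ψ) Xs h = ≡⇒T (eval φ _) _ (cong head (≡-∷ φ ψ Xs h))
  head-consistent (_ ≤ᵉ _) Xs h = tt
  head-consistent (_ ≡ᵉ _) Xs h = tt

  all-consistent : ∀ (Γ : List (Fact sv nv)) (Xs : Vec (Subset (suc N)) sv) →
                   All (λ h → SetFact h Xs) Γ → T (allConsistent Γ (Vec.map head Xs))
  all-consistent []      Xs []       = tt
  all-consistent (h ∷ Γ) Xs (p ∷ ps) =
    Equivalence.from T-∧ (head-consistent h Xs p , all-consistent Γ Xs ps)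

  tail-SetFact : ∀ (h : Fact sv nv) (Xs : Vec (Subset (suc N)) sv) →
                 SetFact h Xs → SetFact h (Vec.map tail Xs)
  tail-SetFact (φ ⊆ᶠ ψ) Xs h = drop-∷-⊆ (⊆-∷ φ ψ Xs h)
  tail-SetFact (φ ≡ᶠ ψ) Xs h = cong tail (≡-∷ φ ψ Xs h)
  tail-SetFact (_ ≤ᵉ _) Xs h = tt
  tail-SetFact (_ ≡ᵉ _) Xs h = tt

  -- Induction on the ground set: the first point has the pattern `Vec.map head Xs`, which is
  -- consistent with the set hypotheses, and these hypotheses pass to the tails.
  sets-mono : ∀ (Γ : List (Fact sv nv)) (a b : Expr sv nv) →
              (∀ ρ → T (not (allConsistent Γ ρ) ∨ (evalᵉ a ρ ≤ᵇ evalᵉ b ρ))) →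
              ∀ {N} (Xs : Vec (Subset N) sv) → All (λ h → SetFact h Xs) Γ → sets a Xs ≤ sets b Xs
  sets-mono Γ a b t {zero}  Xs hs = ℕ.≤-reflexive (trans (sets-[] a Xs) (sym (sets-[] b Xs)))
  sets-mono Γ a b t {suc N} Xs hs = subst₂ _≤_ (sym (sets-∷ a Xs)) (sym (sets-∷ b Xs))
    (ℕ.+-mono-≤ (pointwise (all-consistent Γ Xs hs) (t (Vec.map head Xs)))
      (sets-mono Γ a b t (Vec.map tail Xs) (All.map (λ {h} → tail-SetFact h Xs) hs)))
    where
    pointwise : ∀ {c x y} → T c → T (not c ∨ (x ≤ᵇ y)) → x ≤ y
    pointwise {true} _ t = ℕ.≤ᵇ⇒≤ _ _ t

  Holds : List (Fact sv nv) → Vec (Subset N) sv → Vec ℕ nv → Set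
  Holds Γ Xs ks = All (λ h → ⟦ h ⟧ Xs ks) Γ

  ⇒SetFact : ∀ (h : Fact sv nv) (Xs : Vec (Subset N) sv) {ks} → ⟦ h ⟧ Xs ks → SetFact h Xs
  ⇒SetFact (φ ⊆ᶠ ψ) Xs h = h
  ⇒SetFact (φ ≡ᶠ ψ) Xs h = h
  ⇒SetFact (_ ≤ᵉ _) Xs h = tt
  ⇒SetFact (_ ≡ᵉ _) Xs h = tt

  immediate-sound : ∀ (Γ : List (Fact sv nv)) a b → T (immediate Γ a b) →
                    ∀ (Xs : Vec (Subset N) sv) ks → Holds Γ Xs ks → ⟦ a ⟧ᵉ Xs ks ≤ ⟦ b ⟧ᵉ Xs ks
  immediate-sound Γ a b t Xs ks hs =
    let t₁ , t₂₃ = T-∧⁻ {everywhere _ (λ ρ → not (allConsistent Γ ρ) ∨ (evalᵉ a ρ ≤ᵇ evalᵉ b ρ))} t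
        t₂ , t₃  = T-∧⁻ {coefficients a ≤ᵛ coefficients b} t₂₃
    in subst₂ _≤_ (sym (separate a Xs ks)) (sym (separate b Xs ks))
         (ℕ.+-mono-≤
           (sets-mono Γ a b (everywhere-sound _ _ t₁) Xs (All.map (λ {h} → ⇒SetFact h Xs) hs))
           (ℕ.+-mono-≤ (dot-mono (coefficients a) (coefficients b) ks t₂) (ℕ.≤ᵇ⇒≤ _ _ t₃)))

  cancel-≤ : ∀ {a b c d} → c ≤ d → a + d ≤ b + c → a ≤ b
  cancel-≤ {a} {b} {c} {d} c≤d a+d≤b+c =
    ℕ.+-cancelʳ-≤ d a b (ℕ.≤-trans a+d≤b+c (ℕ.+-monoʳ-≤ b c≤d))

  search-sound : ∀ (Γ Δ : List (Fact sv nv)) a b → T (search Γ Δ a b) →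
                 ∀ (Xs : Vec (Subset N) sv) ks → Holds Γ Xs ks → Holds Δ Xs ks →
                 ⟦ a ⟧ᵉ Xs ks ≤ ⟦ b ⟧ᵉ Xs ks
  search-sound Γ [] a b t Xs ks hs _ = immediate-sound Γ a b t Xs ks hs
  search-sound Γ (c ≤ᵉ d ∷ Δ) a b t Xs ks hs (k ∷ gs)
    with Equivalence.to (T-∨ {search Γ Δ (a +ᵉ d) (b +ᵉ c)}) t
  ... | inj₁ t₁ = cancel-≤ k (search-sound Γ Δ (a +ᵉ d) (b +ᵉ c) t₁ Xs ks hs gs)
  ... | inj₂ t₂ = search-sound Γ Δ a b t₂ Xs ks hs gs
  search-sound Γ (c ≡ᵉ d ∷ Δ) a b t Xs ks hs (k ∷ gs)
    with Equivalence.to (T-∨ {search Γ Δ (a +ᵉ d) (b +ᵉ c)}) t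
  ... | inj₁ t₁ = cancel-≤ (ℕ.≤-reflexive k) (search-sound Γ Δ (a +ᵉ d) (b +ᵉ c) t₁ Xs ks hs gs)
  ... | inj₂ t₂ with Equivalence.to (T-∨ {search Γ Δ (a +ᵉ c) (b +ᵉ d)}) t₂
  ...   | inj₁ t₃ = cancel-≤ (ℕ.≤-reflexive (sym k)) (search-sound Γ Δ (a +ᵉ c) (b +ᵉ d) t₃ Xs ks hs gs)
  ...   | inj₂ t₄ = search-sound Γ Δ a b t₄ Xs ks hs gs
  search-sound Γ (_ ⊆ᶠ _ ∷ Δ) a b t Xs ks hs (_ ∷ gs) = search-sound Γ Δ a b t Xs ks hs gs
  search-sound Γ (_ ≡ᶠ _ ∷ Δ) a b t Xs ks hs (_ ∷ gs) = search-sound Γ Δ a b t Xs ks hs gs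

  ∣p∩∁q∣≤0⇒p⊆q : (p q : Subset N) → ∣ p ∩ ∁ q ∣ ≤ 0 → p ⊆ q
  ∣p∩∁q∣≤0⇒p⊆q p q ≤0 {x} x∈p with x ∈? q
  ... | yes x∈q = x∈q
  ... | no  x∉q = ⊥-elim (ℕ.<⇒≱ (Nonempty⇒0<∣p∣ (x , x∈p∩q⁺ (x∈p , x∉p⇒x∈∁p x∉q))) ≤0)

  valid-sound : ∀ (Γ : List (Fact sv nv)) g → T (valid (Γ ⊢ g)) →
                ∀ (Xs : Vec (Subset N) sv) ks → Holds Γ Xs ks → ⟦ g ⟧ Xs ks
  valid-sound Γ (a ≤ᵉ b) t Xs ks hs = search-sound Γ Γ a b t Xs ks hs hs
  valid-sound Γ (a ≡ᵉ b) t Xs ks hs =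
    let t₁ , t₂ = T-∧⁻ {search Γ Γ a b} t
    in ℕ.≤-antisym (search-sound Γ Γ a b t₁ Xs ks hs hs) (search-sound Γ Γ b a t₂ Xs ks hs hs)
  valid-sound Γ (φ ⊆ᶠ ψ) t Xs ks hs =
    ∣p∩∁q∣≤0⇒p⊆q (⟦ φ ⟧ᶠ Xs) (⟦ ψ ⟧ᶠ Xs) (search-sound Γ Γ _ _ t Xs ks hs hs)
  valid-sound Γ (φ ≡ᶠ ψ) t Xs ks hs =
    let t₁ , t₂ = T-∧⁻ {search Γ Γ ∣ φ ∩ᶠ ∁ᶠ ψ ∣ᵉ (lit 0)} t
    in ⊆-antisym (∣p∩∁q∣≤0⇒p⊆q (⟦ φ ⟧ᶠ Xs) (⟦ ψ ⟧ᶠ Xs) (search-sound Γ Γ _ _ t₁ Xs ks hs hs))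
                 (∣p∩∁q∣≤0⇒p⊆q (⟦ ψ ⟧ᶠ Xs) (⟦ φ ⟧ᶠ Xs) (search-sound Γ Γ _ _ t₂ Xs ks hs hs))

  curryHolds : ∀ (Γ : List (Fact sv nv)) {g} {Xs : Vec (Subset N) sv} {ks} →
               (Holds Γ Xs ks → ⟦ g ⟧ Xs ks) → Entails (Γ ⊢ g) Xs ks
  curryHolds []      k = k []
  curryHolds (h ∷ Γ) k = λ p → curryHolds Γ (λ ps → k (p ∷ ps))

  entails : ∀ {sv nv N} (P : Problem sv nv) → T (valid P) → ∀ (Xs : Vec (Subset N) sv) ks → Entails P Xs ks
  entails (Γ ⊢ g) t Xs ks = curryHolds Γ (valid-sound Γ g t Xs ks)

N-ary : ℕ → Set → Set → Set
N-ary zero    A B = B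
N-ary (suc n) A B = A → N-ary n A B

apply : ∀ {A B} n → N-ary n A B → Vec A n → B
apply zero    f []       = f
apply (suc n) f (a ∷ as) = apply n (f a) as

Curried : ∀ n {A : Set} → (Vec A n → Set) → Set
Curried zero    P = P []
Curried (suc n) P = ∀ a → Curried n (P ∘ (a ∷_))

curried : ∀ n {A : Set} {P : Vec A n → Set} → (∀ as → P as) → Curried n P
curried zero    p = p []
curried (suc n) p = λ a → curried n (p ∘ (a ∷_))

-- Terms in n subsets and m numbers, given as a function of n + m variables.
Stated : ∀ n m → N-ary n (Form n) (N-ary m (Expr n m) (Problem n m)) → Problem n m
Stated n m P = apply m (apply n P (Vec.tabulate var)) (Vec.tabulate num)

-- The validity argument is implicit: for a concrete problem it computes to the unit type and is
-- inferred, and a problem on which the search fails does not type-check.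
counting : ∀ n m (P : N-ary n (Form n) (N-ary m (Expr n m) (Problem n m))) {_ : T (valid (Stated n m P))} →
           ∀ {N} → Curried n λ (Xs : Vec (Subset N) n) → Curried m λ ks → Entails (Stated n m P) Xs ks
counting n m P {t} = curried n λ Xs → curried m λ ks → entails (Stated n m P) t Xs ks

linear : ∀ m (P : N-ary m (Expr 0 m) (Problem 0 m)) {_ : T (valid (Stated 0 m P))} →
         Curried m λ ks → Entails {N = 0} (Stated 0 m P) [] ks
linear m P {t} = counting 0 m P {t} {0}

-- Bases and ranks.

∈⇒⁅⁆⊆ : ∀ {N} {p : Subset N} {x} → x ∈ p → ⁅ x ⁆ ⊆ p
∈⇒⁅⁆⊆ {p = p} {x} x∈p y∈ = subst (_∈ p) (sym (x∈⁅y⁆⇒x≡y x y∈)) x∈p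

∉⇒⁅⁆⊆∁ : ∀ {N} {p : Subset N} {x} → x ∉ p → ⁅ x ⁆ ⊆ ∁ p
∉⇒⁅⁆⊆∁ x∉p = ∈⇒⁅⁆⊆ (x∉p⇒x∈∁p x∉p)

x∈p─q⁻ : ∀ {N} (p q : Subset N) {x} → x ∈ p ─ q → x ∈ p × x ∉ q
x∈p─q⁻ p q {x} x∈ = p─q⊆p p q x∈ , λ x∈q → x∈∁p⇒x∉p
  (counting 2 0 (λ p q → [] ⊢ p ─ᶠ q ⊆ᶠ ∁ᶠ q) p q x∈) x∈q

disjoint⇒⊆∁ : ∀ {N} {p q : Subset N} → Disjoint p q → p ⊆ ∁ q
disjoint⇒⊆∁ disjoint x∈p = x∉p⇒x∈∁p λ x∈q → disjoint (_ , x∈p∩q⁺ (x∈p , x∈q))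

∣[p∪q]∩r∣≡∣p∣ : ∀ {N} {p q r s : Subset N} → r ⊆ ∁ s → p ⊆ r → q ⊆ s → ∣ (p ∪ q) ∩ r ∣ ≡ ∣ p ∣
∣[p∪q]∩r∣≡∣p∣ {p = p} {q} {r} {s} =
  counting 4 0 (λ p q r s → r ⊆ᶠ ∁ᶠ s ∷ p ⊆ᶠ r ∷ q ⊆ᶠ s ∷ [] ⊢ ∣ (p ∪ᶠ q) ∩ᶠ r ∣ᵉ ≡ᵉ ∣ p ∣ᵉ) p q r s

∣[p∪q]∩s∣≡∣q∣ : ∀ {N} {p q r s : Subset N} → r ⊆ ∁ s → p ⊆ r → q ⊆ s → ∣ (p ∪ q) ∩ s ∣ ≡ ∣ q ∣
∣[p∪q]∩s∣≡∣q∣ {p = p} {q} {r} {s} =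
  counting 4 0 (λ p q r s → r ⊆ᶠ ∁ᶠ s ∷ p ⊆ᶠ r ∷ q ⊆ᶠ s ∷ [] ⊢ ∣ (p ∪ᶠ q) ∩ᶠ s ∣ᵉ ≡ᵉ ∣ q ∣ᵉ) p q r s

p∪[q─p]≡q : ∀ {N} {p q : Subset N} → p ⊆ q → p ∪ (q ─ p) ≡ q
p∪[q─p]≡q {p = p} {q} = counting 2 0 (λ p q → p ⊆ᶠ q ∷ [] ⊢ p ∪ᶠ (q ─ᶠ p) ≡ᶠ q) p q

p⊆∁[q─p] : ∀ {N} (p q : Subset N) → p ⊆ ∁ (q ─ p)
p⊆∁[q─p] = counting 2 0 (λ p q → [] ⊢ p ⊆ᶠ ∁ᶠ (q ─ᶠ p))

∣p∣<∣q∣⇒∃ : ∀ {N} (p q : Subset N) → ∣ p ∣ < ∣ q ∣ → ∃ λ x → x ∈ q × x ∉ p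
∣p∣<∣q∣⇒∃ p q p<q =
  let x , x∈ = 0<∣p∣⇒Nonempty {p = q ─ p} (counting 2 0 (λ p q →
                 ∣ p ∣ᵉ <ᵉ ∣ q ∣ᵉ ∷ [] ⊢ lit 1 ≤ᵉ ∣ q ─ᶠ p ∣ᵉ) p q p<q)
  in x , x∈p─q⁻ q p x∈

interpolate : ∀ {N} m (X Y : Subset N) → X ⊆ Y → ∣ X ∣ ≤ m → m ≤ ∣ Y ∣ →
              ∃ λ Z → X ⊆ Z × Z ⊆ Y × ∣ Z ∣ ≡ m
interpolate m X Y X⊆Y X≤m m≤Y =
  let Z , Z⊆ , ∣Z∣≡ = choose (m ∸ ∣ X ∣) (Y ─ X) (ℕ.m≤n+o⇒m∸n≤o m ∣ X ∣ (counting 2 1 (λ X Y m → X ⊆ᶠ Y ∷ m ≤ᵉ ∣ Y ∣ᵉ ∷ [] ⊢ m ≤ᵉ ∣ X ∣ᵉ +ᵉ ∣ Y ─ᶠ X ∣ᵉ)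
        X Y m X⊆Y m≤Y))
  in X ∪ Z , p⊆p∪q Z ,
     counting 3 0 (λ X Y Z → X ⊆ᶠ Y ∷ Z ⊆ᶠ Y ─ᶠ X ∷ [] ⊢ X ∪ᶠ Z ⊆ᶠ Y) X Y Z X⊆Y Z⊆ ,
     trans (counting 3 0 (λ X Y Z → X ⊆ᶠ Y ∷ Z ⊆ᶠ Y ─ᶠ X ∷ [] ⊢
              ∣ X ∪ᶠ Z ∣ᵉ ≡ᵉ ∣ X ∣ᵉ +ᵉ ∣ Z ∣ᵉ) X Y Z X⊆Y Z⊆)
       (trans (cong (∣ X ∣ +_) ∣Z∣≡) (ℕ.m+[n∸m]≡n X≤m))

-- The measure is a parameter because it is also taken to be `∣ B ─ A ∣`, to maximise an
-- intersection, and `∣ E ─ F ∣`, to obtain a largest set.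
minimalSubset : ∀ {N ℓ} {P : Pred (Subset N) ℓ} → Decidable P → (size : Subset N → ℕ) →
                ∀ {A} → P A → ∃ λ B → P B × (∀ {C} → P C → size B ≤ size C)
minimalSubset {P = P} P? size {A} p = least (suc (size A)) p (ℕ.n<1+n _)
  where
  least : ∀ m {B} → P B → size B < m → ∃ λ B → P B × (∀ {C} → P C → size B ≤ size C)
  least (suc m) {B} b B<1+m with anySubset? (λ C → P? C ×-dec (size C ℕ.<? m))
  ... | yes (C , c , C<m) = least m c C<m
  ... | no none = B , b , λ {C} c → ℕ.≤-trans (ℕ.≤-pred B<1+m) (ℕ.≮⇒≥ λ C<m → none (C , c , C<m))

∣B∩A∣≤rk : ∀ {N} {E : Subset N} (S : SetSystem E) {B} → Basis S B → ∀ A → ∣ B ∩ A ∣ ≤ rk S A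
∣B∩A∣≤rk S {B} b A = v≤max⁺ 0 _ (inj₂ (Any.map ℕ.≤-reflexive
  (List.∈-map⁺ (λ B → ∣ B ∩ A ∣) (List.∈-filter⁺ (Basis? S) (∈-subsets B) b))))

module _ {N : ℕ} {E : Subset N} (S : SetSystem E) (matroid : IsMatroid S) where

  open IsMatroid matroid

  private
    -- Each exchange replaces an element of B outside Y and C by one of C: `B ∩ Y` is kept and
    -- `∣ B ─ C ∣`, bounded by the fuel, drops. The equation between sizes is carried along because
    -- the equicardinality of bases is deduced from it.
    augment-within : ∀ fuel {B C} → ∣ B ─ C ∣ ≤ fuel → ∀ Y → Basis S B → Basis S C →
                     ∃ λ D → Basis S D × ∣ D ∣ ≡ ∣ B ∣ × B ∩ Y ⊆ D × D ─ Y ⊆ C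
    augment-within fuel {B} {C} ≤fuel Y b c with nonempty? ((B ─ Y) ─ C)
    ... | no e = B , b , refl , p∩q⊆p B Y , λ {x} x∈ → case x ∈? C of λ where
            (yes x∈C) → x∈C
            (no x∉C)  → ⊥-elim (e (x , x∈p∧x∉q⇒x∈p─q x∈ x∉C))
    augment-within zero {B} {C} ≤fuel Y b c | yes ne = ⊥-elim (ℕ.<⇒≱ (Nonempty⇒0<∣p∣ ne)
      (counting 3 0 (λ B C Y → ∣ B ─ᶠ C ∣ᵉ ≤ᵉ lit 0 ∷ [] ⊢ ∣ (B ─ᶠ Y) ─ᶠ C ∣ᵉ ≤ᵉ lit 0)
        B C Y ≤fuel))
    augment-within (suc fuel) {B} {C} ≤fuel Y b c | yes (x , x∈) =
      let x∈B─Y , x∉C = x∈p─q⁻ (B ─ Y) C x∈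
          x∈B , x∉Y = x∈p─q⁻ B Y x∈B─Y
          y , y∈C , y∉B , b′ = exchange b c x∈B x∉C
          D , d , ∣D∣ , ⊇ , ⊆C = augment-within fuel (counting 4 1 (λ B C x y k → ∣ B ─ᶠ C ∣ᵉ ≤ᵉ lit 1 +ᵉ k ∷ ∣ x ∣ᵉ ≡ᵉ lit 1 ∷ x ⊆ᶠ B ∷ x ⊆ᶠ ∁ᶠ C ∷ y ⊆ᶠ C ∷ [] ⊢
                 ∣ ((B ─ᶠ x) ∪ᶠ y) ─ᶠ C ∣ᵉ ≤ᵉ k)
            B C ⁅ x ⁆ ⁅ y ⁆ fuel ≤fuel (∣⁅x⁆∣≡1 x) (∈⇒⁅⁆⊆ x∈B) (∉⇒⁅⁆⊆∁ x∉C) (∈⇒⁅⁆⊆ y∈C))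
            Y b′ c
      in D , d , trans ∣D∣ (∣swap∣ x∈B y∉B) , (λ z∈ → ⊇ (counting 4 0 (λ B Y x y → x ⊆ᶠ ∁ᶠ Y ∷ [] ⊢ B ∩ᶠ Y ⊆ᶠ ((B ─ᶠ x) ∪ᶠ y) ∩ᶠ Y)
            B Y ⁅ x ⁆ ⁅ y ⁆ (∉⇒⁅⁆⊆∁ x∉Y) z∈)) , ⊆C

  -- For empty Y the exchanges end in a basis D of the size of B inside C. An element of C outside D
  -- could be exchanged for an element of D outside C, so D = C.
  ∣bases∣≡ : ∀ {B C} → Basis S B → Basis S C → ∣ B ∣ ≡ ∣ C ∣
  ∣bases∣≡ {B} {C} b c with augment-within ∣ B ─ C ∣ ℕ.≤-refl ⊥ b c
  ... | D , d , ∣D∣ , _ , D─⊥⊆C = trans (sym ∣D∣) (cong ∣_∣ (⊆-antisym D⊆C C⊆D))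
    where
    D⊆C : D ⊆ C
    D⊆C = D─⊥⊆C ∘ subst (_ ∈_) (sym (p─⊥≡p D))
    C⊆D : C ⊆ D
    C⊆D {x} x∈C with x ∈? D
    ... | yes x∈D = x∈D
    ... | no x∉D  = let y , y∈D , y∉C , _ = exchange c d x∈C x∉D in ⊥-elim (y∉C (D⊆C y∈D))

  -- An extension of the independent set `B ∩ Y` to a basis whose elements outside Y come from C.
  -- When B is optimal on Y, this glues the part of B inside Y to elements of C outside.
  augment : ∀ {B C} Y → Basis S B → Basis S C → ∃ λ D → Basis S D × B ∩ Y ⊆ D × D ─ Y ⊆ C
  augment {B} {C} Y b c =
    let D , d , _ , ⊇ , ⊆C = augment-within ∣ B ─ C ∣ ℕ.≤-refl Y b c in D , d , ⊇ , ⊆C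

  ∣basis∣≡rank : ∀ {B} → Basis S B → ∣ B ∣ ≡ rank S
  ∣basis∣≡rank {B} b = sym (rk-const S nonempty λ {C} c →
    trans (cong ∣_∣ (C∩E c)) (∣bases∣≡ c b))
    where
    C∩E : ∀ {C} → Basis S C → C ∩ E ≡ C
    C∩E {C} c = counting 2 0 (λ C E → C ⊆ᶠ E ∷ [] ⊢ C ∩ᶠ E ≡ᶠ C) C E (Basis⊆ S c)

  rk-attained : ∀ A → ∃ λ B → Basis S B × ∣ B ∩ A ∣ ≡ rk S A
  -- Bases have equal size, so a smallest part outside A means a largest part inside A.
  rk-attained A with minimalSubset (Basis? S) (λ B → ∣ B ─ A ∣) (proj₂ nonempty)
  ... | B , b , min = B , b , ℕ.≤-antisym (∣B∩A∣≤rk S b A)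
    (max≤v⁺ z≤n (All.map⁺ (All.map (λ {C} c → counting 3 0 (λ B C A → ∣ B ─ᶠ A ∣ᵉ ≤ᵉ ∣ C ─ᶠ A ∣ᵉ ∷ ∣ B ∣ᵉ ≡ᵉ ∣ C ∣ᵉ ∷ [] ⊢ ∣ C ∩ᶠ A ∣ᵉ ≤ᵉ ∣ B ∩ᶠ A ∣ᵉ)
      B C A (min c) (∣bases∣≡ b c)) (All.all-filter (Basis? S) (subsets N)))))

  -- D keeps the optimal `B ∩ X`, since X ⊆ Y. Its elements outside Y lie in C, so it has no more of
  -- them than C and hence at least as many inside Y.
  chain-basis : ∀ {X Y} → X ⊆ Y → ∃ λ B → Basis S B × ∣ B ∩ X ∣ ≡ rk S X × ∣ B ∩ Y ∣ ≡ rk S Y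
  chain-basis {X} {Y} X⊆Y =
    let B , b , B-X = rk-attained X
        C , c , C-Y = rk-attained Y
        D , d , ⊇ , ⊆C = augment Y b c
    in D , d ,
    ℕ.≤-antisym (∣B∩A∣≤rk S d X) (subst (_≤ ∣ D ∩ X ∣) B-X (counting 4 0 (λ B D X Y → X ⊆ᶠ Y ∷ B ∩ᶠ Y ⊆ᶠ D ∷ [] ⊢ ∣ B ∩ᶠ X ∣ᵉ ≤ᵉ ∣ D ∩ᶠ X ∣ᵉ)
      B D X Y X⊆Y ⊇)) ,
    ℕ.≤-antisym (∣B∩A∣≤rk S d Y) (subst (_≤ ∣ D ∩ Y ∣) C-Y (counting 3 0 (λ C D Y → D ─ᶠ Y ⊆ᶠ C ∷ ∣ D ∣ᵉ ≡ᵉ ∣ C ∣ᵉ ∷ [] ⊢ ∣ C ∩ᶠ Y ∣ᵉ ≤ᵉ ∣ D ∩ᶠ Y ∣ᵉ)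
      C D Y ⊆C (∣bases∣≡ d c)))

  -- The sizes of the intersections with one fixed basis are modular; choose a basis that is optimal
  -- for the intersection and the union at once.
  rk-submodular : ∀ X Y → rk S (X ∩ Y) + rk S (X ∪ Y) ≤ rk S X + rk S Y
  rk-submodular X Y =
    let B , b , eq∩ , eq∪ = chain-basis {X ∩ Y} {X ∪ Y} (λ x∈ → p⊆p∪q Y (p∩q⊆p X Y x∈))
    in counting 3 4 (λ B X Y r∩ r∪ rX rY →
         ∣ B ∩ᶠ (X ∩ᶠ Y) ∣ᵉ ≡ᵉ r∩ ∷ ∣ B ∩ᶠ (X ∪ᶠ Y) ∣ᵉ ≡ᵉ r∪ ∷ ∣ B ∩ᶠ X ∣ᵉ ≤ᵉ rX ∷ ∣ B ∩ᶠ Y ∣ᵉ ≤ᵉ rY ∷ []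
         ⊢ r∩ +ᵉ r∪ ≤ᵉ rX +ᵉ rY)
         B X Y (rk S (X ∩ Y)) (rk S (X ∪ Y)) (rk S X) (rk S Y)
         eq∩ eq∪ (∣B∩A∣≤rk S b X) (∣B∩A∣≤rk S b Y)

  rk-mono : ∀ {X Y} → X ⊆ Y → rk S X ≤ rk S Y
  rk-mono {X} {Y} X⊆Y = let B , b , eq = rk-attained X in subst (_≤ rk S Y) eq
    (ℕ.≤-trans (p⊆q⇒∣p∣≤∣q∣ (λ x∈ → let x∈B , x∈X = x∈p∩q⁻ B X x∈ in x∈p∩q⁺ (x∈B , X⊆Y x∈X)))
      (∣B∩A∣≤rk S b Y))

  rk≤∣∣ : ∀ X → rk S X ≤ ∣ X ∣
  rk≤∣∣ X = let B , b , eq = rk-attained X in subst (_≤ ∣ X ∣) eq (∣p∩q∣≤∣q∣ B X)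

-- Stressed subsets and their relaxation.

-- A stressed subset A of rank r with non-empty cover, in a matroid of rank k, as a
-- property of the bases alone.
record Relaxable {N} {E : Subset N} (S : SetSystem E) (k : ℕ) (A : Subset N) (r : ℕ) : Set where
  field
    A⊆E   : A ⊆ E
    size  : ∀ {B} → Basis S B → ∣ B ∣ ≡ k
    bound : ∀ {B} → Basis S B → ∣ B ∩ A ∣ ≤ r
    full  : ∀ {B} → B ⊆ E → ∣ B ∣ ≡ k → ∣ B ∩ A ∣ ≡ r → Basis S B
    r<∣A∣ : r < ∣ A ∣
    r<k   : r < k
    room  : k ≤ r + ∣ E ─ A ∣

open Relaxable public

-- For r ≤ k this is the direct sum of the uniform matroids of rank k - r on E ─ A and of rank r on
-- A, and `enlarge` turns it into Λ; both live on the ground set of the given matroid.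
exactly : ∀ {N} (E : Subset N) → ℕ → Subset N → ℕ → SetSystem E
exactly E k A r .Basis B  = B ⊆ E × ∣ B ∣ ≡ k × ∣ B ∩ A ∣ ≡ r
exactly E k A r .Basis? B = (B ⊆? E) ×-dec (∣ B ∣ ℕ.≟ k) ×-dec (∣ B ∩ A ∣ ℕ.≟ r)
exactly E k A r .Basis⊆   = proj₁

-- Relaxation by A with k and r supplied instead of being computed as ranks, so that they stay the
-- same along a chain of relaxations.
enlarge : ∀ {N} {E : Subset N} → SetSystem E → ℕ → Subset N → ℕ → SetSystem E
enlarge {E = E} S k A r .Basis B  = Basis S B ⊎ (B ⊆ E × ∣ B ∣ ≡ k × r < ∣ B ∩ A ∣)
enlarge {E = E} S k A r .Basis? B =
  Basis? S B ⊎-dec ((B ⊆? E) ×-dec (∣ B ∣ ℕ.≟ k) ×-dec (r ℕ.<? ∣ B ∩ A ∣))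
enlarge S k A r .Basis⊆ (inj₁ b)       = Basis⊆ S b
enlarge S k A r .Basis⊆ (inj₂ (⊆E , _)) = ⊆E

module _ {N : ℕ} {E : Subset N} {S : SetSystem E} {k : ℕ} where

  -- By `full`, the parts of a basis inside and outside A can be chosen independently as soon as
  -- their sizes are r and k - r. This is the source of all bases constructed below from a stressed
  -- subset.
  between : ∀ {A r} → Relaxable S k A r → ∀ X Y → X ⊆ Y → Y ⊆ E →
            ∣ X ∩ A ∣ ≤ r → r ≤ ∣ Y ∩ A ∣ → ∣ X ─ A ∣ + r ≤ k → k ≤ r + ∣ Y ─ A ∣ →
            ∃ λ T → Basis S T × X ⊆ T × T ⊆ Y × ∣ T ∩ A ∣ ≡ r
  between {A} {r} rel X Y X⊆Y Y⊆E X≤ ≤Y X≤′ ≤Y′ =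
    let Z , X⊆Z , Z⊆Y , ∣Z∣ = interpolate r (X ∩ A) (Y ∩ A)
          (counting 3 0 (λ X Y A → X ⊆ᶠ Y ∷ [] ⊢ X ∩ᶠ A ⊆ᶠ Y ∩ᶠ A) X Y A X⊆Y) X≤ ≤Y
        W , X⊆W , W⊆Y , ∣W∣ = interpolate (k ∸ r) (X ─ A) (Y ─ A)
          (counting 3 0 (λ X Y A → X ⊆ᶠ Y ∷ [] ⊢ X ─ᶠ A ⊆ᶠ Y ─ᶠ A) X Y A X⊆Y)
          (ℕ.m+n≤o⇒m≤o∸n _ X≤′) (ℕ.m≤n+o⇒m∸n≤o k r ≤Y′)
        ∣T∩A∣ = trans (counting 4 0 (λ Z W Y A → Z ⊆ᶠ Y ∩ᶠ A ∷ W ⊆ᶠ Y ─ᶠ A ∷ [] ⊢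
                        ∣ (Z ∪ᶠ W) ∩ᶠ A ∣ᵉ ≡ᵉ ∣ Z ∣ᵉ) Z W Y A Z⊆Y W⊆Y) ∣Z∣
        T⊆Y = counting 4 0 (λ Z W Y A → Z ⊆ᶠ Y ∩ᶠ A ∷ W ⊆ᶠ Y ─ᶠ A ∷ [] ⊢ Z ∪ᶠ W ⊆ᶠ Y)
                Z W Y A Z⊆Y W⊆Y
        ∣T∣ = trans (counting 4 0 (λ Z W Y A → Z ⊆ᶠ Y ∩ᶠ A ∷ W ⊆ᶠ Y ─ᶠ A ∷ [] ⊢
                       ∣ Z ∪ᶠ W ∣ᵉ ≡ᵉ ∣ Z ∣ᵉ +ᵉ ∣ W ∣ᵉ) Z W Y A Z⊆Y W⊆Y)
                (trans (cong₂ _+_ ∣Z∣ ∣W∣) (ℕ.m+[n∸m]≡n (ℕ.<⇒≤ (r<k rel))))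
    in Z ∪ W , full rel (λ x∈ → Y⊆E (T⊆Y x∈)) ∣T∣ ∣T∩A∣ ,
       counting 4 0 (λ Z W X A → X ∩ᶠ A ⊆ᶠ Z ∷ X ─ᶠ A ⊆ᶠ W ∷ [] ⊢ X ⊆ᶠ Z ∪ᶠ W)
         Z W X A X⊆Z X⊆W ,
       T⊆Y , ∣T∩A∣

  basis-within : ∀ {A r} → Relaxable S k A r → ∀ Y → Y ⊆ E → r ≤ ∣ Y ∩ A ∣ → k ≤ r + ∣ Y ─ A ∣ →
                 ∃ λ T → Basis S T × T ⊆ Y × ∣ T ∩ A ∣ ≡ r
  basis-within {A} {r} rel Y Y⊆E r≤ k≤ =
    let T , t , _ , T⊆Y , ∣T∩A∣ = between rel ⊥ Y (⊆-min Y) Y⊆E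
          (counting 2 1 (λ o A r → ∣ o ∣ᵉ ≡ᵉ lit 0 ∷ [] ⊢ ∣ o ∩ᶠ A ∣ᵉ ≤ᵉ r)
            ⊥ A r (∣⊥∣≡0 N))
          r≤
          (counting 2 2 (λ o A r k → ∣ o ∣ᵉ ≡ᵉ lit 0 ∷ r <ᵉ k ∷ [] ⊢ ∣ o ─ᶠ A ∣ᵉ +ᵉ r ≤ᵉ k)
            ⊥ A r k (∣⊥∣≡0 N) (r<k rel))
          k≤
    in T , t , T⊆Y , ∣T∩A∣

  private
    module Two {A r} (rel : Relaxable S k A r) {A′ r′} (rel′ : Relaxable S k A′ r′) where

      -- Otherwise `B ∩ A′` has at most r elements in A, and fewer than k - r outside because B has
      -- more than r elements in A. It therefore extends to a basis, which meets A′ in more than r′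
      -- elements.
      small-meet : ∀ {B} → B ⊆ E → ∣ B ∣ ≡ k → r < ∣ B ∩ A ∣ → r′ < ∣ B ∩ A′ ∣ → ¬ (∣ B ∩ (A ∩ A′) ∣ ≤ r)
      small-meet {B} B⊆E ∣B∣ r<B r′<B meet≤ =
        let T , t , ⊆T , _ , _ = between rel (B ∩ A′) E (λ x∈ → B⊆E (p∩q⊆p B A′ x∈)) ⊆-refl
              (counting 3 1 (λ B A A′ r → ∣ B ∩ᶠ (A ∩ᶠ A′) ∣ᵉ ≤ᵉ r ∷ [] ⊢ ∣ (B ∩ᶠ A′) ∩ᶠ A ∣ᵉ ≤ᵉ r)
                B A A′ r meet≤)
              (counting 2 1 (λ E A r → A ⊆ᶠ E ∷ r <ᵉ ∣ A ∣ᵉ ∷ [] ⊢ r ≤ᵉ ∣ E ∩ᶠ A ∣ᵉ)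
                E A r (A⊆E rel) (r<∣A∣ rel))
              (counting 3 2 (λ B A A′ r k → ∣ B ∣ᵉ ≡ᵉ k ∷ r <ᵉ ∣ B ∩ᶠ A ∣ᵉ ∷ [] ⊢
                  ∣ (B ∩ᶠ A′) ─ᶠ A ∣ᵉ +ᵉ r ≤ᵉ k) B A A′ r k ∣B∣ r<B)
              (room rel)
        in ℕ.<⇒≱ r′<B (counting 3 1 (λ B T A′ r′ →
             B ∩ᶠ A′ ⊆ᶠ T ∷ ∣ T ∩ᶠ A′ ∣ᵉ ≤ᵉ r′ ∷ [] ⊢ ∣ B ∩ᶠ A′ ∣ᵉ ≤ᵉ r′)
             B T A′ r′ ⊆T (bound rel′ t))

      private
        -- A basis inside Y that meets A in r elements meets it only within A ∩ A′, and so has at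
        -- least r elements in A′.
        Y = (A ∩ A′) ∪ (E ─ A)

        Y⊆E : Y ⊆ E
        Y⊆E = counting 3 0 (λ E A A′ → A ⊆ᶠ E ∷ [] ⊢ (A ∩ᶠ A′) ∪ᶠ (E ─ᶠ A) ⊆ᶠ E)
                E A A′ (A⊆E rel)

        k≤ : k ≤ r + ∣ Y ─ A ∣
        k≤ = counting 3 2 (λ E A A′ r k → k ≤ᵉ r +ᵉ ∣ E ─ᶠ A ∣ᵉ ∷ [] ⊢
               k ≤ᵉ r +ᵉ ∣ ((A ∩ᶠ A′) ∪ᶠ (E ─ᶠ A)) ─ᶠ A ∣ᵉ) E A A′ r k (room rel)

        r≤ : r ≤ ∣ A ∩ A′ ∣ → r ≤ ∣ Y ∩ A ∣
        r≤ = counting 3 1 (λ E A A′ r → r ≤ᵉ ∣ A ∩ᶠ A′ ∣ᵉ ∷ [] ⊢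
               r ≤ᵉ ∣ ((A ∩ᶠ A′) ∪ᶠ (E ─ᶠ A)) ∩ᶠ A ∣ᵉ) E A A′ r

      rank-≮ : r ≤ ∣ A ∩ A′ ∣ → ¬ (r′ < r)
      rank-≮ r≤meet r′<r =
        let T , t , T⊆Y , ∣T∩A∣ = basis-within rel Y Y⊆E (r≤ r≤meet) k≤
        in ℕ.<⇒≱ r′<r (counting 4 2 (λ T E A A′ r r′ →
             T ⊆ᶠ (A ∩ᶠ A′) ∪ᶠ (E ─ᶠ A) ∷ ∣ T ∩ᶠ A ∣ᵉ ≡ᵉ r ∷ ∣ T ∩ᶠ A′ ∣ᵉ ≤ᵉ r′ ∷ [] ⊢ r ≤ᵉ r′)
             T E A A′ r r′ T⊆Y ∣T∩A∣ (bound rel′ t))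

      -- A basis inside Y through z would meet A′ in r elements of A ∩ A′ and, in addition, in z.
      equal-rank-⊆ : r ≤ ∣ A ∩ A′ ∣ → r ≡ r′ → ∀ {z} → z ∈ A′ → ¬ (z ∉ A)
      equal-rank-⊆ r≤meet refl {z} z∈A′ z∉A =
        let T , t , ⊆T , T⊆Y , ∣T∩A∣ = between rel ⁅ z ⁆ Y
              (counting 4 0 (λ z A A′ E → z ⊆ᶠ A′ ∷ z ⊆ᶠ ∁ᶠ A ∷ A′ ⊆ᶠ E ∷ [] ⊢
                  z ⊆ᶠ (A ∩ᶠ A′) ∪ᶠ (E ─ᶠ A)) ⁅ z ⁆ A A′ E z⊆A′ z⊆∁A (A⊆E rel′))
              Y⊆E
              (counting 2 1 (λ z A r → z ⊆ᶠ ∁ᶠ A ∷ [] ⊢ ∣ z ∩ᶠ A ∣ᵉ ≤ᵉ r) ⁅ z ⁆ A r z⊆∁A)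
              (r≤ r≤meet)
              (counting 2 2 (λ z A r k → ∣ z ∣ᵉ ≡ᵉ lit 1 ∷ r <ᵉ k ∷ [] ⊢ ∣ z ─ᶠ A ∣ᵉ +ᵉ r ≤ᵉ k)
                ⁅ z ⁆ A r k (∣⁅x⁆∣≡1 z) (r<k rel))
              k≤
        in ℕ.<⇒≱ (ℕ.n<1+n r) (counting 5 1 (λ T z E A A′ r →
             T ⊆ᶠ (A ∩ᶠ A′) ∪ᶠ (E ─ᶠ A) ∷ z ⊆ᶠ T ∷ z ⊆ᶠ A′ ∷ z ⊆ᶠ ∁ᶠ A ∷ ∣ z ∣ᵉ ≡ᵉ lit 1 ∷
             ∣ T ∩ᶠ A ∣ᵉ ≡ᵉ r ∷ ∣ T ∩ᶠ A′ ∣ᵉ ≤ᵉ r ∷ [] ⊢ lit 1 +ᵉ r ≤ᵉ r)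
             T ⁅ z ⁆ E A A′ r T⊆Y ⊆T z⊆A′ z⊆∁A (∣⁅x⁆∣≡1 z) ∣T∩A∣ (bound rel′ t))
        where
        z⊆A′ : ⁅ z ⁆ ⊆ A′
        z⊆A′ = ∈⇒⁅⁆⊆ z∈A′
        z⊆∁A : ⁅ z ⁆ ⊆ ∁ A
        z⊆∁A = ∉⇒⁅⁆⊆∁ z∉A

  -- A set in both covers has more than r and more than r′ elements in A ∩ A′ by `small-meet`. Bases
  -- with their A-part in A ∩ A′ then give r = r′ and, by symmetry, both inclusions between A and
  -- A′.
  covers-disjoint : ∀ {A r A′ r′} → Relaxable S k A r → Relaxable S k A′ r′ → A ≢ A′ →
                    ∀ {B} → B ⊆ E → ∣ B ∣ ≡ k → r < ∣ B ∩ A ∣ → ∣ B ∩ A′ ∣ ≤ r′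
  covers-disjoint {A} {r} {A′} {r′} rel rel′ A≢A′ {B} B⊆E ∣B∣ r<B = ℕ.≮⇒≥ λ r′<B →
    let r<meet = ℕ.≰⇒> (Two.small-meet rel rel′ B⊆E ∣B∣ r<B r′<B)
        r′<meet = ℕ.≰⇒> (Two.small-meet rel′ rel B⊆E ∣B∣ r′<B r<B)
        r≤ = counting 3 1 (λ B A A′ r → r <ᵉ ∣ B ∩ᶠ (A ∩ᶠ A′) ∣ᵉ ∷ [] ⊢ r ≤ᵉ ∣ A ∩ᶠ A′ ∣ᵉ)
               B A A′ r r<meet
        r′≤ = counting 3 1 (λ B A A′ r → r <ᵉ ∣ B ∩ᶠ (A ∩ᶠ A′) ∣ᵉ ∷ [] ⊢ r ≤ᵉ ∣ A ∩ᶠ A′ ∣ᵉ)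
               B A′ A r′ r′<meet
        r≡r′ = ℕ.≤-antisym (ℕ.≮⇒≥ (Two.rank-≮ rel rel′ r≤)) (ℕ.≮⇒≥ (Two.rank-≮ rel′ rel r′≤))
        ⊆-from : ∀ {p q : Subset N} → (∀ {z} → z ∈ p → ¬ (z ∉ q)) → p ⊆ q
        ⊆-from h {z} z∈p = Dec.decidable-stable (z ∈? _) (h z∈p)
    in A≢A′ (⊆-antisym (⊆-from (Two.equal-rank-⊆ rel′ rel r′≤ (sym r≡r′)))
                       (⊆-from (Two.equal-rank-⊆ rel rel′ r≤ r≡r′)))

  module _ {A r} (rel : Relaxable S k A r) where

    enlarge-size : ∀ {B} → Basis (enlarge S k A r) B → ∣ B ∣ ≡ k
    enlarge-size (inj₁ b)            = size rel b
    enlarge-size (inj₂ (_ , ∣B∣ , _)) = ∣B∣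

    r≤⇒enlarge : ∀ {B} → B ⊆ E → ∣ B ∣ ≡ k → r ≤ ∣ B ∩ A ∣ → Basis (enlarge S k A r) B
    r≤⇒enlarge {B} B⊆E ∣B∣ r≤ with r ℕ.≟ ∣ B ∩ A ∣
    ... | yes r≡ = inj₁ (full rel B⊆E ∣B∣ (sym r≡))
    ... | no r≢  = inj₂ (B⊆E , ∣B∣ , ℕ.≤∧≢⇒< r≤ r≢)

    enlarge-isMatroid : IsMatroid S → IsMatroid (enlarge S k A r)
    enlarge-isMatroid matroid = record
      { nonempty = proj₁ nonempty , inj₁ (proj₂ nonempty)
      ; exchange = exchange-enlarge
      }
      where
      open IsMatroid matroid
      R = enlarge S k A r
      -- T stands in for C, which need not be a basis of S. An element of T outside B lies in C, so
      -- an exchange against T is one against C. As B - x has fewer than r elements in A, it has at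
      -- least k - r outside A, enough for T.
      basis-within-C∪B : ∀ {B C x} → Basis S B → C ⊆ E → r < ∣ C ∩ A ∣ → x ∈ B → ∣ (B - x) ∩ A ∣ < r →
                         ∃ λ T → Basis S T × (∀ {z} → z ∈ T → z ∈ C ⊎ z ∈ B - x)
      basis-within-C∪B {B} {C} {x} b C⊆E r<C x∈B <r =
        case basis-within rel ((C ∩ A) ∪ ((B - x) ─ A))
          (counting 5 0 (λ B C x A E → B ⊆ᶠ E ∷ C ⊆ᶠ E ∷ [] ⊢ (C ∩ᶠ A) ∪ᶠ ((B ─ᶠ x) ─ᶠ A) ⊆ᶠ E)
            B C ⁅ x ⁆ A E (Basis⊆ S b) C⊆E)
          (counting 3 1 (λ C D A r → r <ᵉ ∣ C ∩ᶠ A ∣ᵉ ∷ [] ⊢ r ≤ᵉ ∣ ((C ∩ᶠ A) ∪ᶠ (D ─ᶠ A)) ∩ᶠ A ∣ᵉ)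
            C (B - x) A r r<C)
          (counting 3 2 (λ C D A r k → lit 1 +ᵉ ∣ D ∣ᵉ ≡ᵉ k ∷ ∣ D ∩ᶠ A ∣ᵉ <ᵉ r ∷ [] ⊢
              k ≤ᵉ r +ᵉ ∣ ((C ∩ᶠ A) ∪ᶠ (D ─ᶠ A)) ─ᶠ A ∣ᵉ)
            C (B - x) A r k (trans (∣p-x∣ {B = B} x∈B) (size rel b)) <r)
        of λ (T , t , T⊆ , _) → T , t , λ {_} z∈T →
          [ inj₁ ∘ p∩q⊆p C A , inj₂ ∘ p─q⊆p (B - x) A ]′ (x∈p∪q⁻ (C ∩ A) ((B - x) ─ A) (T⊆ z∈T))

      Exchange : (B C : Subset N) → Fin N → Set
      Exchange B C x = ∃ λ y → y ∈ C × y ∉ B × Basis R (swap B x y)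

      -- Here every y of C outside B will do: what remains of B has r elements in A, and every
      -- k-subset with that many is a basis of the relaxation.
      exchange-above : ∀ {B C x} → Basis R B → Basis R C → x ∈ B → x ∉ C → r ≤ ∣ (B - x) ∩ A ∣ → Exchange B C x
      exchange-above {B} {C} {x} b c x∈B x∉C r≤ =
        case differ {A = B} {C} (ℕ.≤-reflexive (trans (enlarge-size b) (sym (enlarge-size c)))) x∈B x∉C of λ (y , y∈C , y∉B) →
          y , y∈C , y∉B , r≤⇒enlarge {swap B x y} (swap-⊆ (Basis⊆ R b) (Basis⊆ R c y∈C))
            (trans (∣swap∣ {B = B} x∈B y∉B) (enlarge-size b))
            (counting 3 1 (λ D y A r → r ≤ᵉ ∣ D ∩ᶠ A ∣ᵉ ∷ [] ⊢ r ≤ᵉ ∣ (D ∪ᶠ y) ∩ᶠ A ∣ᵉ)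
              (B - x) ⁅ y ⁆ A r r≤)

      exchange-below : ∀ {B C x} → Basis R B → Basis R C → x ∈ B → x ∉ C → ∣ (B - x) ∩ A ∣ < r → Exchange B C x
      exchange-below {B} {C} {x} (inj₂ (_ , _ , r<B)) c x∈B x∉C <r = ⊥-elim (ℕ.<⇒≱ <r
        (counting 3 1 (λ B x A r → r <ᵉ ∣ B ∩ᶠ A ∣ᵉ ∷ ∣ x ∣ᵉ ≡ᵉ lit 1 ∷ [] ⊢ r ≤ᵉ ∣ (B ─ᶠ x) ∩ᶠ A ∣ᵉ)
          B ⁅ x ⁆ A r r<B (∣⁅x⁆∣≡1 x)))
      exchange-below (inj₁ b) (inj₁ c) x∈B x∉C _ =
        case exchange b c x∈B x∉C of λ (y , y∈C , y∉B , d) → y , y∈C , y∉B , inj₁ d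
      exchange-below {B} {C} {x} (inj₁ b) (inj₂ (C⊆E , _ , r<C)) x∈B x∉C <r =
        case basis-within-C∪B b C⊆E r<C x∈B <r of λ (T , t , T⊆) →
        case exchange b t x∈B (λ x∈T → [ x∉C , x∉p-x B x ]′ (T⊆ x∈T)) of λ (y , y∈T , y∉B , d) →
          y , [ id , (λ y∈ → ⊥-elim (y∉B (p─q⊆p B ⁅ x ⁆ y∈))) ]′ (T⊆ y∈T) , y∉B , inj₁ d

      exchange-enlarge : ∀ {B C x} → Basis R B → Basis R C → x ∈ B → x ∉ C → Exchange B C x
      exchange-enlarge {B} {C} {x} b c x∈B x∉C =
        [ exchange-above b c x∈B x∉C , exchange-below b c x∈B x∉C ]′ (ℕ.≤-<-connex r ∣ (B - x) ∩ A ∣)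

    enlarge-relaxable : ∀ {A′ r′} → A ≢ A′ → Relaxable S k A′ r′ → Relaxable (enlarge S k A r) k A′ r′
    enlarge-relaxable A≢A′ rel′ = record
      { A⊆E   = A⊆E rel′
      ; size  = enlarge-size
      ; bound = λ { (inj₁ b) → bound rel′ b
                  ; (inj₂ (⊆E , ∣B∣ , r<)) → covers-disjoint rel rel′ A≢A′ ⊆E ∣B∣ r< }
      ; full  = λ ⊆E ∣B∣ ∣B∩A∣ → inj₁ (full rel′ ⊆E ∣B∣ ∣B∩A∣)
      ; r<∣A∣ = r<∣A∣ rel′
      ; r<k   = r<k rel′
      ; room  = room rel′
      }

    private
      towards : ∀ {B C} → Basis S B → ∣ B ∩ A ∣ < r → C ⊆ E → ∣ C ∣ ≡ k → r < ∣ C ∩ A ∣ →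
                ∃ λ T → Basis S T × (B ∩ C) ─ A ⊆ T × T ⊆ (C ∩ A) ∪ (B ─ A) × ∣ T ∩ A ∣ ≡ r
      towards {B} {C} b B<r C⊆E ∣C∣ r<C = between rel ((B ∩ C) ─ A) ((C ∩ A) ∪ (B ─ A))
        (counting 3 0 (λ B C A → [] ⊢ (B ∩ᶠ C) ─ᶠ A ⊆ᶠ (C ∩ᶠ A) ∪ᶠ (B ─ᶠ A)) B C A)
        (counting 4 0 (λ B C A E → B ⊆ᶠ E ∷ C ⊆ᶠ E ∷ [] ⊢ (C ∩ᶠ A) ∪ᶠ (B ─ᶠ A) ⊆ᶠ E)
          B C A E (Basis⊆ S b) C⊆E)
        (counting 3 1 (λ B C A r → [] ⊢ ∣ ((B ∩ᶠ C) ─ᶠ A) ∩ᶠ A ∣ᵉ ≤ᵉ r) B C A r)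
        (counting 3 1 (λ B C A r → r <ᵉ ∣ C ∩ᶠ A ∣ᵉ ∷ [] ⊢ r ≤ᵉ ∣ ((C ∩ᶠ A) ∪ᶠ (B ─ᶠ A)) ∩ᶠ A ∣ᵉ)
          B C A r r<C)
        (counting 3 2 (λ B C A r k → r <ᵉ ∣ C ∩ᶠ A ∣ᵉ ∷ ∣ C ∣ᵉ ≡ᵉ k ∷ [] ⊢
            ∣ ((B ∩ᶠ C) ─ᶠ A) ─ᶠ A ∣ᵉ +ᵉ r ≤ᵉ k) B C A r k r<C ∣C∣)
        (counting 3 2 (λ B C A r k → ∣ B ∩ᶠ A ∣ᵉ <ᵉ r ∷ ∣ B ∣ᵉ ≡ᵉ k ∷ [] ⊢
            k ≤ᵉ r +ᵉ ∣ ((C ∩ᶠ A) ∪ᶠ (B ─ᶠ A)) ─ᶠ A ∣ᵉ) B C A r k B<r (size rel b))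

    -- T keeps B ∩ C outside A and lies in C inside A, so exchanging an element
    -- x ∉ A of B for one of T stays within what C offers.
    exchange-towards : IsMatroid S → ∀ {B C} → Basis S B → ∣ B ∩ A ∣ < r →
                       C ⊆ E → ∣ C ∣ ≡ k → r < ∣ C ∩ A ∣ →
                       ∃₂ λ x y → x ∈ B ─ A × x ∉ C × y ∈ C ∩ A × y ∉ B × Basis S (swap B x y)
    exchange-towards matroid {B} {C} b B<r C⊆E ∣C∣ r<C =
      case towards b B<r C⊆E ∣C∣ r<C of λ (T , t , ⊆T , T⊆ , ∣T∩A∣) →
      case ∣p∣<∣q∣⇒∃ (T ─ A) (B ─ A)
        (counting 3 1 (λ B T A r → ∣ B ∩ᶠ A ∣ᵉ <ᵉ r ∷ ∣ T ∩ᶠ A ∣ᵉ ≡ᵉ r ∷ ∣ B ∣ᵉ ≡ᵉ ∣ T ∣ᵉ ∷ [] ⊢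
            ∣ T ─ᶠ A ∣ᵉ <ᵉ ∣ B ─ᶠ A ∣ᵉ) B T A r
          B<r ∣T∩A∣ (trans (size rel b) (sym (size rel t)))) of λ (x , x∈B─A , x∉T─A) →
      let x∈B , x∉A = x∈p─q⁻ B A x∈B─A
          x∉T = λ (x∈T : x ∈ T) → x∉T─A (x∈p∧x∉q⇒x∈p─q x∈T x∉A)
      in case IsMatroid.exchange matroid b t x∈B x∉T of λ (y , y∈T , y∉B , d) →
         x , y , x∈B─A , (λ x∈C → x∉T (⊆T (x∈p∧x∉q⇒x∈p─q (x∈p∩q⁺ (x∈B , x∈C)) x∉A))) ,
         [ id , (λ y∈ → ⊥-elim (y∉B (p─q⊆p B A y∈))) ]′ (x∈p∪q⁻ (C ∩ A) (B ─ A) (T⊆ y∈T)) ,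
         y∉B , d

    exactly-relaxable : Relaxable (exactly E k A r) k A r
    exactly-relaxable = record
      { A⊆E   = A⊆E rel
      ; size  = λ (_ , ∣B∣ , _) → ∣B∣
      ; bound = λ (_ , _ , ∣B∩A∣) → ℕ.≤-reflexive ∣B∩A∣
      ; full  = λ ⊆E ∣B∣ ∣B∩A∣ → ⊆E , ∣B∣ , ∣B∩A∣
      ; r<∣A∣ = r<∣A∣ rel
      ; r<k   = r<k rel
      ; room  = room rel
      }

-- An exchange stays on the side, A or E ─ A, of the removed element; both bases have equally many
-- elements there.
exactly-isMatroid : ∀ {N} {E : Subset N} {S : SetSystem E} {k A r} → Relaxable S k A r → IsMatroid (exactly E k A r)
exactly-isMatroid {N} {E} {S} {k} {A} {r} rel = record
  { nonempty = let T , t , _ = basis-within (exactly-relaxable rel) E ⊆-refl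
                     (counting 2 1 (λ E A r → A ⊆ᶠ E ∷ r <ᵉ ∣ A ∣ᵉ ∷ [] ⊢ r ≤ᵉ ∣ E ∩ᶠ A ∣ᵉ)
                       E A r (A⊆E rel) (r<∣A∣ rel)) (room rel)
               in T , t
  ; exchange = exchange-exactly
  }
  where
  exchange-exactly : ∀ {B C x} → Basis (exactly E k A r) B → Basis (exactly E k A r) C → x ∈ B → x ∉ C →
                     ∃ λ y → y ∈ C × y ∉ B × Basis (exactly E k A r) (swap B x y)
  exchange-exactly {B} {C} {x} (B⊆E , ∣B∣ , B∩A) (C⊆E , ∣C∣ , C∩A) x∈B x∉C with x ∈? A
  ... | yes x∈A =
    let y , y∈C∩A , y∉B∩A = differ {A = B ∩ A} {C ∩ A} (ℕ.≤-reflexive (trans B∩A (sym C∩A))) (x∈p∩q⁺ (x∈B , x∈A)) (x∉C ∘ p∩q⊆p C A)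
        y∈C , y∈A = x∈p∩q⁻ C A y∈C∩A
        y∉B = λ y∈B → y∉B∩A (x∈p∩q⁺ (y∈B , y∈A))
    in y , y∈C , y∉B , swap-⊆ B⊆E (C⊆E y∈C) , trans (∣swap∣ {B = B} x∈B y∉B) ∣B∣ ,
       counting 4 1 (λ B A x y r → ∣ B ∩ᶠ A ∣ᵉ ≡ᵉ r ∷ x ⊆ᶠ A ∷ x ⊆ᶠ B ∷ y ⊆ᶠ A ∷ y ⊆ᶠ ∁ᶠ B ∷
                  ∣ x ∣ᵉ ≡ᵉ ∣ y ∣ᵉ ∷ [] ⊢ ∣ ((B ─ᶠ x) ∪ᶠ y) ∩ᶠ A ∣ᵉ ≡ᵉ r)
         B A ⁅ x ⁆ ⁅ y ⁆ r B∩A (∈⇒⁅⁆⊆ x∈A) (∈⇒⁅⁆⊆ x∈B) (∈⇒⁅⁆⊆ y∈A) (∉⇒⁅⁆⊆∁ y∉B)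
         (trans (∣⁅x⁆∣≡1 x) (sym (∣⁅x⁆∣≡1 y)))
  ... | no x∉A =
    let y , y∈C─A , y∉B─A = differ {A = B ─ A} {C ─ A}
          (counting 3 0 (λ B C A → ∣ B ∩ᶠ A ∣ᵉ ≡ᵉ ∣ C ∩ᶠ A ∣ᵉ ∷ ∣ B ∣ᵉ ≡ᵉ ∣ C ∣ᵉ ∷ [] ⊢ ∣ B ─ᶠ A ∣ᵉ ≤ᵉ ∣ C ─ᶠ A ∣ᵉ)
            B C A (trans B∩A (sym C∩A)) (trans ∣B∣ (sym ∣C∣)))
          (x∈p∧x∉q⇒x∈p─q x∈B x∉A) (x∉C ∘ p─q⊆p C A)
        y∈C , y∉A = x∈p─q⁻ C A y∈C─A
        y∉B = λ y∈B → y∉B─A (x∈p∧x∉q⇒x∈p─q y∈B y∉A)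
    in y , y∈C , y∉B , swap-⊆ B⊆E (C⊆E y∈C) , trans (∣swap∣ {B = B} x∈B y∉B) ∣B∣ ,
       counting 4 1 (λ B A x y r → ∣ B ∩ᶠ A ∣ᵉ ≡ᵉ r ∷ x ⊆ᶠ ∁ᶠ A ∷ y ⊆ᶠ ∁ᶠ A ∷ [] ⊢
           ∣ ((B ─ᶠ x) ∪ᶠ y) ∩ᶠ A ∣ᵉ ≡ᵉ r)
         B A ⁅ x ⁆ ⁅ y ⁆ r B∩A (∉⇒⁅⁆⊆∁ x∉A) (∉⇒⁅⁆⊆∁ y∉A)

-- The content is in `full`: by uniformity `B ∩ A` is a basis of the restriction and `B ─ A` one of
-- the contraction, and `augment` glues bases that witness this into one that equals B.
stressed⇒relaxable : ∀ {N} {E : Subset N} {S : SetSystem E} → IsMatroid S → ∀ {A} →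
                     Stressed S A → ∃ (Cover S A) → Relaxable S (rank S) A (rk S A)
stressed⇒relaxable {N} {E} {S} matroid {A} (A⊆E , (kA , _ , restrict⇒ , ⇒restrict) , (kC , _ , contract⇒ , ⇒contract))
    (C , C⊆E , ∣C∣ , r<C) = record
  { A⊆E   = A⊆E
  ; size  = ∣basis∣≡rank S matroid
  ; bound = λ b → ∣B∩A∣≤rk S b A
  ; full  = full′
  ; r<∣A∣ = counting 2 1 (λ C A r → r +ᵉ lit 1 ≤ᵉ ∣ C ∩ᶠ A ∣ᵉ ∷ [] ⊢ r <ᵉ ∣ A ∣ᵉ) C A (rk S A) r<C
  ; r<k   = counting 2 2 (λ C A r k → r +ᵉ lit 1 ≤ᵉ ∣ C ∩ᶠ A ∣ᵉ ∷ ∣ C ∣ᵉ ≡ᵉ k ∷ [] ⊢ r <ᵉ k)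
              C A (rk S A) (rank S) r<C ∣C∣
  ; room  = let B , b , B∩A = rk-attained S matroid A in
      counting 3 2 (λ B A E r k → ∣ B ∩ᶠ A ∣ᵉ ≡ᵉ r ∷ ∣ B ∣ᵉ ≡ᵉ k ∷ B ⊆ᶠ E ∷ [] ⊢ k ≤ᵉ r +ᵉ ∣ E ─ᶠ A ∣ᵉ)
        B A E (rk S A) (rank S) B∩A (∣basis∣≡rank S matroid b) (Basis⊆ S b)
  }
  where
  full′ : ∀ {B} → B ⊆ E → ∣ B ∣ ≡ rank S → ∣ B ∩ A ∣ ≡ rk S A → Basis S B
  full′ {B} B⊆E ∣B∣ B∩A =
    -- B₀ identifies the ranks kA and kC of the two uniform matroids with `∣ B₀ ∩ A ∣` and
    -- `∣ B₀ ─ A ∣`.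
    let B₀ , b₀ , B₀∩A = rk-attained S matroid A
        _ , ∣B₀∩A∣≡kA = restrict⇒ (B₀ , b₀ , B₀∩A , refl)
        _ , ∣B₀─A∣≡kC = contract⇒ (B₀ , b₀ , B₀∩A , refl)
        B₁ , b₁ , _ , B∩A≡ = ⇒restrict {B ∩ A} (p∩q⊆q B A , trans B∩A (trans (sym B₀∩A) ∣B₀∩A∣≡kA))
        B₂ , b₂ , _ , B─A≡ = ⇒contract {B ─ A}
          (counting 3 0 (λ B A E → B ⊆ᶠ E ∷ [] ⊢ B ─ᶠ A ⊆ᶠ E ─ᶠ A) B A E B⊆E ,
           trans (counting 3 0 (λ B C A → ∣ B ∩ᶠ A ∣ᵉ ≡ᵉ ∣ C ∩ᶠ A ∣ᵉ ∷ ∣ B ∣ᵉ ≡ᵉ ∣ C ∣ᵉ ∷ [] ⊢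
                      ∣ B ─ᶠ A ∣ᵉ ≡ᵉ ∣ C ─ᶠ A ∣ᵉ) B B₀ A
                    (trans B∩A (sym B₀∩A)) (trans ∣B∣ (sym (∣basis∣≡rank S matroid b₀))))
             ∣B₀─A∣≡kC)
        D , d , ⊆D , D─A⊆ = augment S matroid A b₁ b₂
    in subst (Basis S) (sym (counting 5 1 (λ B B₁ B₂ D A r →
              B ∩ᶠ A ≡ᶠ B₁ ∩ᶠ A ∷ B ─ᶠ A ≡ᶠ B₂ ─ᶠ A ∷ B₁ ∩ᶠ A ⊆ᶠ D ∷ D ─ᶠ A ⊆ᶠ B₂ ∷
              ∣ D ∩ᶠ A ∣ᵉ ≤ᵉ r ∷ ∣ B ∩ᶠ A ∣ᵉ ≡ᵉ r ∷ ∣ B ∣ᵉ ≡ᵉ ∣ D ∣ᵉ ∷ [] ⊢ B ≡ᶠ D)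
         B B₁ B₂ D A (rk S A) B∩A≡ B─A≡ ⊆D D─A⊆ (∣B∩A∣≤rk S d A) B∩A
         (trans ∣B∣ (sym (∣basis∣≡rank S matroid d))))) d

-- Elementary split matroids.

module _ {N : ℕ} {E : Subset N} (S : SetSystem E) (matroid : IsMatroid S) where

  -- Disconnectedness of the restriction to F in terms of ranks. Unlike `Connected`, which
  -- quantifies over matroids, this can be decided, so that a largest unseparated set can be chosen.
  Separates : Subset N → Subset N → Set
  Separates F X = X ⊆ F × Nonempty X × Nonempty (F ─ X) × rk S X + rk S (F ─ X) ≤ rk S F

  Unseparated : Subset N → Set
  Unseparated F = ¬ ∃ (Separates F)

  unseparated? : Decidable Unseparated
  unseparated? F = ¬? (anySubset? λ X →
    (X ⊆? F) ×-dec nonempty? X ×-dec nonempty? (F ─ X) ×-dec (rk S X + rk S (F ─ X) ℕ.≤? rk S F))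

  module _ (X : Subset N) where

    private
      -- The bases behind two bases of a restriction may differ outside X. Once the first is
      -- replaced by D, which contains the second outside X, the element gained in an exchange must
      -- lie in X.
      align : ∀ {B C} → Basis S B → ∣ B ∩ X ∣ ≡ rk S X → Basis S C → ∣ C ∩ X ∣ ≡ rk S X →
              ∃ λ D → Basis S D × B ∩ X ≡ D ∩ X × C ─ X ⊆ D
      align {B} {C} b ∣B∩X∣ c ∣C∩X∣ =
        let D , d , ⊆D , D─X⊆ = augment S matroid X b c
        in D , d , meets D d ⊆D , avoids D d D─X⊆
        where
        meets : ∀ D → Basis S D → B ∩ X ⊆ D → B ∩ X ≡ D ∩ X
        meets D d ⊆D =
          counting 3 1 (λ B D X r → B ∩ᶠ X ⊆ᶠ D ∷ ∣ B ∩ᶠ X ∣ᵉ ≡ᵉ r ∷ ∣ D ∩ᶠ X ∣ᵉ ≤ᵉ r ∷ [] ⊢ B ∩ᶠ X ≡ᶠ D ∩ᶠ X)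
            B D X (rk S X) ⊆D ∣B∩X∣ (∣B∩A∣≤rk S d X)
        avoids : ∀ D → Basis S D → D ─ X ⊆ C → C ─ X ⊆ D
        avoids D d D─X⊆ =
          counting 3 1 (λ C D X r → ∣ C ∩ᶠ X ∣ᵉ ≡ᵉ r ∷ ∣ D ∩ᶠ X ∣ᵉ ≤ᵉ r ∷ D ─ᶠ X ⊆ᶠ C ∷ ∣ D ∣ᵉ ≡ᵉ ∣ C ∣ᵉ ∷ [] ⊢ C ─ᶠ X ⊆ᶠ D)
            C D X (rk S X) ∣C∩X∣ (∣B∩A∣≤rk S d X) D─X⊆ (∣bases∣≡ S matroid d c)

      exchange-restrict : ∀ {C₁ C₂ x} → Basis (restrict S X) C₁ → Basis (restrict S X) C₂ → x ∈ C₁ → x ∉ C₂ →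
                          ∃ λ y → y ∈ C₂ × y ∉ C₁ × Basis (restrict S X) (swap C₁ x y)
      exchange-restrict {x = x} (B₁ , b₁ , ∣B₁∩X∣ , refl) (B₂ , b₂ , ∣B₂∩X∣ , refl) x∈ x∉ =
        case align b₁ ∣B₁∩X∣ b₂ ∣B₂∩X∣ of λ (D , d , B₁∩X≡ , B₂─X⊆D) →
        let x∈B₁ , x∈X = x∈p∩q⁻ B₁ X x∈
            ⊆D : B₁ ∩ X ⊆ D
            ⊆D z∈ = p∩q⊆p D X (subst (_ ∈_) B₁∩X≡ z∈)
        in case IsMatroid.exchange matroid d b₂ (⊆D x∈) (λ x∈B₂ → x∉ (x∈p∩q⁺ (x∈B₂ , x∈X))) of λ (y , y∈B₂ , y∉D , d′) →
           let y∈X : y ∈ X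
               y∈X = Dec.decidable-stable (y ∈? X) λ y∉X → y∉D (B₂─X⊆D (x∈p∧x∉q⇒x∈p─q y∈B₂ y∉X))
           in y , x∈p∩q⁺ (y∈B₂ , y∈X) , (λ y∈ → y∉D (⊆D y∈)) , swap D x y , d′ ,
              trans (counting 4 0 (λ D X x y → x ⊆ᶠ X ∷ y ⊆ᶠ X ∷ x ⊆ᶠ D ∷ y ⊆ᶠ ∁ᶠ D ∷ ∣ x ∣ᵉ ≡ᵉ ∣ y ∣ᵉ ∷ [] ⊢
                        ∣ ((D ─ᶠ x) ∪ᶠ y) ∩ᶠ X ∣ᵉ ≡ᵉ ∣ D ∩ᶠ X ∣ᵉ)
                      D X ⁅ x ⁆ ⁅ y ⁆ (∈⇒⁅⁆⊆ x∈X) (∈⇒⁅⁆⊆ y∈X) (∈⇒⁅⁆⊆ (⊆D x∈)) (∉⇒⁅⁆⊆∁ y∉D)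
                      (trans (∣⁅x⁆∣≡1 x) (sym (∣⁅x⁆∣≡1 y))))
                (trans (cong ∣_∣ (sym B₁∩X≡)) ∣B₁∩X∣) ,
              counting 5 0 (λ B D X x y → B ∩ᶠ X ≡ᶠ D ∩ᶠ X ∷ y ⊆ᶠ X ∷ [] ⊢
                  ((B ∩ᶠ X) ─ᶠ x) ∪ᶠ y ≡ᶠ ((D ─ᶠ x) ∪ᶠ y) ∩ᶠ X)
                B₁ D X ⁅ x ⁆ ⁅ y ⁆ B₁∩X≡ (∈⇒⁅⁆⊆ y∈X)

    restrict-isMatroid : IsMatroid (restrict S X)
    restrict-isMatroid = record
      { nonempty = let B , b , ∣B∩X∣ = rk-attained S matroid X in B ∩ X , B , b , ∣B∩X∣ , refl
      ; exchange = exchange-restrict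
      }

  restriction : ∀ X → Matroid X
  restriction X = record { system = restrict S X ; isMatroid = restrict-isMatroid X }

  -- If the ranks of X and E ─ X add up to at most rk E, every basis attains both of them.
  -- Conversely `augment` combines optimal parts on X and on E ─ X into a basis, so S is the direct
  -- sum of its restrictions.
  connected⇒unseparated : Connected S → Unseparated E
  connected⇒unseparated connected (X , X⊆E , ne , ne′ , ≤rk) = connected
    (X , E ─ X , ne , ne′ , restriction X , restriction (E ─ X) , disjoint , cover≡ , to , from)
    where
    disjoint : Disjoint X (E ─ X)
    disjoint (x , x∈) = let x∈X , x∈E─X = x∈p∩q⁻ X (E ─ X) x∈ in proj₂ (x∈p─q⁻ E X x∈E─X) x∈X
    cover≡ : X ∪ (E ─ X) ≡ E
    cover≡ = p∪[q─p]≡q {p = X} {E} X⊆E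
    to : ∀ {B} → Basis S B → Basis (restrict S X ⊕ restrict S (E ─ X)) B
    to {B} b = B ∩ X , B ∩ (E ─ X) , (B , b , ∣B∩X∣ , refl) , (B , b , ∣B∩E─X∣ , refl) ,
      counting 3 0 (λ B X E → B ⊆ᶠ E ∷ [] ⊢ B ≡ᶠ (B ∩ᶠ X) ∪ᶠ (B ∩ᶠ (E ─ᶠ X))) B X E (Basis⊆ S b)
      where
      ∣B∩X∣ : ∣ B ∩ X ∣ ≡ rk S X
      ∣B∩X∣ = ℕ.≤-antisym (∣B∩A∣≤rk S b X) (counting 3 3 (λ B X E k r r′ → r +ᵉ r′ ≤ᵉ k ∷ ∣ B ∣ᵉ ≡ᵉ k ∷ ∣ B ∩ᶠ (E ─ᶠ X) ∣ᵉ ≤ᵉ r′ ∷ B ⊆ᶠ E ∷ [] ⊢ r ≤ᵉ ∣ B ∩ᶠ X ∣ᵉ)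
        B X E (rank S) (rk S X) (rk S (E ─ X)) ≤rk (∣basis∣≡rank S matroid b) (∣B∩A∣≤rk S b (E ─ X)) (Basis⊆ S b))
      ∣B∩E─X∣ : ∣ B ∩ (E ─ X) ∣ ≡ rk S (E ─ X)
      ∣B∩E─X∣ = ℕ.≤-antisym (∣B∩A∣≤rk S b (E ─ X)) (counting 3 3 (λ B X E k r r′ → r +ᵉ r′ ≤ᵉ k ∷ ∣ B ∣ᵉ ≡ᵉ k ∷ ∣ B ∩ᶠ X ∣ᵉ ≤ᵉ r ∷ B ⊆ᶠ E ∷ [] ⊢ r′ ≤ᵉ ∣ B ∩ᶠ (E ─ᶠ X) ∣ᵉ)
        B X E (rank S) (rk S X) (rk S (E ─ X)) ≤rk (∣basis∣≡rank S matroid b) (∣B∩A∣≤rk S b X) (Basis⊆ S b))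
    from : ∀ {B} → Basis (restrict S X ⊕ restrict S (E ─ X)) B → Basis S B
    from (_ , _ , (B , b , ∣B∩X∣ , refl) , (C , c , ∣C∩E─X∣ , refl) , refl) =
      case augment S matroid X b c of λ (D , d , ⊆D , D─X⊆) →
      let D∩X≡ : D ∩ X ≡ B ∩ X
          D∩X≡ = counting 3 1 (λ B D X r → B ∩ᶠ X ⊆ᶠ D ∷ ∣ B ∩ᶠ X ∣ᵉ ≡ᵉ r ∷ ∣ D ∩ᶠ X ∣ᵉ ≤ᵉ r ∷ [] ⊢ D ∩ᶠ X ≡ᶠ B ∩ᶠ X)
            B D X (rk S X) ⊆D ∣B∩X∣ (∣B∩A∣≤rk S d X)
          C∩⊆D : C ∩ (E ─ X) ⊆ D
          C∩⊆D = counting 4 3 (λ C D X E k r r′ → D ─ᶠ X ⊆ᶠ C ∷ D ⊆ᶠ E ∷ r +ᵉ r′ ≤ᵉ k ∷ ∣ D ∣ᵉ ≡ᵉ k ∷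
                     ∣ D ∩ᶠ X ∣ᵉ ≤ᵉ r ∷ ∣ C ∩ᶠ (E ─ᶠ X) ∣ᵉ ≡ᵉ r′ ∷ [] ⊢ C ∩ᶠ (E ─ᶠ X) ⊆ᶠ D)
            C D X E (rank S) (rk S X) (rk S (E ─ X)) D─X⊆ (Basis⊆ S d) ≤rk (∣basis∣≡rank S matroid d)
            (∣B∩A∣≤rk S d X) ∣C∩E─X∣
      in subst (Basis S) (counting 5 0 (λ B C D X E → D ⊆ᶠ E ∷ D ∩ᶠ X ≡ᶠ B ∩ᶠ X ∷ C ∩ᶠ (E ─ᶠ X) ⊆ᶠ D ∷ D ─ᶠ X ⊆ᶠ C ∷ [] ⊢
             D ≡ᶠ (B ∩ᶠ X) ∪ᶠ (C ∩ᶠ (E ─ᶠ X))) B C D X E (Basis⊆ S d) D∩X≡ C∩⊆D D─X⊆) d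

  -- In a direct sum the E₁-part of a basis optimal on E₁ and the E₂-part of one optimal on E₂
  -- combine to a basis. Its size rk E₁ + rk E₂ is rk F, so E₁ separates F.
  unseparated⇒connected-restrict : ∀ {F} → Unseparated F → Connected (restrict S F)
  unseparated⇒connected-restrict {F} unseparated (E₁ , E₂ , ne₁ , ne₂ , M₁ , M₂ , disjoint , refl , to , from) =
    case chain-basis S matroid (p⊆p∪q {p = E₁} E₂) of λ (B₁ , b₁ , ∣B₁∩E₁∣ , ∣B₁∩F∣) →
    case chain-basis S matroid (q⊆p∪q E₁ E₂) of λ (B₂ , b₂ , ∣B₂∩E₂∣ , ∣B₂∩F∣) →
    case to (B₁ , b₁ , ∣B₁∩F∣ , refl) of λ (C₁ , C₂ , c₁ , c₂ , B₁≡) →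
    case to (B₂ , b₂ , ∣B₂∩F∣ , refl) of λ (D₁ , D₂ , d₁ , d₂ , B₂≡) →
    case from (C₁ , D₂ , c₁ , d₂ , refl) of λ (B , _ , ∣B∩F∣ , ≡B) →
    unseparated (E₁ , p⊆p∪q E₂ , ne₁ ,
      subst Nonempty (sym F─E₁) ne₂ ,
      subst (λ X → rk S E₁ + rk S X ≤ rk S F) (sym F─E₁) (counting 5 3 (λ B E₁ E₂ C₁ D₂ r₁ r₂ r →
             E₁ ⊆ᶠ ∁ᶠ E₂ ∷ C₁ ⊆ᶠ E₁ ∷ D₂ ⊆ᶠ E₂ ∷ ∣ C₁ ∣ᵉ ≡ᵉ r₁ ∷ ∣ D₂ ∣ᵉ ≡ᵉ r₂ ∷ C₁ ∪ᶠ D₂ ≡ᶠ B ∩ᶠ (E₁ ∪ᶠ E₂) ∷ ∣ B ∩ᶠ (E₁ ∪ᶠ E₂) ∣ᵉ ≡ᵉ r ∷ [] ⊢ r₁ +ᵉ r₂ ≤ᵉ r)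
        B E₁ E₂ C₁ D₂ (rk S E₁) (rk S E₂) (rk S F) (disjoint⇒⊆∁ disjoint)
        (Basis⊆ (system M₁) c₁) (Basis⊆ (system M₂) d₂)
        (trans (sym (part B₁ C₁ C₂ (Basis⊆ (system M₁) c₁) (Basis⊆ (system M₂) c₂) B₁≡)) ∣B₁∩E₁∣)
        (trans (sym (part′ B₂ D₁ D₂ (Basis⊆ (system M₁) d₁) (Basis⊆ (system M₂) d₂) B₂≡)) ∣B₂∩E₂∣)
        ≡B ∣B∩F∣))
    where
    F─E₁ : (E₁ ∪ E₂) ─ E₁ ≡ E₂
    F─E₁ = counting 2 0 (λ E₁ E₂ → E₁ ⊆ᶠ ∁ᶠ E₂ ∷ [] ⊢ (E₁ ∪ᶠ E₂) ─ᶠ E₁ ≡ᶠ E₂) E₁ E₂ (disjoint⇒⊆∁ disjoint)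
    part : ∀ B C₁ C₂ → C₁ ⊆ E₁ → C₂ ⊆ E₂ → B ∩ (E₁ ∪ E₂) ≡ C₁ ∪ C₂ → ∣ B ∩ E₁ ∣ ≡ ∣ C₁ ∣
    part B C₁ C₂ = counting 5 0 (λ B C₁ C₂ E₁ E₂ → E₁ ⊆ᶠ ∁ᶠ E₂ ∷ C₁ ⊆ᶠ E₁ ∷ C₂ ⊆ᶠ E₂ ∷
      B ∩ᶠ (E₁ ∪ᶠ E₂) ≡ᶠ C₁ ∪ᶠ C₂ ∷ [] ⊢ ∣ B ∩ᶠ E₁ ∣ᵉ ≡ᵉ ∣ C₁ ∣ᵉ) B C₁ C₂ E₁ E₂ (disjoint⇒⊆∁ disjoint)
    part′ : ∀ B C₁ C₂ → C₁ ⊆ E₁ → C₂ ⊆ E₂ → B ∩ (E₁ ∪ E₂) ≡ C₁ ∪ C₂ → ∣ B ∩ E₂ ∣ ≡ ∣ C₂ ∣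
    part′ B C₁ C₂ = counting 5 0 (λ B C₁ C₂ E₁ E₂ → E₁ ⊆ᶠ ∁ᶠ E₂ ∷ C₁ ⊆ᶠ E₁ ∷ C₂ ⊆ᶠ E₂ ∷
      B ∩ᶠ (E₁ ∪ᶠ E₂) ≡ᶠ C₁ ∪ᶠ C₂ ∷ [] ⊢ ∣ B ∩ᶠ E₂ ∣ᵉ ≡ᵉ ∣ C₂ ∣ᵉ) B C₁ C₂ E₁ E₂ (disjoint⇒⊆∁ disjoint)

  -- The same mixing of optimal parts, now in the contraction: C₁ has rk (F ∪ E₁) - rk F elements,
  -- D₂ has rk (F ∪ E₂) - rk F, and their union is a basis of the contraction, with rk E - rk F
  -- elements.
  contract-additive : ∀ {F E₁ E₂} {M₁ : Matroid E₁} {M₂ : Matroid E₂} → F ⊆ E →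
                      IsDirectSum (contract S F) (system M₁) (system M₂) →
                      rk S (F ∪ E₁) + rk S (F ∪ E₂) ≤ rk S E + rk S F
  contract-additive {F} {E₁} {E₂} {M₁} {M₂} F⊆E (disjoint , E₁∪E₂≡ , to , from) =
    case chain-basis S matroid (p⊆p∪q {p = F} E₁) of λ (B₁ , b₁ , ∣B₁∩F∣ , ∣B₁∩∪∣) →
    case chain-basis S matroid (p⊆p∪q {p = F} E₂) of λ (B₂ , b₂ , ∣B₂∩F∣ , ∣B₂∩∪∣) →
    case to (B₁ , b₁ , ∣B₁∩F∣ , refl) of λ (C₁ , C₂ , c₁ , c₂ , B₁≡) →
    case to (B₂ , b₂ , ∣B₂∩F∣ , refl) of λ (D₁ , D₂ , d₁ , d₂ , B₂≡) →
    case from (C₁ , D₂ , c₁ , d₂ , refl) of λ (B , b , ∣B∩F∣ , ≡B) →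
    counting 6 4 (λ B F E₁ E₂ C₁ D₂ r₁ r₂ k r →
           E₁ ⊆ᶠ ∁ᶠ E₂ ∷ C₁ ⊆ᶠ E₁ ∷ D₂ ⊆ᶠ E₂ ∷ C₁ ∪ᶠ D₂ ≡ᶠ B ─ᶠ F ∷ r₁ ≡ᵉ r +ᵉ ∣ C₁ ∣ᵉ ∷ r₂ ≡ᵉ r +ᵉ ∣ D₂ ∣ᵉ ∷ ∣ B ∣ᵉ ≡ᵉ k ∷ ∣ B ∩ᶠ F ∣ᵉ ≡ᵉ r ∷ []
           ⊢ r₁ +ᵉ r₂ ≤ᵉ k +ᵉ r)
      B F E₁ E₂ C₁ D₂ (rk S (F ∪ E₁)) (rk S (F ∪ E₂)) (rank S) (rk S F)
      (disjoint⇒⊆∁ disjoint) (Basis⊆ (system M₁) c₁) (Basis⊆ (system M₂) d₂) ≡B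
      (trans (sym ∣B₁∩∪∣) (trans (part B₁ C₁ C₂ (Basis⊆ (system M₁) c₁) (Basis⊆ (system M₂) c₂) B₁≡) (cong (_+ ∣ C₁ ∣) ∣B₁∩F∣)))
      (trans (sym ∣B₂∩∪∣) (trans (part′ B₂ D₁ D₂ (Basis⊆ (system M₁) d₁) (Basis⊆ (system M₂) d₂) B₂≡) (cong (_+ ∣ D₂ ∣) ∣B₂∩F∣)))
      (∣basis∣≡rank S matroid b) ∣B∩F∣
    where
    ⊆∁F : E₁ ∪ E₂ ⊆ ∁ F
    ⊆∁F = counting 3 0 (λ E E′ F → E′ ≡ᶠ E ─ᶠ F ∷ [] ⊢ E′ ⊆ᶠ ∁ᶠ F) E (E₁ ∪ E₂) F E₁∪E₂≡
    part : ∀ B C₁ C₂ → C₁ ⊆ E₁ → C₂ ⊆ E₂ → B ─ F ≡ C₁ ∪ C₂ → ∣ B ∩ (F ∪ E₁) ∣ ≡ ∣ B ∩ F ∣ + ∣ C₁ ∣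
    part B C₁ C₂ = counting 6 0 (λ B C₁ C₂ E₁ E₂ F → E₁ ∪ᶠ E₂ ⊆ᶠ ∁ᶠ F ∷ E₁ ⊆ᶠ ∁ᶠ E₂ ∷ C₁ ⊆ᶠ E₁ ∷ C₂ ⊆ᶠ E₂ ∷
      B ─ᶠ F ≡ᶠ C₁ ∪ᶠ C₂ ∷ [] ⊢ ∣ B ∩ᶠ (F ∪ᶠ E₁) ∣ᵉ ≡ᵉ ∣ B ∩ᶠ F ∣ᵉ +ᵉ ∣ C₁ ∣ᵉ)
      B C₁ C₂ E₁ E₂ F ⊆∁F (disjoint⇒⊆∁ disjoint)
    part′ : ∀ B C₁ C₂ → C₁ ⊆ E₁ → C₂ ⊆ E₂ → B ─ F ≡ C₁ ∪ C₂ → ∣ B ∩ (F ∪ E₂) ∣ ≡ ∣ B ∩ F ∣ + ∣ C₂ ∣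
    part′ B C₁ C₂ = counting 6 0 (λ B C₁ C₂ E₁ E₂ F → E₁ ∪ᶠ E₂ ⊆ᶠ ∁ᶠ F ∷ E₁ ⊆ᶠ ∁ᶠ E₂ ∷ C₁ ⊆ᶠ E₁ ∷ C₂ ⊆ᶠ E₂ ∷
      B ─ᶠ F ≡ᶠ C₁ ∪ᶠ C₂ ∷ [] ⊢ ∣ B ∩ᶠ (F ∪ᶠ E₂) ∣ᵉ ≡ᵉ ∣ B ∩ᶠ F ∣ᵉ +ᵉ ∣ C₂ ∣ᵉ)
      B C₁ C₂ E₁ E₂ F ⊆∁F (disjoint⇒⊆∁ disjoint)

  -- A separation of F ∪ E₁ has F on one side, since F is unseparated; the other
  -- side then lies in E₁ and separates E.
  module _ {F E₁ E₂ : Subset N} (F⊆E : F ⊆ E) (disjoint : E₁ ⊆ ∁ E₂) (E₁∪E₂≡ : E₁ ∪ E₂ ≡ E ─ F)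
           (additive : rk S (F ∪ E₁) + rk S (F ∪ E₂) ≤ rk S E + rk S F)
           (unseparated-E : Unseparated E) (unseparated-F : Unseparated F) where

    private
      one-sided : ∀ X Y → X ⊆ ∁ Y → X ∪ Y ≡ F ∪ E₁ → Nonempty X → Nonempty Y →
                  rk S X + rk S Y ≤ rk S (F ∪ E₁) → ¬ (F ⊆ X)
      one-sided X Y X∩Y X∪Y≡ (x , x∈X) ne-Y ≤rk F⊆X = unseparated-E
        (Y , counting 6 0 (λ X Y E F E₁ E₂ → F ⊆ᶠ E ∷ X ∪ᶠ Y ≡ᶠ F ∪ᶠ E₁ ∷ E₁ ∪ᶠ E₂ ≡ᶠ E ─ᶠ F ∷ [] ⊢ Y ⊆ᶠ E)
               X Y E F E₁ E₂ F⊆E X∪Y≡ E₁∪E₂≡ ,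
         ne-Y ,
         (x , counting 6 0 (λ X Y E F E₁ E₂ → F ⊆ᶠ E ∷ X ⊆ᶠ ∁ᶠ Y ∷ X ∪ᶠ Y ≡ᶠ F ∪ᶠ E₁ ∷ E₁ ∪ᶠ E₂ ≡ᶠ E ─ᶠ F ∷ [] ⊢ X ⊆ᶠ E ─ᶠ Y)
                X Y E F E₁ E₂ F⊆E X∩Y X∪Y≡ E₁∪E₂≡ x∈X) ,
         -- Submodularity is applied to X and F ∪ E₂, which meet in F and have union E ─ Y.
         linear 7 (λ rX rY rE rF r₁ r₂ rE─Y →
             rF +ᵉ rE─Y ≤ᵉ rX +ᵉ r₂ ∷ rX +ᵉ rY ≤ᵉ r₁ ∷ r₁ +ᵉ r₂ ≤ᵉ rE +ᵉ rF ∷ [] ⊢ rY +ᵉ rE─Y ≤ᵉ rE)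
           (rk S X) (rk S Y) (rk S E) (rk S F) (rk S (F ∪ E₁)) (rk S (F ∪ E₂)) (rk S (E ─ Y))
           (subst₂ (λ P Q → rk S P + rk S Q ≤ rk S X + rk S (F ∪ E₂))
             (counting 6 0 (λ X Y E F E₁ E₂ → F ⊆ᶠ X ∷ E₁ ⊆ᶠ ∁ᶠ E₂ ∷ X ∪ᶠ Y ≡ᶠ F ∪ᶠ E₁ ∷ [] ⊢ X ∩ᶠ (F ∪ᶠ E₂) ≡ᶠ F)
               X Y E F E₁ E₂ F⊆X disjoint X∪Y≡)
             (counting 6 0 (λ X Y E F E₁ E₂ → F ⊆ᶠ E ∷ F ⊆ᶠ X ∷ X ⊆ᶠ ∁ᶠ Y ∷ E₁ ⊆ᶠ ∁ᶠ E₂ ∷ X ∪ᶠ Y ≡ᶠ F ∪ᶠ E₁ ∷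
                 E₁ ∪ᶠ E₂ ≡ᶠ E ─ᶠ F ∷ [] ⊢ X ∪ᶠ (F ∪ᶠ E₂) ≡ᶠ E ─ᶠ Y)
               X Y E F E₁ E₂ F⊆E F⊆X X∩Y disjoint X∪Y≡ E₁∪E₂≡)
             (rk-submodular S matroid X (F ∪ E₂)))
           ≤rk additive)

      -- A separation restricts to subsets: submodularity for F and X, then for F ∪ X and Y, adds up
      -- to the inequality that separates F ∩ X from F ∩ Y within F.
      meets-one : ∀ X Y → X ⊆ ∁ Y → F ⊆ X ∪ Y → rk S X + rk S Y ≤ rk S (X ∪ Y) →
                  Nonempty (F ∩ X) → ¬ Nonempty (F ∩ Y)
      meets-one X Y X∩Y F⊆ ≤rk ne-X (y , y∈) = unseparated-F
        (F ∩ X , p∩q⊆p F X , ne-X , subst Nonempty (sym F─) (y , y∈) ,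
         subst (λ P → rk S (F ∩ X) + rk S P ≤ rk S F) (sym F─)
           (linear 7 (λ rX rY rF rF∩X rF∩Y rF∪X rX∪Y →
               rF∩X +ᵉ rF∪X ≤ᵉ rF +ᵉ rX ∷ rF∩Y +ᵉ rX∪Y ≤ᵉ rF∪X +ᵉ rY ∷ rX +ᵉ rY ≤ᵉ rX∪Y ∷ [] ⊢ rF∩X +ᵉ rF∩Y ≤ᵉ rF)
             (rk S X) (rk S Y) (rk S F) (rk S (F ∩ X)) (rk S (F ∩ Y)) (rk S (F ∪ X)) (rk S (X ∪ Y))
             (rk-submodular S matroid F X)
             (subst₂ (λ P Q → rk S P + rk S Q ≤ rk S (F ∪ X) + rk S Y)
               (counting 3 0 (λ X Y F → X ⊆ᶠ ∁ᶠ Y ∷ [] ⊢ (F ∪ᶠ X) ∩ᶠ Y ≡ᶠ F ∩ᶠ Y) X Y F X∩Y)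
               (counting 3 0 (λ X Y F → F ⊆ᶠ X ∪ᶠ Y ∷ [] ⊢ (F ∪ᶠ X) ∪ᶠ Y ≡ᶠ X ∪ᶠ Y) X Y F F⊆)
               (rk-submodular S matroid (F ∪ X) Y))
             ≤rk))
        where
        F─ : F ─ (F ∩ X) ≡ F ∩ Y
        F─ = counting 3 0 (λ X Y F → X ⊆ᶠ ∁ᶠ Y ∷ F ⊆ᶠ X ∪ᶠ Y ∷ [] ⊢ F ─ᶠ (F ∩ᶠ X) ≡ᶠ F ∩ᶠ Y) X Y F X∩Y F⊆

    extend-unseparated : Unseparated (F ∪ E₁)
    extend-unseparated (X , X⊆ , ne-X , ne-Y , ≤rk) with nonempty? (F ∩ X) | nonempty? (F ∩ ((F ∪ E₁) ─ X))
    ... | yes ne | yes ne′ = meets-one X Y X⊆∁Y F⊆X∪Y (subst (λ P → rk S X + rk S Y ≤ rk S P) (sym X∪Y≡) ≤rk) ne ne′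
      where
      Y = (F ∪ E₁) ─ X
      X⊆∁Y : X ⊆ ∁ Y
      X⊆∁Y = p⊆∁[q─p] X (F ∪ E₁)
      X∪Y≡ : X ∪ Y ≡ F ∪ E₁
      X∪Y≡ = p∪[q─p]≡q {p = X} {F ∪ E₁} X⊆
      F⊆X∪Y : F ⊆ X ∪ Y
      F⊆X∪Y x∈ = subst (_ ∈_) (sym X∪Y≡) (p⊆p∪q E₁ x∈)
    ... | _ | no empty = one-sided X ((F ∪ E₁) ─ X)
      (p⊆∁[q─p] X (F ∪ E₁)) (p∪[q─p]≡q {p = X} {F ∪ E₁} X⊆)
      ne-X ne-Y ≤rk λ {x} x∈F → Dec.decidable-stable (x ∈? X) λ x∉X →
        empty (x , x∈p∩q⁺ (x∈F , x∈p∧x∉q⇒x∈p─q (p⊆p∪q E₁ x∈F) x∉X))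
    ... | no empty | _ = one-sided ((F ∪ E₁) ─ X) X
      (counting 2 0 (λ X P → [] ⊢ P ─ᶠ X ⊆ᶠ ∁ᶠ X) X (F ∪ E₁))
      (trans (∪-comm _ X) (p∪[q─p]≡q {p = X} {F ∪ E₁} X⊆))
      ne-Y ne-X (subst (_≤ rk S (F ∪ E₁)) (ℕ.+-comm (rk S X) _) ≤rk) λ {x} x∈F →
        x∈p∧x∉q⇒x∈p─q (p⊆p∪q E₁ x∈F) λ x∈X → empty (x , x∈p∩q⁺ (x∈F , x∈X))

-- Non-bases of a connected matroid.

module _ {N : ℕ} {E : Subset N} (S : SetSystem E) (matroid : IsMatroid S) (connected : Connected S)
         {B : Subset N} (B⊆E : B ⊆ E) (∣B∣≡ : ∣ B ∣ ≡ rank S) (¬b : ¬ Basis S B) where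

  private
    Violated : Subset N → Set
    Violated F = F ⊆ E × rk S F < ∣ B ∩ F ∣

    unseparated-E : Unseparated S matroid E
    unseparated-E = connected⇒unseparated S matroid connected

    rkB<∣B∣ : rk S B < ∣ B ∩ B ∣
    rkB<∣B∣ = ℕ.≰⇒> λ ≤rk → let C , c , ∣C∩B∣ = rk-attained S matroid B in
      ¬b (subst (Basis S) (counting 2 1 (λ B C r → ∣ B ∩ᶠ B ∣ᵉ ≤ᵉ r ∷ ∣ C ∩ᶠ B ∣ᵉ ≡ᵉ r ∷ ∣ C ∣ᵉ ≡ᵉ ∣ B ∣ᵉ ∷ [] ⊢ C ≡ᶠ B)
        B C (rk S B) ≤rk ∣C∩B∣ (trans (∣basis∣≡rank S matroid c) (sym ∣B∣≡))) c)

    Minimal : Subset N → Set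
    Minimal F = ∀ {G} → Violated G → ∣ F ∣ ≤ ∣ G ∣

    minimal-violated : ∃ λ F → Violated F × Minimal F
    minimal-violated = minimalSubset (λ F → (F ⊆? E) ×-dec (rk S F ℕ.<? ∣ B ∩ F ∣)) ∣_∣ {B} (B⊆E , rkB<∣B∣)

    -- Both sides of a separation are proper subsets of F, so B respects their ranks; as these ranks
    -- add up to at most rk F, it would respect that of F.
    minimal⇒unseparated : ∀ F → Violated F → Minimal F → Unseparated S matroid F
    minimal⇒unseparated F (F⊆E , rk<) least (X , X⊆F , ne , ne′ , ≤rk) = ℕ.<⇒≱ rk<
      (counting 3 3 (λ B X F r r′ rF →
           ∣ B ∩ᶠ X ∣ᵉ ≤ᵉ r ∷ ∣ B ∩ᶠ (F ─ᶠ X) ∣ᵉ ≤ᵉ r′ ∷ r +ᵉ r′ ≤ᵉ rF ∷ [] ⊢ ∣ B ∩ᶠ F ∣ᵉ ≤ᵉ rF)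
         B X F (rk S X) (rk S (F ─ X)) (rk S F)
         (proper X X⊆F ne′) (proper (F ─ X) (p─q⊆p F X) (subst Nonempty (sym F─[F─X]) ne)) ≤rk)
      where
      proper : ∀ Z → Z ⊆ F → Nonempty (F ─ Z) → ∣ B ∩ Z ∣ ≤ rk S Z
      proper Z Z⊆F ne = ℕ.≮⇒≥ λ rk<Z → ℕ.<⇒≱
        (counting 2 0 (λ Z F → Z ⊆ᶠ F ∷ lit 0 <ᵉ ∣ F ─ᶠ Z ∣ᵉ ∷ [] ⊢ ∣ Z ∣ᵉ <ᵉ ∣ F ∣ᵉ) Z F Z⊆F (Nonempty⇒0<∣p∣ {p = F ─ Z} ne))
        (least {Z} ((λ z∈ → F⊆E (Z⊆F z∈)) , rk<Z))
      F─[F─X] : F ─ (F ─ X) ≡ X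
      F─[F─X] = counting 2 0 (λ X F → X ⊆ᶠ F ∷ [] ⊢ F ─ᶠ (F ─ᶠ X) ≡ᶠ X) X F X⊆F

    unseparated-violated : ∃ λ F → Violated F × Unseparated S matroid F
    unseparated-violated = let F , violated , least = minimal-violated
                           in F , violated , minimal⇒unseparated F violated least

    Maximal : Subset N → Set
    Maximal F = ∀ {G} → Violated G × Unseparated S matroid G → ∣ E ─ F ∣ ≤ ∣ E ─ G ∣

    maximal-violated : ∃ λ F → (Violated F × Unseparated S matroid F) × Maximal F
    maximal-violated = minimalSubset
      (λ F → ((F ⊆? E) ×-dec (rk S F ℕ.<? ∣ B ∩ F ∣)) ×-dec unseparated? S matroid F)
      (λ F → ∣ E ─ F ∣) {proj₁ unseparated-violated} (proj₂ unseparated-violated)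

    module Facet (F : Subset N) (F⊆E : F ⊆ E) (rk< : rk S F < ∣ B ∩ F ∣)
                 (unseparated-F : Unseparated S matroid F) (maximal : Maximal F) where

      E≰F : ¬ (rank S ≤ rk S F)
      E≰F k≤ = ℕ.<⇒≱ rk< (ℕ.≤-trans (∣p∩q∣≤∣p∣ B F) (ℕ.≤-trans (ℕ.≤-reflexive ∣B∣≡) k≤))

      no-extension : ∀ E₁ E₂ → Nonempty E₁ → E₁ ⊆ ∁ E₂ → E₁ ∪ E₂ ≡ E ─ F →
                     rk S (F ∪ E₁) + rk S (F ∪ E₂) ≤ rk S E + rk S F → ¬ (rk S (F ∪ E₁) < ∣ B ∩ (F ∪ E₁) ∣)
      no-extension E₁ E₂ ne disjoint E₁∪E₂≡ additive rk<′ = ℕ.<⇒≱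
        (counting 4 0 (λ E F E₁ E₂ → F ⊆ᶠ E ∷ E₁ ∪ᶠ E₂ ≡ᶠ E ─ᶠ F ∷ lit 0 <ᵉ ∣ E₁ ∣ᵉ ∷ [] ⊢
            ∣ E ─ᶠ (F ∪ᶠ E₁) ∣ᵉ <ᵉ ∣ E ─ᶠ F ∣ᵉ) E F E₁ E₂ F⊆E E₁∪E₂≡ (Nonempty⇒0<∣p∣ {p = E₁} ne))
        (maximal {F ∪ E₁} ((counting 4 0 (λ E F E₁ E₂ → F ⊆ᶠ E ∷ E₁ ∪ᶠ E₂ ≡ᶠ E ─ᶠ F ∷ [] ⊢ F ∪ᶠ E₁ ⊆ᶠ E)
                     E F E₁ E₂ F⊆E E₁∪E₂≡ , rk<′) ,
          extend-unseparated S matroid F⊆E disjoint E₁∪E₂≡ additive unseparated-E unseparated-F))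

      -- By maximality B respects the ranks of F ∪ E₁ and F ∪ E₂. Its intersections with these two
      -- sets have sizes adding up to |B| + |B ∩ F|, which is then at most rk E + rk F, whereas |B|
      -- = rk E and |B ∩ F| > rk F.
      inseparable : ∀ E₁ E₂ → Nonempty E₁ → Nonempty E₂ → E₁ ⊆ ∁ E₂ → E₁ ∪ E₂ ≡ E ─ F →
                    ¬ (rk S (F ∪ E₁) + rk S (F ∪ E₂) ≤ rk S E + rk S F)
      inseparable E₁ E₂ ne₁ ne₂ disjoint E₁∪E₂≡ additive = ℕ.<⇒≱ rk<
        (counting 5 4 (λ B E F E₁ E₂ r₁ r₂ k r →
             E₁ ⊆ᶠ ∁ᶠ E₂ ∷ E₁ ∪ᶠ E₂ ≡ᶠ E ─ᶠ F ∷ B ⊆ᶠ E ∷ F ⊆ᶠ E ∷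
             ∣ B ∩ᶠ (F ∪ᶠ E₁) ∣ᵉ ≤ᵉ r₁ ∷ ∣ B ∩ᶠ (F ∪ᶠ E₂) ∣ᵉ ≤ᵉ r₂ ∷ r₁ +ᵉ r₂ ≤ᵉ k +ᵉ r ∷ ∣ B ∣ᵉ ≡ᵉ k ∷ [] ⊢ ∣ B ∩ᶠ F ∣ᵉ ≤ᵉ r)
          B E F E₁ E₂ (rk S (F ∪ E₁)) (rk S (F ∪ E₂)) (rank S) (rk S F)
          disjoint E₁∪E₂≡ B⊆E F⊆E
          (ℕ.≮⇒≥ (no-extension E₁ E₂ ne₁ disjoint E₁∪E₂≡ additive))
          (ℕ.≮⇒≥ (no-extension E₂ E₁ ne₂
            (counting 2 0 (λ X Y → X ⊆ᶠ ∁ᶠ Y ∷ [] ⊢ Y ⊆ᶠ ∁ᶠ X) E₁ E₂ disjoint)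
            (trans (∪-comm E₂ E₁) E₁∪E₂≡)
            (subst (_≤ rk S E + rk S F) (ℕ.+-comm (rk S (F ∪ E₁)) _) additive)))
          additive ∣B∣≡)

      nonempty-F : Nonempty F
      nonempty-F = 0<∣p∣⇒Nonempty {p = F} (ℕ.<-≤-trans (ℕ.≤-<-trans z≤n rk<) (∣p∩q∣≤∣q∣ B F))

      nonempty-E─F : Nonempty (E ─ F)
      nonempty-E─F = 0<∣p∣⇒Nonempty {p = E ─ F} (ℕ.≰⇒> λ ≤0 → E≰F (rk-mono S matroid {E} {F}
        (counting 2 0 (λ E F → ∣ E ─ᶠ F ∣ᵉ ≤ᵉ lit 0 ∷ [] ⊢ E ⊆ᶠ F) E F ≤0)))

      flat : Flat S F
      flat = F⊆E , λ {x} x∈E x∉F → ℕ.≰⇒> (no-point x∈E x∉F)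
        where
        no-point : ∀ {x} → x ∈ E → x ∉ F → ¬ (rk S (F ∪ ⁅ x ⁆) ≤ rk S F)
        no-point {x} x∈E x∉F ≤rk with nonempty? (E ─ (F ∪ ⁅ x ⁆))
        -- A point x in the closure of F splits off additively: F ∪ {x} has the rank of F, and the
        -- other set at most that of E.
        ... | yes ne = inseparable ⁅ x ⁆ (E ─ (F ∪ ⁅ x ⁆)) (x , x∈⁅x⁆ x) ne
          (counting 3 0 (λ x E F → [] ⊢ x ⊆ᶠ ∁ᶠ (E ─ᶠ (F ∪ᶠ x))) ⁅ x ⁆ E F)
          (counting 3 0 (λ x E F → x ⊆ᶠ E ∷ x ⊆ᶠ ∁ᶠ F ∷ [] ⊢ x ∪ᶠ (E ─ᶠ (F ∪ᶠ x)) ≡ᶠ E ─ᶠ F)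
            ⁅ x ⁆ E F (∈⇒⁅⁆⊆ x∈E) (∉⇒⁅⁆⊆∁ x∉F))
          (subst (rk S (F ∪ ⁅ x ⁆) + rk S (F ∪ (E ─ (F ∪ ⁅ x ⁆))) ≤_) (ℕ.+-comm (rk S F) (rk S E))
            (ℕ.+-mono-≤ ≤rk (rk-mono S matroid {F ∪ (E ─ (F ∪ ⁅ x ⁆))} {E}
              (counting 3 0 (λ x E F → F ⊆ᶠ E ∷ [] ⊢ F ∪ᶠ (E ─ᶠ (F ∪ᶠ x)) ⊆ᶠ E) ⁅ x ⁆ E F F⊆E))))
        ... | no e = E≰F (ℕ.≤-trans (rk-mono S matroid {E} {F ∪ ⁅ x ⁆} λ {z} z∈E →
          Dec.decidable-stable (z ∈? F ∪ ⁅ x ⁆) λ z∉ → e (z , x∈p∧x∉q⇒x∈p─q z∈E z∉)) ≤rk)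

      0<rk : 0 < rk S F
      0<rk = ℕ.≰⇒> λ ≤0 → unseparated-E (F , F⊆E , nonempty-F , nonempty-E─F ,
        ℕ.+-mono-≤ ≤0 (rk-mono S matroid {E ─ F} {E} (p─q⊆p E F)))

      connected-contract : Connected (contract S F)
      connected-contract (E₁ , E₂ , ne₁ , ne₂ , M₁ , M₂ , sum@(disjoint , E₁∪E₂≡ , _)) =
        inseparable E₁ E₂ ne₁ ne₂ (disjoint⇒⊆∁ disjoint) E₁∪E₂≡
          (contract-additive S matroid {M₁ = M₁} {M₂} F⊆E sum)

      not-coloop : ∀ {x} → x ∈ E ─ F → ¬ Coloop S x
      not-coloop {x} x∈ coloop = unseparated-E (⁅ x ⁆ , ∈⇒⁅⁆⊆ x∈E , (x , x∈⁅x⁆ x) ,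
        (z , x∈p∧x∉q⇒x∈p─q (F⊆E z∈F) (λ z∈x → x∉F (subst (_∈ F) (x∈⁅y⁆⇒x≡y x z∈x) z∈F))) ,
        counting 3 3 (λ C x E rx r k → rx ≤ᵉ ∣ x ∣ᵉ ∷ x ⊆ᶠ C ∷ ∣ C ∩ᶠ (E ─ᶠ x) ∣ᵉ ≡ᵉ r ∷ ∣ C ∣ᵉ ≡ᵉ k ∷ [] ⊢ rx +ᵉ r ≤ᵉ k)
          C ⁅ x ⁆ E (rk S ⁅ x ⁆) (rk S (E ─ ⁅ x ⁆)) (rank S)
          (rk≤∣∣ S matroid ⁅ x ⁆) (∈⇒⁅⁆⊆ (coloop c)) ∣C∩∣ (∣basis∣≡rank S matroid c))
        where
        x∈E = proj₁ (x∈p─q⁻ E F x∈)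
        x∉F = proj₂ (x∈p─q⁻ E F x∈)
        z   = proj₁ nonempty-F
        z∈F = proj₂ nonempty-F
        C    = proj₁ (rk-attained S matroid (E ─ ⁅ x ⁆))
        c    = proj₁ (proj₂ (rk-attained S matroid (E ─ ⁅ x ⁆)))
        ∣C∩∣ = proj₂ (proj₂ (rk-attained S matroid (E ─ ⁅ x ⁆)))

      splitFlacet : SplitFlacet S F
      splitFlacet =
        (flat , unseparated⇒connected-restrict S matroid unseparated-F , connected-contract) , 0<rk ,
        ℕ.<-≤-trans rk< (∣p∩q∣≤∣q∣ B F) , proj₁ nonempty-E─F , proj₂ nonempty-E─F , not-coloop (proj₂ nonempty-E─F)

  violated-splitFlacet : ∃ λ F → SplitFlacet S F × Cover S F B
  violated-splitFlacet =
    let F , ((F⊆E , rk<) , unseparated) , maximal = maximal-violated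
    in F , Facet.splitFlacet F F⊆E rk< unseparated maximal ,
       (B⊆E , ∣B∣≡ , subst (_≤ ∣ B ∩ F ∣) (ℕ.+-comm 1 (rk S F)) rk<)

-- Direct sums of two uniform matroids.

module _ {N : ℕ} {E E₁ E₂ : Subset N} {a b : ℕ} (S : SetSystem E) (E₁⊆∁E₂ : E₁ ⊆ ∁ E₂) (E₁∪E₂≡E : E₁ ∪ E₂ ≡ E)
         (a≤ : a ≤ ∣ E₁ ∣) (b≤ : b ≤ ∣ E₂ ∣)
         (bases⇔ : ∀ {B} → Basis S B ⇔ (B ⊆ E × ∣ B ∩ E₁ ∣ ≡ a × ∣ B ∩ E₂ ∣ ≡ b)) where

  private
    Z₁ = choose a E₁ a≤
    Z₂ = choose b E₂ b≤

    glue : ∀ {C D} → C ⊆ E₁ → ∣ C ∣ ≡ a → D ⊆ E₂ → ∣ D ∣ ≡ b → Basis S (C ∪ D)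
    glue {C} {D} C⊆ ∣C∣ D⊆ ∣D∣ = Equivalence.from bases⇔
      ( counting 5 0 (λ C D E₁ E₂ E → C ⊆ᶠ E₁ ∷ D ⊆ᶠ E₂ ∷ E₁ ∪ᶠ E₂ ≡ᶠ E ∷ [] ⊢ C ∪ᶠ D ⊆ᶠ E)
          C D E₁ E₂ E C⊆ D⊆ E₁∪E₂≡E
      , trans (∣[p∪q]∩r∣≡∣p∣ {p = C} {D} {E₁} {E₂} E₁⊆∁E₂ C⊆ D⊆) ∣C∣
      , trans (∣[p∪q]∩s∣≡∣q∣ {p = C} {D} {E₁} {E₂} E₁⊆∁E₂ C⊆ D⊆) ∣D∣ )

    E─E₁≡E₂ : E ─ E₁ ≡ E₂
    E─E₁≡E₂ = counting 3 0 (λ E₁ E₂ E → E₁ ⊆ᶠ ∁ᶠ E₂ ∷ E₁ ∪ᶠ E₂ ≡ᶠ E ∷ [] ⊢ E ─ᶠ E₁ ≡ᶠ E₂) E₁ E₂ E E₁⊆∁E₂ E₁∪E₂≡E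

    ─E₁≡∩E₂ : ∀ {B} → B ⊆ E → B ─ E₁ ≡ B ∩ E₂
    ─E₁≡∩E₂ {B} = counting 4 0 (λ E₁ E₂ E B → E₁ ⊆ᶠ ∁ᶠ E₂ ∷ E₁ ∪ᶠ E₂ ≡ᶠ E ∷ B ⊆ᶠ E ∷ [] ⊢ B ─ᶠ E₁ ≡ᶠ B ∩ᶠ E₂)
      E₁ E₂ E B E₁⊆∁E₂ E₁∪E₂≡E

  uniform-sum-rk : rk S E₁ ≡ a
  uniform-sum-rk = rk-const S
    (_ , glue (proj₁ (proj₂ Z₁)) (proj₂ (proj₂ Z₁)) (proj₁ (proj₂ Z₂)) (proj₂ (proj₂ Z₂)))
    (λ b → proj₁ (proj₂ (Equivalence.to bases⇔ b)))

  -- Any a elements of E₁ can be completed by any b elements of E₂, so the restriction to E₁ and the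
  -- contraction by it are the two summands. The hypotheses are symmetric, which gives the same for
  -- E₂ after a swap.
  uniform-sum-stressed : Stressed S E₁
  uniform-sum-stressed = E₁⊆E , (a , a≤ , restrict⇒ , ⇒restrict) ,
    (b , subst (λ X → b ≤ ∣ X ∣) (sym E─E₁≡E₂) b≤ , contract⇒ , ⇒contract)
    where
    E₁⊆E : E₁ ⊆ E
    E₁⊆E x∈ = subst (_ ∈_) E₁∪E₂≡E (p⊆p∪q E₂ x∈)
    restrict⇒ : ∀ {C} → Basis (restrict S E₁) C → C ⊆ E₁ × ∣ C ∣ ≡ a
    restrict⇒ (B , b , _ , refl) = p∩q⊆q B E₁ , proj₁ (proj₂ (Equivalence.to bases⇔ b))
    ⇒restrict : ∀ {C} → C ⊆ E₁ × ∣ C ∣ ≡ a → Basis (restrict S E₁) C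
    ⇒restrict {C} (C⊆ , ∣C∣) = C ∪ D , basis ,
      trans (proj₁ (proj₂ (Equivalence.to bases⇔ basis))) (sym uniform-sum-rk) ,
      counting 4 0 (λ C D E₁ E₂ → E₁ ⊆ᶠ ∁ᶠ E₂ ∷ C ⊆ᶠ E₁ ∷ D ⊆ᶠ E₂ ∷ [] ⊢ C ≡ᶠ (C ∪ᶠ D) ∩ᶠ E₁)
        C D E₁ E₂ E₁⊆∁E₂ C⊆ (proj₁ (proj₂ Z₂))
      where
      D = proj₁ Z₂
      basis = glue {C} {D} C⊆ ∣C∣ (proj₁ (proj₂ Z₂)) (proj₂ (proj₂ Z₂))
    contract⇒ : ∀ {C} → Basis (contract S E₁) C → C ⊆ E ─ E₁ × ∣ C ∣ ≡ b
    contract⇒ {C} (B , b , eq , refl) = Basis⊆ (contract S E₁) (B , b , eq , refl) ,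
      trans (cong ∣_∣ (─E₁≡∩E₂ (Basis⊆ S b))) (proj₂ (proj₂ (Equivalence.to bases⇔ b)))
    ⇒contract : ∀ {C} → C ⊆ E ─ E₁ × ∣ C ∣ ≡ b → Basis (contract S E₁) C
    ⇒contract {C} (C⊆ , ∣C∣) = D ∪ C , basis ,
      trans (proj₁ (proj₂ (Equivalence.to bases⇔ basis))) (sym uniform-sum-rk) ,
      counting 4 0 (λ C D E₁ E₂ → E₁ ⊆ᶠ ∁ᶠ E₂ ∷ C ⊆ᶠ E₂ ∷ D ⊆ᶠ E₁ ∷ [] ⊢ C ≡ᶠ (D ∪ᶠ C) ─ᶠ E₁)
        C D E₁ E₂ E₁⊆∁E₂ C⊆E₂ (proj₁ (proj₂ Z₁))
      where
      D = proj₁ Z₁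
      C⊆E₂ : C ⊆ E₂
      C⊆E₂ x∈ = subst (_ ∈_) E─E₁≡E₂ (C⊆ x∈)
      basis = glue {D} {C} (proj₁ (proj₂ Z₁)) (proj₂ (proj₂ Z₁)) C⊆E₂ ∣C∣

nonbasis-covered : ∀ {N} {E : Subset N} (M : Matroid E) → ElementarySplit M →
                   ∀ {B} → B ⊆ E → ∣ B ∣ ≡ rank (system M) → ¬ Basis (system M) B →
                   ∃ λ A → Stressed (system M) A × Cover (system M) A B
nonbasis-covered M (inj₁ (connected , split)) B⊆E ∣B∣ ¬b =
  let F , flacet , cover = violated-splitFlacet (system M) (isMatroid M) connected B⊆E ∣B∣ ¬b
  in F , split F flacet , cover
nonbasis-covered {N} {E} M (inj₂ (E₁ , E₂ , M₁ , M₂ , (a , a≤ , M₁⇒ , ⇒M₁) , (b , b≤ , M₂⇒ , ⇒M₂) , disjoint , E₁∪E₂≡E , to , from))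
    {B} B⊆E ∣B∣ ¬b = [ below , (λ a< → E₁ , stressed₁ , covers rk₁ a<) ]′ (ℕ.≤-<-connex ∣ B ∩ E₁ ∣ a)
  where
  S = system M
  E₁⊆∁E₂ = disjoint⇒⊆∁ disjoint
  bases⇔ : ∀ {B} → Basis S B ⇔ (B ⊆ E × ∣ B ∩ E₁ ∣ ≡ a × ∣ B ∩ E₂ ∣ ≡ b)
  bases⇔ {B} = mk⇔ ⇒ ⇐
    where
    ⇒ : Basis S B → B ⊆ E × ∣ B ∩ E₁ ∣ ≡ a × ∣ B ∩ E₂ ∣ ≡ b
    ⇒ b with to b
    ... | B₁ , B₂ , b₁ , b₂ , refl =
      Basis⊆ S b ,
      trans (∣[p∪q]∩r∣≡∣p∣ {p = B₁} {B₂} {E₁} {E₂} E₁⊆∁E₂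
          (Basis⊆ (system M₁) b₁) (Basis⊆ (system M₂) b₂)) (proj₂ (M₁⇒ b₁)) ,
      trans (∣[p∪q]∩s∣≡∣q∣ {p = B₁} {B₂} {E₁} {E₂} E₁⊆∁E₂
          (Basis⊆ (system M₁) b₁) (Basis⊆ (system M₂) b₂)) (proj₂ (M₂⇒ b₂))
    ⇐ : B ⊆ E × ∣ B ∩ E₁ ∣ ≡ a × ∣ B ∩ E₂ ∣ ≡ b → Basis S B
    ⇐ (B⊆E , ∣B∩E₁∣ , ∣B∩E₂∣) = from (B ∩ E₁ , B ∩ E₂ , ⇒M₁ (p∩q⊆q B E₁ , ∣B∩E₁∣) , ⇒M₂ (p∩q⊆q B E₂ , ∣B∩E₂∣) ,
      counting 4 0 (λ B E₁ E₂ E → B ⊆ᶠ E ∷ E₁ ∪ᶠ E₂ ≡ᶠ E ∷ [] ⊢ B ≡ᶠ (B ∩ᶠ E₁) ∪ᶠ (B ∩ᶠ E₂)) B E₁ E₂ E B⊆E E₁∪E₂≡E)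

  E₂⊆∁E₁ : E₂ ⊆ ∁ E₁
  E₂⊆∁E₁ = counting 2 0 (λ X Y → X ⊆ᶠ ∁ᶠ Y ∷ [] ⊢ Y ⊆ᶠ ∁ᶠ X) E₁ E₂ E₁⊆∁E₂
  E₂∪E₁≡E : E₂ ∪ E₁ ≡ E
  E₂∪E₁≡E = trans (∪-comm E₂ E₁) E₁∪E₂≡E
  swapped : ∀ {B} → Basis S B ⇔ (B ⊆ E × ∣ B ∩ E₂ ∣ ≡ b × ∣ B ∩ E₁ ∣ ≡ a)
  swapped = mk⇔ (λ b → let p , q , r = Equivalence.to bases⇔ b in (λ {_} → p) , r , q)
                (λ (p , q , r) → Equivalence.from bases⇔ ((λ {_} → p) , r , q))

  stressed₁ = uniform-sum-stressed S E₁⊆∁E₂ E₁∪E₂≡E a≤ b≤ bases⇔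
  rk₁       = uniform-sum-rk S E₁⊆∁E₂ E₁∪E₂≡E a≤ b≤ bases⇔
  stressed₂ = uniform-sum-stressed S E₂⊆∁E₁ E₂∪E₁≡E b≤ a≤ swapped
  rk₂       = uniform-sum-rk S E₂⊆∁E₁ E₂∪E₁≡E b≤ a≤ swapped

  covers : ∀ {A r} → rk S A ≡ r → r < ∣ B ∩ A ∣ → Cover S A B
  covers {A} {r} refl r< = (λ {_} → B⊆E) , ∣B∣ , subst (_≤ ∣ B ∩ A ∣) (ℕ.+-comm 1 r) r<

  rank≡ : rank S ≡ a + b
  rank≡ = let C , c = IsMatroid.nonempty (isMatroid M) ; C⊆E , ∣C∩E₁∣ , ∣C∩E₂∣ = Equivalence.to bases⇔ c in
    trans (sym (∣basis∣≡rank S (isMatroid M) c))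
      (counting 4 2 (λ C E₁ E₂ E a b → C ⊆ᶠ E ∷ E₁ ⊆ᶠ ∁ᶠ E₂ ∷ E₁ ∪ᶠ E₂ ≡ᶠ E ∷ ∣ C ∩ᶠ E₁ ∣ᵉ ≡ᵉ a ∷ ∣ C ∩ᶠ E₂ ∣ᵉ ≡ᵉ b ∷ [] ⊢
          ∣ C ∣ᵉ ≡ᵉ a +ᵉ b) C E₁ E₂ E a b C⊆E E₁⊆∁E₂ E₁∪E₂≡E ∣C∩E₁∣ ∣C∩E₂∣)

  a+b≤ : a + b ≤ ∣ B ∩ E₁ ∣ + ∣ B ∩ E₂ ∣
  a+b≤ = counting 4 1 (λ B E₁ E₂ E k → B ⊆ᶠ E ∷ E₁ ∪ᶠ E₂ ≡ᶠ E ∷ ∣ B ∣ᵉ ≡ᵉ k ∷ [] ⊢ k ≤ᵉ ∣ B ∩ᶠ E₁ ∣ᵉ +ᵉ ∣ B ∩ᶠ E₂ ∣ᵉ)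
    B E₁ E₂ E (a + b) B⊆E E₁∪E₂≡E (trans ∣B∣ rank≡)

  below : ∣ B ∩ E₁ ∣ ≤ a → ∃ λ A → Stressed S A × Cover S A B
  -- Intersections of sizes at most a and at most b with sum a + b have exactly these sizes, and
  -- then B is a basis.
  below ≤a = [ (λ ≤b → ⊥-elim (¬b (Equivalence.from bases⇔ ((λ {_} → B⊆E) ,
                 ℕ.≤-antisym ≤a (ℕ.+-cancelʳ-≤ b a _ (ℕ.≤-trans a+b≤ (ℕ.+-monoʳ-≤ ∣ B ∩ E₁ ∣ ≤b))) ,
                 ℕ.≤-antisym ≤b (ℕ.+-cancelˡ-≤ a b _ (ℕ.≤-trans a+b≤ (ℕ.+-monoˡ-≤ ∣ B ∩ E₂ ∣ ≤a)))))))
             , (λ b< → E₂ , stressed₂ , covers rk₂ b<) ]′ (ℕ.≤-<-connex ∣ B ∩ E₂ ∣ b)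

-- Real weights.

infix 4 _≼_

-- x ≤ℝ y amounts to seq x ≼ seq y; the sequences below need not be Cauchy.
record _≼_ (u v : ℕ → ℚ) : Set where
  constructor ⟨_⟩
  field
    bound-within : ∀ ε → 0ℚ ℚ.< ε → ∃ λ N → ∀ n → N ≤ n → u n ℚ.≤ v n ℚ.+ ε

open _≼_ public

private
  half+half : ∀ ε → ½ ℚ.* ε ℚ.+ ½ ℚ.* ε ≡ ε
  half+half ε = trans (sym (ℚ.*-distribʳ-+ ε ½ ½)) (ℚ.*-identityˡ ε)

  0<half : ∀ {ε} → 0ℚ ℚ.< ε → 0ℚ ℚ.< ½ ℚ.* ε
  0<half {ε} 0<ε = ℚ.positive⁻¹ (½ ℚ.* ε)
    where instance _ = ℚ.positive 0<ε
                   _ = ℚ.pos*pos⇒pos ½ ε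

≤⇒≼ : ∀ {u v} → (∀ n → u n ℚ.≤ v n) → u ≼ v
≤⇒≼ {v = v} u≤v = ⟨ (λ ε 0<ε → 0 , λ n _ → ℚ.≤-trans (u≤v n)
  (subst (ℚ._≤ v n ℚ.+ ε) (ℚ.+-identityʳ (v n)) (ℚ.+-monoʳ-≤ (v n) (ℚ.<⇒≤ 0<ε)))) ⟩

≡⇒≼ : ∀ {u v} → (∀ n → u n ≡ v n) → u ≼ v
≡⇒≼ u≡v = ≤⇒≼ λ n → ℚ.≤-reflexive (u≡v n)

+-mono-≼ : ∀ {u v u′ v′} → u ≼ v → u′ ≼ v′ → (λ n → u n ℚ.+ u′ n) ≼ (λ n → v n ℚ.+ v′ n)
+-mono-≼ {u} {v} {u′} {v′} u≼v u′≼v′ = ⟨ (λ ε 0<ε →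
  let N₁ , close₁ = bound-within u≼v (½ ℚ.* ε) (0<half 0<ε)
      N₂ , close₂ = bound-within u′≼v′ (½ ℚ.* ε) (0<half 0<ε)
  in N₁ ℕ.⊔ N₂ , λ n n≥ → subst (u n ℚ.+ u′ n ℚ.≤_)
       (trans (rearrange (v n) (½ ℚ.* ε) (v′ n) (½ ℚ.* ε)) (cong (v n ℚ.+ v′ n ℚ.+_) (half+half ε)))
       (ℚ.+-mono-≤ (close₁ n (ℕ.m⊔n≤o⇒m≤o N₁ N₂ n≥)) (close₂ n (ℕ.m⊔n≤o⇒n≤o N₁ N₂ n≥)))) ⟩
  where
  open ℚ-Solver
  rearrange : ∀ a b c d → (a ℚ.+ b) ℚ.+ (c ℚ.+ d) ≡ (a ℚ.+ c) ℚ.+ (b ℚ.+ d)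
  rearrange = solve 4 (λ a b c d → (a :+ b) :+ (c :+ d) := (a :+ c) :+ (b :+ d)) refl

≼-trans : ∀ {u v w} → u ≼ v → v ≼ w → u ≼ w
≼-trans {u} {v} {w} u≼v v≼w = ⟨ (λ ε 0<ε →
  let N₁ , close₁ = bound-within u≼v (½ ℚ.* ε) (0<half 0<ε)
      N₂ , close₂ = bound-within v≼w (½ ℚ.* ε) (0<half 0<ε)
  in N₁ ℕ.⊔ N₂ , λ n n≥ → subst (u n ℚ.≤_)
       (trans (ℚ.+-assoc (w n) (½ ℚ.* ε) (½ ℚ.* ε)) (cong (w n ℚ.+_) (half+half ε)))
       (ℚ.≤-trans (close₁ n (ℕ.m⊔n≤o⇒m≤o N₁ N₂ n≥))
         (ℚ.+-monoˡ-≤ (½ ℚ.* ε) (close₂ n (ℕ.m⊔n≤o⇒n≤o N₁ N₂ n≥))))) ⟩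

scale-≼ : ∀ {u v} q → 0ℚ ℚ.≤ q → u ≼ v → (λ n → q ℚ.* u n) ≼ (λ n → q ℚ.* v n)
scale-≼ {u} {v} q 0≤q u≼v = ⟨ (λ ε 0<ε →
  let 0<q+1 = ℚ.<-≤-trans (ℚ.positive⁻¹ 1ℚ)
                (subst (ℚ._≤ q ℚ.+ 1ℚ) (ℚ.+-identityˡ 1ℚ) (ℚ.+-monoˡ-≤ 1ℚ 0≤q))
      δ , 0<δ , [q+1]δ≡ε = shrink {q ℚ.+ 1ℚ} 0<q+1 0<ε
      N , close = bound-within u≼v δ 0<δ
      instance _ = ℚ.nonNegative 0≤q
      qδ≤ε = subst (q ℚ.* δ ℚ.≤_) (trans (sym (distrib q δ)) [q+1]δ≡ε)
               (subst (ℚ._≤ q ℚ.* δ ℚ.+ δ) (ℚ.+-identityʳ (q ℚ.* δ)) (ℚ.+-monoʳ-≤ (q ℚ.* δ) (ℚ.<⇒≤ 0<δ)))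
  in N , λ n n≥ → ℚ.≤-trans (ℚ.*-monoˡ-≤-nonNeg q (close n n≥))
       (subst (ℚ._≤ q ℚ.* v n ℚ.+ ε) (sym (ℚ.*-distribˡ-+ q (v n) δ)) (ℚ.+-monoʳ-≤ (q ℚ.* v n) qδ≤ε))) ⟩
  where
  open ℚ-Solver
  distrib : ∀ q δ → (q ℚ.+ 1ℚ) ℚ.* δ ≡ q ℚ.* δ ℚ.+ δ
  distrib = solve 2 (λ q δ → (q :+ con 1ℚ) :* δ := q :* δ :+ δ) refl

-- At one late index N the rationals yN and xN + 2δ can be compared, with δ = ε / 4. Each sequence
-- moves by less than δ afterwards, so the comparison yields either yn ≤ xn + 4δ or xn ≤ yn from
-- there on.
≰ℝ⇒≥ℝ : ∀ x y → ¬ (x ≤ℝ y) → y ≤ℝ x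
≰ℝ⇒≥ℝ x y x≰y ε 0<ε =
  let N₁ , close₁ = cauchy x δ 0<δ
      N₂ , close₂ = cauchy y δ 0<δ
      N = N₁ ℕ.⊔ N₂
      x-close = λ n (n≥ : N ≤ n) → close₁ N n (ℕ.m≤m⊔n N₁ N₂) (ℕ.≤-trans (ℕ.m≤m⊔n N₁ N₂) n≥)
      y-close = λ n (n≥ : N ≤ n) → close₂ N n (ℕ.m≤n⊔m N₁ N₂) (ℕ.≤-trans (ℕ.m≤n⊔m N₁ N₂) n≥)
  in [ (λ y≤x+2δ → N , λ n n≥ → y≤x+ε (seq x N) (seq x n) (seq y N) (seq y n) (x-close n n≥) (y-close n n≥) y≤x+2δ)
     , (λ x+2δ≤y → ⊥-elim (x≰y (eventually N λ n n≥ →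
         x≤y (seq x N) (seq x n) (seq y N) (seq y n) (x-close n n≥) (y-close n n≥) x+2δ≤y))) ]′
     (ℚ.≤-total (seq y N) (seq x N ℚ.+ (δ ℚ.+ δ)))
  where
  δ = ½ ℚ.* (½ ℚ.* ε)
  0<δ = 0<half (0<half 0<ε)
  4δ : δ ℚ.+ (δ ℚ.+ δ) ℚ.+ δ ≡ ε
  4δ = trans (regroup δ) (trans (cong₂ ℚ._+_ (half+half (½ ℚ.* ε)) (half+half (½ ℚ.* ε))) (half+half ε))
    where
    open ℚ-Solver
    regroup : ∀ d → d ℚ.+ (d ℚ.+ d) ℚ.+ d ≡ (d ℚ.+ d) ℚ.+ (d ℚ.+ d)
    regroup = solve 1 (λ d → d :+ (d :+ d) :+ d := (d :+ d) :+ (d :+ d)) refl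
  eventually : ∀ N → (∀ n → N ≤ n → seq x n ℚ.≤ seq y n) → x ≤ℝ y
  eventually N x≤y η 0<η = N , λ n n≥ → ℚ.≤-trans (x≤y n n≥)
    (subst (ℚ._≤ seq y n ℚ.+ η) (ℚ.+-identityʳ (seq y n)) (ℚ.+-monoʳ-≤ (seq y n) (ℚ.<⇒≤ 0<η)))
  cancel-δ : ∀ p q → p ℚ.+ δ ℚ.≤ q ℚ.+ δ → p ℚ.≤ q
  cancel-δ p q le = subst₂ ℚ._≤_ (cancel p δ) (cancel q δ) (ℚ.+-monoˡ-≤ (ℚ.- δ) le)
    where
    open ℚ-Solver
    cancel : ∀ p d → p ℚ.+ d ℚ.- d ≡ p
    cancel = solve 2 (λ p d → p :+ d :- d := p) refl
  p≤q+δ : ∀ p q → ℚ.∣ p ℚ.- q ∣ ℚ.< δ → p ℚ.≤ q ℚ.+ δ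
  p≤q+δ p q close = subst (ℚ._≤ q ℚ.+ δ) (cancel p q) (ℚ.+-monoʳ-≤ q (ℚ.≤-trans (p≤∣p∣ (p ℚ.- q)) (ℚ.<⇒≤ close)))
    where
    open ℚ-Solver
    cancel : ∀ p q → q ℚ.+ (p ℚ.- q) ≡ p
    cancel = solve 2 (λ p q → q :+ (p :- q) := p) refl
    p≤∣p∣ : ∀ p → p ℚ.≤ ℚ.∣ p ∣
    p≤∣p∣ p = [ (λ 0≤p → ℚ.≤-reflexive (sym (ℚ.0≤p⇒∣p∣≡p 0≤p))) , (λ p≤0 → ℚ.≤-trans p≤0 (ℚ.0≤∣p∣ p)) ]′ (ℚ.≤-total 0ℚ p)
  q≤p+δ : ∀ p q → ℚ.∣ p ℚ.- q ∣ ℚ.< δ → q ℚ.≤ p ℚ.+ δ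
  q≤p+δ p q close = p≤q+δ q p (subst (ℚ._< δ) (trans (sym (ℚ.∣-p∣≡∣p∣ (p ℚ.- q))) (cong ℚ.∣_∣ (flip-sub p q))) close)
    where
    open ℚ-Solver
    flip-sub : ∀ p q → ℚ.- (p ℚ.- q) ≡ q ℚ.- p
    flip-sub = solve 2 (λ p q → :- (p :- q) := q :- p) refl
  y≤x+ε : ∀ xN xn yN yn → ℚ.∣ xN ℚ.- xn ∣ ℚ.< δ → ℚ.∣ yN ℚ.- yn ∣ ℚ.< δ → yN ℚ.≤ xN ℚ.+ (δ ℚ.+ δ) → yn ℚ.≤ xn ℚ.+ ε
  y≤x+ε xN xn yN yn cx cy yN≤ = subst (yn ℚ.≤_) (trans (regroup xn δ) (cong (xn ℚ.+_) 4δ))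
    (ℚ.≤-trans (q≤p+δ yN yn cy) (ℚ.+-monoˡ-≤ δ (ℚ.≤-trans yN≤ (ℚ.+-monoˡ-≤ (δ ℚ.+ δ) (p≤q+δ xN xn cx)))))
    where
    open ℚ-Solver
    regroup : ∀ x d → x ℚ.+ d ℚ.+ (d ℚ.+ d) ℚ.+ d ≡ x ℚ.+ (d ℚ.+ (d ℚ.+ d) ℚ.+ d)
    regroup = solve 2 (λ x d → x :+ d :+ (d :+ d) :+ d := x :+ (d :+ (d :+ d) :+ d)) refl
  x≤y : ∀ xN xn yN yn → ℚ.∣ xN ℚ.- xn ∣ ℚ.< δ → ℚ.∣ yN ℚ.- yn ∣ ℚ.< δ → xN ℚ.+ (δ ℚ.+ δ) ℚ.≤ yN → xn ℚ.≤ yn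
  x≤y xN xn yN yn cx cy ≤yN = cancel-δ xn yn (ℚ.≤-trans (ℚ.+-monoˡ-≤ δ (q≤p+δ xN xn cx))
    (subst (ℚ._≤ yn ℚ.+ δ) (sym (ℚ.+-assoc xN δ δ)) (ℚ.≤-trans ≤yN (p≤q+δ yN yn cy))))

¬¬-total : ∀ x y → ¬ ¬ (seq x ≼ seq y ⊎ seq y ≼ seq x)
¬¬-total x y neither = neither (inj₂ ⟨ ≰ℝ⇒≥ℝ x y (λ x≤y → neither (inj₁ ⟨ x≤y ⟩)) ⟩)

infixr 8 _•_

_•_ : ℚ → ℝ → ℝ
q • x = fromℚ q *ℝ x

ι : ℕ → ℚ
ι zero    = 0ℚ
ι (suc n) = 1ℚ ℚ.+ ι n

ι-+ : ∀ m n → ι (m + n) ≡ ι m ℚ.+ ι n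
ι-+ zero    n = sym (ℚ.+-identityˡ (ι n))
ι-+ (suc m) n = trans (cong (1ℚ ℚ.+_) (ι-+ m n)) (sym (ℚ.+-assoc 1ℚ (ι m) (ι n)))

ι-* : ∀ m n → ι (m * n) ≡ ι m ℚ.* ι n
ι-* zero    n = sym (ℚ.*-zeroˡ (ι n))
ι-* (suc m) n = trans (ι-+ n (m * n)) (trans (cong (ι n ℚ.+_) (ι-* m n)) (distrib (ι m) (ι n)))
  where
  open ℚ-Solver
  distrib : ∀ a b → b ℚ.+ a ℚ.* b ≡ (1ℚ ℚ.+ a) ℚ.* b
  distrib = solve 2 (λ a b → b :+ a :* b := (con 1ℚ :+ a) :* b) refl

0≤ι : ∀ n → 0ℚ ℚ.≤ ι n
0≤ι zero    = ℚ.≤-refl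
0≤ι (suc n) = subst (ℚ._≤ 1ℚ ℚ.+ ι n) (ℚ.+-identityˡ 0ℚ) (ℚ.+-mono-≤ (ℚ.<⇒≤ (ℚ.positive⁻¹ 1ℚ)) (0≤ι n))

ι-inverse : ∀ n → ∃ λ q → 0ℚ ℚ.≤ q × ι (suc n) ℚ.* q ≡ 1ℚ
ι-inverse n = let q , 0<q , eq = shrink 0<ι (ℚ.positive⁻¹ 1ℚ) in q , ℚ.<⇒≤ 0<q , eq
  where
  0<ι : 0ℚ ℚ.< ι (suc n)
  0<ι = ℚ.<-≤-trans (ℚ.positive⁻¹ 1ℚ) (subst (ℚ._≤ ι (suc n)) (ℚ.+-identityʳ 1ℚ) (ℚ.+-monoʳ-≤ 1ℚ (0≤ι n)))

-- Lists with repetitions rather than functions on subsets: moving weight from one set to others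
-- then amounts to replacing entries.
Weighted : ℕ → Set
Weighted N = List (ℝ × Subset N)

-- Evaluated at each index of the approximating sequences. Redistributions of weight preserve it
-- exactly, so they can be stated with `_≡_`, and the order on reals enters only through signs.
total : ∀ {N} → (Subset N → ℕ) → Weighted N → ℕ → ℚ
total φ []            n = 0ℚ
total φ ((w , B) ∷ L) n = seq w n ℚ.* ι (φ B) ℚ.+ total φ L n

NonNeg : ∀ {N} → Weighted N → Set
NonNeg = All (λ (w , _) → seq 0ℝ ≼ seq w)

Carried : ∀ {N} → (Subset N → Set) → Weighted N → Set
Carried P = All (λ (_ , B) → P B)

total-++ : ∀ {N} (φ : Subset N → ℕ) L L′ n → total φ (L ++ L′) n ≡ total φ L n ℚ.+ total φ L′ n
total-++ φ []            L′ n = sym (ℚ.+-identityˡ _)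
total-++ φ ((w , B) ∷ L) L′ n =
  trans (cong (seq w n ℚ.* ι (φ B) ℚ.+_) (total-++ φ L L′ n)) (sym (ℚ.+-assoc (seq w n ℚ.* ι (φ B)) _ _))

0≼term : ∀ w m → seq 0ℝ ≼ seq w → (λ _ → 0ℚ) ≼ (λ n → seq w n ℚ.* ι m)
0≼term w m 0≤w = ≼-trans (≡⇒≼ λ n → sym (ℚ.*-zeroʳ (ι m)))
  (≼-trans (scale-≼ (ι m) (0≤ι m) 0≤w) (≡⇒≼ λ n → ℚ.*-comm (ι m) (seq w n)))

term≼0 : ∀ w m → seq w ≼ seq 0ℝ → (λ n → seq w n ℚ.* ι m) ≼ (λ _ → 0ℚ)
term≼0 w m w≤0 = ≼-trans (≡⇒≼ λ n → ℚ.*-comm (seq w n) (ι m))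
  (≼-trans (scale-≼ (ι m) (0≤ι m) w≤0) (≡⇒≼ λ n → ℚ.*-zeroʳ (ι m)))

0≼total : ∀ {N} (φ : Subset N → ℕ) {L} → NonNeg L → (λ _ → 0ℚ) ≼ total φ L
0≼total φ []                          = ≡⇒≼ λ _ → refl
0≼total φ (_∷_ {x = w , B} 0≤w 0≤L) =
  ≼-trans (≡⇒≼ λ _ → sym (ℚ.+-identityˡ 0ℚ)) (+-mono-≼ (0≼term w (φ B) 0≤w) (0≼total φ 0≤L))

total-cong : ∀ {N} {φ ψ : Subset N → ℕ} {L} → Carried (λ B → φ B ≡ ψ B) L → ∀ n → total φ L n ≡ total ψ L n
total-cong []                          n = refl
total-cong (_∷_ {x = w , B} eq eqs) n = cong₂ (λ m t → seq w n ℚ.* ι m ℚ.+ t) eq (total-cong eqs n)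

total-+ : ∀ {N} (φ ψ : Subset N → ℕ) L n → total (λ B → φ B + ψ B) L n ≡ total φ L n ℚ.+ total ψ L n
total-+ φ ψ []            n = sym (ℚ.+-identityˡ 0ℚ)
total-+ φ ψ ((w , B) ∷ L) n =
  trans (cong₂ (λ m t → seq w n ℚ.* m ℚ.+ t) (ι-+ (φ B) (ψ B)) (total-+ φ ψ L n))
    (rearrange (seq w n) (ι (φ B)) (ι (ψ B)) (total φ L n) (total ψ L n))
  where
  open ℚ-Solver
  rearrange : ∀ w a b s t → w ℚ.* (a ℚ.+ b) ℚ.+ (s ℚ.+ t) ≡ (w ℚ.* a ℚ.+ s) ℚ.+ (w ℚ.* b ℚ.+ t)
  rearrange = solve 5 (λ w a b s t → w :* (a :+ b) :+ (s :+ t) := (w :* a :+ s) :+ (w :* b :+ t)) refl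

total-const : ∀ {N} r (L : Weighted N) n → total (λ _ → r) L n ≡ ι r ℚ.* total (λ _ → 1) L n
total-const r []            n = sym (ℚ.*-zeroʳ (ι r))
total-const r ((w , B) ∷ L) n =
  trans (cong (seq w n ℚ.* ι r ℚ.+_) (total-const r L n)) (rearrange (seq w n) (ι r) (total (λ _ → 1) L n))
  where
  open ℚ-Solver
  rearrange : ∀ w r s → w ℚ.* r ℚ.+ r ℚ.* s ≡ r ℚ.* (w ℚ.* ι 1 ℚ.+ s)
  rearrange = solve 3 (λ w r s → w :* r :+ r :* s := r :* (w :* con (ι 1) :+ s)) refl

-- The relation between indicator functions that expresses one relaxation.

Σ⟨_⟩ : ∀ {N} → (Subset N → ℕ) → List (Subset N) → ℕ
Σ⟨ φ ⟩ Bs = sumℕ (List.map φ Bs)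

Σ-replicate : ∀ {N} (φ : Subset N → ℕ) m B → Σ⟨ φ ⟩ (List.replicate m B) ≡ m * φ B
Σ-replicate φ zero    B = refl
Σ-replicate φ (suc m) B = cong (φ B +_) (Σ-replicate φ m B)

Σ≤ : ∀ {N r} {φ : Subset N → ℕ} {Bs} → All (λ B → φ B ≤ r) Bs → Σ⟨ φ ⟩ Bs ≤ length Bs * r
Σ≤ []       = z≤n
Σ≤ (p ∷ ps) = ℕ.+-mono-≤ p (Σ≤ ps)

≤Σ : ∀ {N r} {φ : Subset N → ℕ} {Bs} → All (λ B → r ≤ φ B) Bs → length Bs * r ≤ Σ⟨ φ ⟩ Bs
≤Σ []       = z≤n
≤Σ (p ∷ ps) = ℕ.+-mono-≤ p (≤Σ ps)

-- The affine functionals in play: the mass, and the coordinate sum over a set Z.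
feature : ∀ {N} → Maybe (Subset N) → Subset N → ℕ
feature nothing  B = 1
feature (just Z) B = ∣ Z ∩ B ∣

total-map : ∀ {N} (φ : Subset N → ℕ) t Bs n → total φ (List.map (t ,_) Bs) n ≡ seq t n ℚ.* ι (Σ⟨ φ ⟩ Bs)
total-map φ t []       n = sym (ℚ.*-zeroʳ (seq t n))
total-map φ t (B ∷ Bs) n = trans (cong (seq t n ℚ.* ι (φ B) ℚ.+_) (total-map φ t Bs n))
  (trans (sym (ℚ.*-distribˡ-+ (seq t n) (ι (φ B)) (ι (Σ⟨ φ ⟩ Bs))))
         (cong (seq t n ℚ.*_) (sym (ι-+ (φ B) (Σ⟨ φ ⟩ Bs)))))

scale-nonneg : ∀ q x → 0ℚ ℚ.≤ q → seq 0ℝ ≼ seq x → seq 0ℝ ≼ seq (q • x)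
scale-nonneg q x 0≤q 0≤x = ≼-trans (≡⇒≼ λ _ → sym (ℚ.*-zeroʳ q)) (scale-≼ q 0≤q 0≤x)

-- If d copies of C and e copies of B sum to Bs, then weight w on C can be moved to
-- Bs together with a part of the weight v on B, provided w / d ≤ v / e.
consume : ∀ {N} d e (C B : Subset N) Bs →
          (∀ j → Σ⟨ feature j ⟩ Bs ≡ suc d * feature j C + suc e * feature j B) →
          ∀ w v → seq 0ℝ ≼ seq w → seq (proj₁ (ι-inverse d) • w) ≼ seq (proj₁ (ι-inverse e) • v) →
          ∃₂ λ t v′ → seq 0ℝ ≼ seq t × seq 0ℝ ≼ seq v′ × (∀ j n →
            total (feature j) (List.map (t ,_) Bs) n ℚ.+ seq v′ n ℚ.* ι (feature j B) ≡
            seq w n ℚ.* ι (feature j C) ℚ.+ seq v n ℚ.* ι (feature j B))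
-- t is the weight of one of the d + 1 copies of C and t′ what each of the e + 1 copies of B can
-- offer; e + 1 times the difference stays on B.
consume d e C B Bs Σ≡ w v 0≤w t≤t′ = t , ι (suc e) • (t′ +ℝ (ℚ.- 1ℚ) • t) ,
  scale-nonneg p w 0≤p 0≤w ,
  scale-nonneg (ι (suc e)) (t′ +ℝ (ℚ.- 1ℚ) • t) (0≤ι (suc e))
    (≼-trans (≡⇒≼ λ n → sym (cancel (seq t n))) (+-mono-≼ t≤t′ (≡⇒≼ {v = λ n → (ℚ.- 1ℚ) ℚ.* seq t n} λ _ → refl))) ,
  balance
  where
  p = proj₁ (ι-inverse d)
  0≤p = proj₁ (proj₂ (ι-inverse d))
  q = proj₁ (ι-inverse e)
  t = p • w
  t′ = q • v
  open ℚ-Solver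
  cancel : ∀ a → a ℚ.+ (ℚ.- 1ℚ) ℚ.* a ≡ 0ℚ
  cancel = solve 1 (λ a → a :+ (con (ℚ.- 1ℚ)) :* a := con 0ℚ) refl
  regroup : ∀ d e p q w v c b →
            p ℚ.* w ℚ.* (d ℚ.* c ℚ.+ e ℚ.* b) ℚ.+ e ℚ.* (q ℚ.* v ℚ.+ (ℚ.- 1ℚ) ℚ.* (p ℚ.* w)) ℚ.* b ≡
            (d ℚ.* p) ℚ.* w ℚ.* c ℚ.+ (e ℚ.* q) ℚ.* v ℚ.* b
  regroup = solve 8 (λ d e p q w v c b →
    p :* w :* (d :* c :+ e :* b) :+ e :* (q :* v :+ con (ℚ.- 1ℚ) :* (p :* w)) :* b :=
    (d :* p) :* w :* c :+ (e :* q) :* v :* b) refl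
  balance : ∀ j n → total (feature j) (List.map (t ,_) Bs) n ℚ.+ seq (ι (suc e) • (t′ +ℝ (ℚ.- 1ℚ) • t)) n ℚ.* ι (feature j B) ≡
                    seq w n ℚ.* ι (feature j C) ℚ.+ seq v n ℚ.* ι (feature j B)
  balance j n = begin
    total (feature j) (List.map (t ,_) Bs) n ℚ.+ rest
      ≡⟨ cong (ℚ._+ rest) (trans (total-map (feature j) t Bs n) (cong (λ m → seq t n ℚ.* m)
           (trans (cong ι (Σ≡ j)) (trans (ι-+ (suc d * c) (suc e * b)) (cong₂ ℚ._+_ (ι-* (suc d) c) (ι-* (suc e) b)))))) ⟩
    p ℚ.* seq w n ℚ.* (ι (suc d) ℚ.* ι c ℚ.+ ι (suc e) ℚ.* ι b) ℚ.+ rest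
      ≡⟨ regroup (ι (suc d)) (ι (suc e)) p q (seq w n) (seq v n) (ι c) (ι b) ⟩
    (ι (suc d) ℚ.* p) ℚ.* seq w n ℚ.* ι c ℚ.+ (ι (suc e) ℚ.* q) ℚ.* seq v n ℚ.* ι b
      ≡⟨ cong₂ (λ x y → x ℚ.* seq w n ℚ.* ι c ℚ.+ y ℚ.* seq v n ℚ.* ι b) (proj₂ (proj₂ (ι-inverse d))) (proj₂ (proj₂ (ι-inverse e))) ⟩
    1ℚ ℚ.* seq w n ℚ.* ι c ℚ.+ 1ℚ ℚ.* seq v n ℚ.* ι b
      ≡⟨ cong₂ (λ x y → x ℚ.* ι c ℚ.+ y ℚ.* ι b) (ℚ.*-identityˡ (seq w n)) (ℚ.*-identityˡ (seq v n)) ⟩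
    seq w n ℚ.* ι c ℚ.+ seq v n ℚ.* ι b ∎
    where
    open ≡-Reasoning
    c = feature j C
    b = feature j B
    rest = ι (suc e) ℚ.* (q ℚ.* seq v n ℚ.+ (ℚ.- 1ℚ) ℚ.* (p ℚ.* seq w n)) ℚ.* ι b

module Relaxation {N : ℕ} {E : Subset N} {S : SetSystem E} {k : ℕ} {A : Subset N} {r : ℕ}
                  (matroid : IsMatroid S) (rel : Relaxable S k A r) where

  X : SetSystem E
  X = exactly E k A r

  AtLeast : Subset N → Set
  AtLeast C = C ⊆ E × ∣ C ∣ ≡ k × r ≤ ∣ C ∩ A ∣

  private
    r≤∩A : ∀ {Cs} → All AtLeast Cs → All (λ C → r ≤ ∣ C ∩ A ∣) Cs
    r≤∩A = All.map λ (_ , _ , r≤) → r≤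

    ∩A≤r : ∀ {Bs} → All (Basis S) Bs → All (λ B → ∣ B ∩ A ∣ ≤ r) Bs
    ∩A≤r = All.map (bound rel)

    excess : List (Subset N) → ℕ
    excess = Σ⟨ (λ C → ∣ C ∩ A ∣) ⟩

    -- Taking all features together, Ds has as many members as Cs and Bs and the same sum of
    -- incidence vectors.
    Balanced : List (Subset N) → List (Subset N) → Set
    Balanced Cs Bs = ∃ λ Ds → All (Basis X) Ds × (∀ j → Σ⟨ feature j ⟩ Ds ≡ Σ⟨ feature j ⟩ Cs + Σ⟨ feature j ⟩ Bs)

    -- The mean intersection with A over both lists is r. Replacement by bases of X with the same
    -- features forces this, and `balance` shows that it suffices.
    Balanceable : List (Subset N) → List (Subset N) → Set
    Balanceable Cs Bs = excess Cs + excess Bs ≡ length Cs * r + length Bs * r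

    swap-feature : ∀ j {B C x y} → x ∈ B ─ A → x ∉ C → y ∈ C ∩ A → y ∉ B →
                   feature j (swap C y x) + feature j (swap B x y) ≡ feature j C + feature j B
    swap-feature nothing  _ _ _ _ = refl
    swap-feature (just Z) {B} {C} {x} {y} x∈ x∉ y∈ y∉ = counting 5 0 (λ Z B C x y → x ⊆ᶠ B ∷ x ⊆ᶠ ∁ᶠ C ∷ y ⊆ᶠ C ∷ y ⊆ᶠ ∁ᶠ B ∷ [] ⊢
           ∣ Z ∩ᶠ ((C ─ᶠ y) ∪ᶠ x) ∣ᵉ +ᵉ ∣ Z ∩ᶠ ((B ─ᶠ x) ∪ᶠ y) ∣ᵉ ≡ᵉ ∣ Z ∩ᶠ C ∣ᵉ +ᵉ ∣ Z ∩ᶠ B ∣ᵉ)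
      Z B C ⁅ x ⁆ ⁅ y ⁆
      (∈⇒⁅⁆⊆ (p─q⊆p B A x∈)) (∉⇒⁅⁆⊆∁ x∉) (∈⇒⁅⁆⊆ (p∩q⊆p C A y∈)) (∉⇒⁅⁆⊆∁ y∉)

    module Exchanged {B C x y} (c : AtLeast C) (r≢C : r ≢ ∣ C ∩ A ∣)
                     (x∈ : x ∈ B ─ A) (x∉C : x ∉ C) (y∈ : y ∈ C ∩ A) (y∉B : y ∉ B) where

      ∣C∩A∣ : suc ∣ swap C y x ∩ A ∣ ≡ ∣ C ∩ A ∣
      ∣C∩A∣ = counting 4 0 (λ C A x y → x ⊆ᶠ ∁ᶠ A ∷ y ⊆ᶠ C ∩ᶠ A ∷ ∣ y ∣ᵉ ≡ᵉ lit 1 ∷ [] ⊢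
        lit 1 +ᵉ ∣ ((C ─ᶠ y) ∪ᶠ x) ∩ᶠ A ∣ᵉ ≡ᵉ ∣ C ∩ᶠ A ∣ᵉ) C A ⁅ x ⁆ ⁅ y ⁆
        (∉⇒⁅⁆⊆∁ (proj₂ (x∈p─q⁻ B A x∈))) (∈⇒⁅⁆⊆ y∈) (∣⁅x⁆∣≡1 y)

      ∣B∩A∣ : ∣ swap B x y ∩ A ∣ ≡ suc ∣ B ∩ A ∣
      ∣B∩A∣ = counting 4 0 (λ B A x y → x ⊆ᶠ ∁ᶠ A ∷ y ⊆ᶠ A ∷ y ⊆ᶠ ∁ᶠ B ∷ ∣ y ∣ᵉ ≡ᵉ lit 1 ∷ [] ⊢
        ∣ ((B ─ᶠ x) ∪ᶠ y) ∩ᶠ A ∣ᵉ ≡ᵉ lit 1 +ᵉ ∣ B ∩ᶠ A ∣ᵉ) B A ⁅ x ⁆ ⁅ y ⁆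
        (∉⇒⁅⁆⊆∁ (proj₂ (x∈p─q⁻ B A x∈))) (∈⇒⁅⁆⊆ (p∩q⊆q C A y∈)) (∉⇒⁅⁆⊆∁ y∉B) (∣⁅x⁆∣≡1 y)

      atLeast : Basis S B → AtLeast (swap C y x)
      atLeast b = swap-⊆ (proj₁ c) (Basis⊆ S b (p─q⊆p B A x∈)) ,
        trans (∣swap∣ {B = C} (p∩q⊆p C A y∈) x∉C) (proj₁ (proj₂ c)) ,
        ℕ.≤-pred (subst (r <_) (sym ∣C∩A∣) (ℕ.≤∧≢⇒< (proj₂ (proj₂ c)) r≢C))

    -- A head that meets A in exactly r elements is set aside. Otherwise C is above r and B below,
    -- and `exchange-towards` moves an element of A from C to B without changing their sum. The fuel
    -- pays for both: setting aside shortens a list, an exchange lowers the excess of Cs. If one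
    -- list is exhausted, the mean value r leaves only tight sets in the other.
    balance : ∀ fuel Cs Bs → All AtLeast Cs → All (Basis S) Bs → Balanceable Cs Bs →
              excess Cs + (length Cs + length Bs) ≤ fuel → Balanced Cs Bs
    balance fuel [] [] [] [] _ _ = [] , [] , λ _ → refl
    balance (suc fuel) [] (B ∷ Bs) [] (b ∷ bs) eq ≤fuel =
      let Ds , ds , Σ≡ = balance fuel [] Bs [] bs eq′ (ℕ.≤-pred ≤fuel)
      in B ∷ Ds , (Basis⊆ S b , size rel b , B∩A) ∷ ds , λ j → cong (feature j B +_) (Σ≡ j)
      where
      B∩A : ∣ B ∩ A ∣ ≡ r
      B∩A = linear 4 (λ a r s l → a ≤ᵉ r ∷ s ≤ᵉ l ∷ a +ᵉ s ≡ᵉ r +ᵉ l ∷ [] ⊢ a ≡ᵉ r)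
              ∣ B ∩ A ∣ r (excess Bs) (length Bs * r) (bound rel b) (Σ≤ (∩A≤r bs)) eq
      eq′ : excess Bs ≡ length Bs * r
      eq′ = linear 4 (λ a r s l → a ≤ᵉ r ∷ s ≤ᵉ l ∷ a +ᵉ s ≡ᵉ r +ᵉ l ∷ [] ⊢ s ≡ᵉ l)
              ∣ B ∩ A ∣ r (excess Bs) (length Bs * r) (bound rel b) (Σ≤ (∩A≤r bs)) eq
    balance zero (C ∷ Cs) Bs _ _ _ ≤0 = ⊥-elim (ℕ.m+1+n≢0 (∣ C ∩ A ∣ + excess Cs) (ℕ.n≤0⇒n≡0 ≤0))
    balance (suc fuel) (C ∷ Cs) Bs (c@(C⊆E , ∣C∣ , r≤C) ∷ cs) bs eq ≤fuel with r ℕ.≟ ∣ C ∩ A ∣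
    ... | yes r≡ =
      let Ds , ds , Σ≡ = balance fuel Cs Bs cs bs
            (linear 6 (λ a r s s′ l l′ → r ≡ᵉ a ∷ (a +ᵉ s) +ᵉ s′ ≡ᵉ (r +ᵉ l) +ᵉ l′ ∷ [] ⊢ s +ᵉ s′ ≡ᵉ l +ᵉ l′)
              ∣ C ∩ A ∣ r (excess Cs) (excess Bs) (length Cs * r) (length Bs * r) r≡ eq)
            (linear 5 (λ a s l l′ f → (a +ᵉ s) +ᵉ ((lit 1 +ᵉ l) +ᵉ l′) ≤ᵉ lit 1 +ᵉ f ∷ [] ⊢ s +ᵉ (l +ᵉ l′) ≤ᵉ f)
              ∣ C ∩ A ∣ (excess Cs) (length Cs) (length Bs) fuel ≤fuel)
      in C ∷ Ds , (C⊆E , ∣C∣ , sym r≡) ∷ ds , λ j →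
           trans (cong (feature j C +_) (Σ≡ j)) (sym (ℕ.+-assoc (feature j C) _ _))
    balance (suc fuel) (C ∷ Cs) [] (c@(C⊆E , ∣C∣ , r≤C) ∷ cs) [] eq ≤fuel | no r≢ =
      ⊥-elim (ℕ.<⇒≢ (ℕ.+-mono-<-≤ (ℕ.+-mono-<-≤ (ℕ.≤∧≢⇒< r≤C r≢) (≤Σ (r≤∩A cs))) ℕ.≤-refl) (sym eq))
    balance (suc fuel) (C ∷ Cs) (B ∷ Bs) (c@(C⊆E , ∣C∣ , r≤C) ∷ cs) (b ∷ bs) eq ≤fuel | no r≢ with ∣ B ∩ A ∣ ℕ.≟ r
    ... | yes ≡r =
      let Ds , ds , Σ≡ = balance fuel (C ∷ Cs) Bs (c ∷ cs) bs
            (linear 6 (λ a r s s′ l l′ → a ≡ᵉ r ∷ s +ᵉ (a +ᵉ s′) ≡ᵉ l +ᵉ (r +ᵉ l′) ∷ [] ⊢ s +ᵉ s′ ≡ᵉ l +ᵉ l′)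
              ∣ B ∩ A ∣ r (excess (C ∷ Cs)) (excess Bs) (length (C ∷ Cs) * r) (length Bs * r) ≡r eq)
            (linear 4 (λ s l l′ f → s +ᵉ (l +ᵉ (lit 1 +ᵉ l′)) ≤ᵉ lit 1 +ᵉ f ∷ [] ⊢ s +ᵉ (l +ᵉ l′) ≤ᵉ f)
              (excess (C ∷ Cs)) (length (C ∷ Cs)) (length Bs) fuel ≤fuel)
      in B ∷ Ds , (Basis⊆ S b , size rel b , ≡r) ∷ ds , λ j →
           trans (cong (feature j B +_) (Σ≡ j))
             (linear 3 (λ b s s′ → [] ⊢ b +ᵉ (s +ᵉ s′) ≡ᵉ s +ᵉ (b +ᵉ s′))
               (feature j B) (Σ⟨ feature j ⟩ (C ∷ Cs)) (Σ⟨ feature j ⟩ Bs))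
    ... | no ≢r = finish (exchange-towards rel matroid b (ℕ.≤∧≢⇒< (bound rel b) ≢r) C⊆E ∣C∣ (ℕ.≤∧≢⇒< r≤C r≢))
      where
      finish : (∃₂ λ x y → x ∈ B ─ A × x ∉ C × y ∈ C ∩ A × y ∉ B × Basis S (swap B x y)) → Balanced (C ∷ Cs) (B ∷ Bs)
      finish (x , y , x∈ , x∉C , y∈ , y∉B , b′) =
        let open Exchanged {B} {C} {x} {y} c r≢ x∈ x∉C y∈ y∉B
            Ds , ds , Σ≡ = balance fuel (swap C y x ∷ Cs) (swap B x y ∷ Bs) (atLeast b ∷ cs) (b′ ∷ bs)
              (linear 8 (λ c c′ b b′ s s′ l l′ → lit 1 +ᵉ c′ ≡ᵉ c ∷ b′ ≡ᵉ lit 1 +ᵉ b ∷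
                   (c +ᵉ s) +ᵉ (b +ᵉ s′) ≡ᵉ l +ᵉ l′ ∷ [] ⊢ (c′ +ᵉ s) +ᵉ (b′ +ᵉ s′) ≡ᵉ l +ᵉ l′)
                (∣ C ∩ A ∣) (∣ swap C y x ∩ A ∣) (∣ B ∩ A ∣) (∣ swap B x y ∩ A ∣) (excess Cs) (excess Bs) (length (C ∷ Cs) * r) (length (B ∷ Bs) * r) ∣C∩A∣ ∣B∩A∣ eq)
              (linear 5 (λ c c′ s l f → lit 1 +ᵉ c′ ≡ᵉ c ∷ (c +ᵉ s) +ᵉ l ≤ᵉ lit 1 +ᵉ f ∷ [] ⊢ (c′ +ᵉ s) +ᵉ l ≤ᵉ f)
                (∣ C ∩ A ∣) (∣ swap C y x ∩ A ∣) (excess Cs) (length (C ∷ Cs) + length (B ∷ Bs)) fuel ∣C∩A∣ ≤fuel)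
        in Ds , ds , λ j → trans (Σ≡ j)
             (linear 6 (λ c c′ b b′ s s′ → c′ +ᵉ b′ ≡ᵉ c +ᵉ b ∷ [] ⊢ (c′ +ᵉ s) +ᵉ (b′ +ᵉ s′) ≡ᵉ (c +ᵉ s) +ᵉ (b +ᵉ s′))
               (feature j C) (feature j (swap C y x)) (feature j B) (feature j (swap B x y)) (Σ⟨ feature j ⟩ Cs) (Σ⟨ feature j ⟩ Bs)
               (swap-feature j {B} {C} {x} {y} x∈ x∉C y∈ y∉B))

    balance-pair : ∀ {C B} → AtLeast C → Basis S B → r < ∣ C ∩ A ∣ → ∣ B ∩ A ∣ < r →
                   ∃₂ λ d e → ∃ λ Ds → All (Basis X) Ds ×
                   (∀ j → Σ⟨ feature j ⟩ Ds ≡ suc d * feature j C + suc e * feature j B)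
    balance-pair {C} {B} c b r<C B<r = d , e ,
      finish (balance _ (List.replicate (suc d) C) (List.replicate (suc e) B)
        (All.replicate⁺ (suc d) c) (All.replicate⁺ (suc e) b) balanceable ℕ.≤-refl)
      where
      -- `suc e` is the excess of C over r and `suc d` the deficit of B; taking them as
      -- multiplicities of the opposite sets makes the mean r.
      e = ∣ C ∩ A ∣ ∸ suc r
      d = r ∸ suc ∣ B ∩ A ∣
      C≡ : ∣ C ∩ A ∣ ≡ suc e + r
      C≡ = sym (trans (sym (ℕ.+-suc e r)) (ℕ.m∸n+n≡m r<C))
      r≡ : r ≡ suc d + ∣ B ∩ A ∣
      r≡ = sym (trans (sym (ℕ.+-suc d ∣ B ∩ A ∣)) (ℕ.m∸n+n≡m B<r))
      identity : ∀ d e b r → r ≡ d + b → d * (e + r) + e * b ≡ d * r + e * r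
      identity d e b _ refl = solve 3 (λ d e b → d :* (e :+ (d :+ b)) :+ e :* b := d :* (d :+ b) :+ e :* (d :+ b)) refl d e b
        where open ℕ-Solver
      balanceable : Balanceable (List.replicate (suc d) C) (List.replicate (suc e) B)
      balanceable = begin
        excess (List.replicate (suc d) C) + excess (List.replicate (suc e) B)
          ≡⟨ cong₂ _+_ (Σ-replicate (λ D → ∣ D ∩ A ∣) (suc d) C) (Σ-replicate (λ D → ∣ D ∩ A ∣) (suc e) B) ⟩
        suc d * ∣ C ∩ A ∣ + suc e * ∣ B ∩ A ∣
          ≡⟨ cong (λ m → suc d * m + suc e * ∣ B ∩ A ∣) C≡ ⟩
        suc d * (suc e + r) + suc e * ∣ B ∩ A ∣
          ≡⟨ identity (suc d) (suc e) ∣ B ∩ A ∣ r r≡ ⟩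
        suc d * r + suc e * r
          ≡⟨ cong₂ (λ l l′ → l * r + l′ * r) (List.length-replicate (suc d)) (List.length-replicate (suc e)) ⟨
        length (List.replicate (suc d) C) * r + length (List.replicate (suc e) B) * r ∎
        where open ≡-Reasoning
      finish : Balanced (List.replicate (suc d) C) (List.replicate (suc e) B) →
               ∃ λ Ds → All (Basis X) Ds × (∀ j → Σ⟨ feature j ⟩ Ds ≡ suc d * feature j C + suc e * feature j B)
      finish (Ds , ds , Σ≡) = Ds , ds , λ j →
        trans (Σ≡ j) (cong₂ _+_ (Σ-replicate (feature j) (suc d) C) (Σ-replicate (feature j) (suc e) B))

    Outcome : Weighted N → Set
    Outcome L = ∃ λ L′ → NonNeg L′ × (Carried AtLeast L′ ⊎ Carried (Basis S) L′) ×
                (∀ j n → total (feature j) L′ n ≡ total (feature j) L n)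

    X⇒AtLeast : ∀ {B} → Basis X B → AtLeast B
    X⇒AtLeast (B⊆E , ∣B∣ , B∩A) = B⊆E , ∣B∣ , ℕ.≤-reflexive (sym B∩A)

    X⇒S : ∀ {B} → Basis X B → Basis S B
    X⇒S (B⊆E , ∣B∣ , B∩A) = full rel B⊆E ∣B∣ B∩A

    -- Bases of X are bases of S and of Λ alike, so their weight can be put aside before it is known
    -- which way the rest will turn out.
    add-X : ∀ L L₀ (K : Weighted N) → NonNeg K → Carried (Basis X) K →
            (∀ j n → total (feature j) K n ℚ.+ total (feature j) L n ≡ total (feature j) L₀ n) →
            Outcome L → Outcome L₀
    add-X L L₀ K 0≤K xs eq (L′ , 0≤L′ , carried , eq′) = K ++ L′ , All.++⁺ 0≤K 0≤L′ ,
      [ (λ cs → inj₁ (All.++⁺ (All.map X⇒AtLeast xs) cs)) , (λ bs → inj₂ (All.++⁺ (All.map X⇒S xs) bs)) ]′ carried ,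
      λ j n → trans (total-++ (feature j) K L′ n) (trans (cong (total (feature j) K n ℚ.+_) (eq′ j n)) (eq j n))

    term : Maybe (Subset N) → ℝ → Subset N → ℕ → ℚ
    term j w B n = seq w n ℚ.* ι (feature j B)

    record Trade (w : ℝ) (C : Subset N) (v : ℝ) (B : Subset N) : Set where
      field
        K    : Weighted N
        0≤K  : NonNeg K
        K⊆X  : Carried (Basis X) K
        rest : (∃ λ v′ → seq 0ℝ ≼ seq v′ × (∀ j n → total (feature j) K n ℚ.+ term j v′ B n ≡ term j w C n ℚ.+ term j v B n)) ⊎
               (∃ λ w′ → seq 0ℝ ≼ seq w′ × (∀ j n → total (feature j) K n ℚ.+ term j w′ C n ≡ term j v B n ℚ.+ term j w C n))

    -- Whether C or B is used up depends on comparing w / (d + 1) with v / (e + 1), and the order of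
    -- the reals is total only under double negation. This is the origin of the continuation style
    -- in what follows.
    trade : ∀ {w C v B} → seq 0ℝ ≼ seq w → seq 0ℝ ≼ seq v → AtLeast C → Basis S B →
            r < ∣ C ∩ A ∣ → ∣ B ∩ A ∣ < r → ¬ ¬ Trade w C v B
    trade {w} {C} {v} {B} 0≤w 0≤v c b r<C B<r continue = split (balance-pair c b r<C B<r)
      where
      split : (∃₂ λ d e → ∃ λ Ds → All (Basis X) Ds × (∀ j → Σ⟨ feature j ⟩ Ds ≡ suc d * feature j C + suc e * feature j B)) → 𝟘
      split (d , e , Ds , ds , Σ≡) = ¬¬-total (proj₁ (ι-inverse d) • w) (proj₁ (ι-inverse e) • v)
        [ (λ t≤t′ → use-up-C (consume d e C B Ds Σ≡ w v 0≤w t≤t′))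
        , (λ t′≤t → use-up-B (consume e d B C Ds (λ j → trans (Σ≡ j) (ℕ.+-comm (suc d * feature j C) _)) v w 0≤v t′≤t)) ]′
        where
        reweighted : ∀ t → seq 0ℝ ≼ seq t → NonNeg (List.map (t ,_) Ds)
        reweighted t 0≤t = All.map⁺ (All.map (λ _ → 0≤t) ds)

        use-up-C : (∃₂ λ t v′ → seq 0ℝ ≼ seq t × seq 0ℝ ≼ seq v′ × (∀ j n →
                     total (feature j) (List.map (t ,_) Ds) n ℚ.+ term j v′ B n ≡ term j w C n ℚ.+ term j v B n)) → 𝟘
        use-up-C (t , v′ , 0≤t , 0≤v′ , eq) = continue record
          { K = List.map (t ,_) Ds ; 0≤K = reweighted t 0≤t ; K⊆X = All.map⁺ ds ; rest = inj₁ (v′ , 0≤v′ , eq) }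

        use-up-B : (∃₂ λ t w′ → seq 0ℝ ≼ seq t × seq 0ℝ ≼ seq w′ × (∀ j n →
                     total (feature j) (List.map (t ,_) Ds) n ℚ.+ term j w′ C n ≡ term j v B n ℚ.+ term j w C n)) → 𝟘
        use-up-B (t , w′ , 0≤t , 0≤w′ , eq) = continue record
          { K = List.map (t ,_) Ds ; 0≤K = reweighted t 0≤t ; K⊆X = All.map⁺ ds ; rest = inj₂ (w′ , 0≤w′ , eq) }

    move-B : ∀ {C B} (K : Weighted N) w v v′ Cs Bs j n →
             total (feature j) K n ℚ.+ term j v′ B n ≡ term j w C n ℚ.+ term j v B n →
             total (feature j) K n ℚ.+ total (feature j) (Cs ++ (v′ , B) ∷ Bs) n ≡
             total (feature j) (((w , C) ∷ Cs) ++ ((v , B) ∷ Bs)) n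
    move-B {C} {B} K w v v′ Cs Bs j n eq = begin
      tK ℚ.+ total (feature j) (Cs ++ (v′ , B) ∷ Bs) n    ≡⟨ cong (tK ℚ.+_) (total-++ (feature j) Cs ((v′ , B) ∷ Bs) n) ⟩
      tK ℚ.+ (tC ℚ.+ (term j v′ B n ℚ.+ tB))              ≡⟨ collect tK tC (term j v′ B n) tB ⟩
      (tK ℚ.+ term j v′ B n) ℚ.+ (tC ℚ.+ tB)              ≡⟨ cong (ℚ._+ (tC ℚ.+ tB)) eq ⟩
      (term j w C n ℚ.+ term j v B n) ℚ.+ (tC ℚ.+ tB)     ≡⟨ distribute (term j w C n) (term j v B n) tC tB ⟩
      (term j w C n ℚ.+ tC) ℚ.+ (term j v B n ℚ.+ tB)     ≡⟨ total-++ (feature j) ((w , C) ∷ Cs) ((v , B) ∷ Bs) n ⟨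
      total (feature j) (((w , C) ∷ Cs) ++ ((v , B) ∷ Bs)) n ∎
      where
      open ≡-Reasoning
      open ℚ-Solver
      tK = total (feature j) K n
      tC = total (feature j) Cs n
      tB = total (feature j) Bs n
      collect : ∀ t x b y → t ℚ.+ (x ℚ.+ (b ℚ.+ y)) ≡ (t ℚ.+ b) ℚ.+ (x ℚ.+ y)
      collect = solve 4 (λ t x b y → t :+ (x :+ (b :+ y)) := (t :+ b) :+ (x :+ y)) refl
      distribute : ∀ c b x y → (c ℚ.+ b) ℚ.+ (x ℚ.+ y) ≡ (c ℚ.+ x) ℚ.+ (b ℚ.+ y)
      distribute = solve 4 (λ c b x y → (c :+ b) :+ (x :+ y) := (c :+ x) :+ (b :+ y)) refl

    move-C : ∀ {C B} (K : Weighted N) w v w′ Cs Bs j n →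
             total (feature j) K n ℚ.+ term j w′ C n ≡ term j v B n ℚ.+ term j w C n →
             total (feature j) K n ℚ.+ total (feature j) (((w′ , C) ∷ Cs) ++ Bs) n ≡
             total (feature j) (((w , C) ∷ Cs) ++ ((v , B) ∷ Bs)) n
    move-C {C} {B} K w v w′ Cs Bs j n eq = begin
      tK ℚ.+ total (feature j) (((w′ , C) ∷ Cs) ++ Bs) n  ≡⟨ cong (tK ℚ.+_) (total-++ (feature j) ((w′ , C) ∷ Cs) Bs n) ⟩
      tK ℚ.+ ((term j w′ C n ℚ.+ tC) ℚ.+ tB)              ≡⟨ collect tK (term j w′ C n) tC tB ⟩
      (tK ℚ.+ term j w′ C n) ℚ.+ (tC ℚ.+ tB)              ≡⟨ cong (ℚ._+ (tC ℚ.+ tB)) eq ⟩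
      (term j v B n ℚ.+ term j w C n) ℚ.+ (tC ℚ.+ tB)     ≡⟨ distribute (term j w C n) (term j v B n) tC tB ⟩
      (term j w C n ℚ.+ tC) ℚ.+ (term j v B n ℚ.+ tB)     ≡⟨ total-++ (feature j) ((w , C) ∷ Cs) ((v , B) ∷ Bs) n ⟨
      total (feature j) (((w , C) ∷ Cs) ++ ((v , B) ∷ Bs)) n ∎
      where
      open ≡-Reasoning
      open ℚ-Solver
      tK = total (feature j) K n
      tC = total (feature j) Cs n
      tB = total (feature j) Bs n
      collect : ∀ t c x y → t ℚ.+ ((c ℚ.+ x) ℚ.+ y) ≡ (t ℚ.+ c) ℚ.+ (x ℚ.+ y)
      collect = solve 4 (λ t c x y → t :+ ((c :+ x) :+ y) := (t :+ c) :+ (x :+ y)) refl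
      distribute : ∀ c b x y → (b ℚ.+ c) ℚ.+ (x ℚ.+ y) ≡ (c ℚ.+ x) ℚ.+ (b ℚ.+ y)
      distribute = solve 4 (λ c b x y → (b :+ c) :+ (x :+ y) := (c :+ x) :+ (b :+ y)) refl

    drop-B : ∀ {B} v Cs Bs j n → total (feature j) ((v , B) ∷ []) n ℚ.+ total (feature j) (Cs ++ Bs) n ≡
                                 total (feature j) (Cs ++ (v , B) ∷ Bs) n
    drop-B {B} v Cs Bs j n = trans (cong (term j v B n ℚ.+ 0ℚ ℚ.+_) (total-++ (feature j) Cs Bs n))
      (trans (rearrange (term j v B n) (total (feature j) Cs n) (total (feature j) Bs n))
             (sym (total-++ (feature j) Cs ((v , B) ∷ Bs) n)))
      where
      open ℚ-Solver
      rearrange : ∀ b x y → b ℚ.+ 0ℚ ℚ.+ (x ℚ.+ y) ≡ x ℚ.+ (b ℚ.+ y)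
      rearrange = solve 3 (λ b x y → b :+ con 0ℚ :+ (x :+ y) := x :+ (b :+ y)) refl

    -- Each step uses up one item, whence the fuel.
    resolve : ∀ fuel Cs Bs → length Cs + length Bs ≤ fuel → NonNeg Cs → NonNeg Bs →
              Carried AtLeast Cs → Carried (Basis S) Bs → ¬ ¬ Outcome (Cs ++ Bs)
    resolve fuel [] Bs _ _ 0≤Bs _ bs continue = continue (Bs , 0≤Bs , inj₂ bs , λ _ _ → refl)
    resolve fuel (C ∷ Cs) [] _ 0≤Cs _ cs _ continue =
      continue ((C ∷ Cs) ++ [] , All.++⁺ 0≤Cs [] , inj₁ (All.++⁺ cs []) , λ _ _ → refl)
    resolve (suc fuel) ((w , C) ∷ Cs) ((v , B) ∷ Bs) (s≤s ≤fuel) (0≤w ∷ 0≤Cs) (0≤v ∷ 0≤Bs) (c ∷ cs) (b ∷ bs) continue =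
      dispatch (r ℕ.≟ ∣ C ∩ A ∣) (∣ B ∩ A ∣ ℕ.≟ r)
      where
      ≤fuel′ : suc (length Cs) + length Bs ≤ fuel
      ≤fuel′ = subst (_≤ fuel) (ℕ.+-suc (length Cs) (length Bs)) ≤fuel

      L₀ = ((w , C) ∷ Cs) ++ ((v , B) ∷ Bs)

      drop-C : r ≡ ∣ C ∩ A ∣ → 𝟘
      drop-C r≡ = resolve fuel Cs ((v , B) ∷ Bs) ≤fuel 0≤Cs (0≤v ∷ 0≤Bs) cs (b ∷ bs)
        (λ outcome → continue (add-X (Cs ++ ((v , B) ∷ Bs)) L₀ ((w , C) ∷ []) (0≤w ∷ []) ((proj₁ c , proj₁ (proj₂ c) , sym r≡) ∷ [])
          (λ j n → cong (ℚ._+ total (feature j) (Cs ++ (v , B) ∷ Bs) n) (ℚ.+-identityʳ (term j w C n))) outcome))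

      after-trade : Trade w C v B → 𝟘
      after-trade record { K = K ; 0≤K = 0≤K ; K⊆X = xs ; rest = inj₁ (v′ , 0≤v′ , eq) } =
        resolve fuel Cs ((v′ , B) ∷ Bs) ≤fuel 0≤Cs (0≤v′ ∷ 0≤Bs) cs (b ∷ bs)
          (λ outcome → continue (add-X (Cs ++ ((v′ , B) ∷ Bs)) L₀ K 0≤K xs (λ j n → move-B K w v v′ Cs Bs j n (eq j n)) outcome))
      after-trade record { K = K ; 0≤K = 0≤K ; K⊆X = xs ; rest = inj₂ (w′ , 0≤w′ , eq) } =
        resolve fuel ((w′ , C) ∷ Cs) Bs ≤fuel′ (0≤w′ ∷ 0≤Cs) 0≤Bs (c ∷ cs) bs
          (λ outcome → continue (add-X (((w′ , C) ∷ Cs) ++ Bs) L₀ K 0≤K xs (λ j n → move-C K w v w′ Cs Bs j n (eq j n)) outcome))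

      dispatch : Dec (r ≡ ∣ C ∩ A ∣) → Dec (∣ B ∩ A ∣ ≡ r) → 𝟘
      dispatch (yes r≡) _        = drop-C r≡
      dispatch (no r≢)  (no ≢r)  =
        trade 0≤w 0≤v c b (ℕ.≤∧≢⇒< (proj₂ (proj₂ c)) r≢) (ℕ.≤∧≢⇒< (bound rel b) ≢r) after-trade
      dispatch (no _)   (yes ≡r) = resolve fuel ((w , C) ∷ Cs) Bs ≤fuel′ (0≤w ∷ 0≤Cs) 0≤Bs (c ∷ cs) bs
        (λ outcome → continue (add-X (((w , C) ∷ Cs) ++ Bs) L₀ ((v , B) ∷ []) (0≤v ∷ [])
          ((Basis⊆ S b , size rel b , ≡r) ∷ []) (drop-B v ((w , C) ∷ Cs) Bs) outcome))

    sort : ∀ {L} → NonNeg L → Carried (Basis (enlarge S k A r)) L →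
           ∃₂ λ Cs Bs → NonNeg Cs × NonNeg Bs × Carried AtLeast Cs × Carried (Basis S) Bs ×
           (∀ φ n → total φ Cs n ℚ.+ total φ Bs n ≡ total φ L n)
    sort [] [] = [] , [] , [] , [] , [] , [] , λ _ _ → refl
    sort (_∷_ {x = w , B} 0≤w 0≤L) (inj₁ b ∷ bs) with sort 0≤L bs
    ... | Cs , Bs , 0≤Cs , 0≤Bs , cs , bs′ , eq = Cs , (w , B) ∷ Bs , 0≤Cs , 0≤w ∷ 0≤Bs , cs , b ∷ bs′ , λ φ n →
      trans (rearrange (total φ Cs n) (seq w n ℚ.* ι (φ B)) (total φ Bs n)) (cong (seq w n ℚ.* ι (φ B) ℚ.+_) (eq φ n))
      where
      open ℚ-Solver
      rearrange : ∀ x b y → x ℚ.+ (b ℚ.+ y) ≡ b ℚ.+ (x ℚ.+ y)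
      rearrange = solve 3 (λ x b y → x :+ (b :+ y) := b :+ (x :+ y)) refl
    sort (_∷_ {x = w , B} 0≤w 0≤L) (inj₂ (B⊆E , ∣B∣ , r<B) ∷ bs) with sort 0≤L bs
    ... | Cs , Bs , 0≤Cs , 0≤Bs , cs , bs′ , eq =
      (w , B) ∷ Cs , Bs , 0≤w ∷ 0≤Cs , 0≤Bs , (B⊆E , ∣B∣ , ℕ.<⇒≤ r<B) ∷ cs , bs′ , λ φ n →
      trans (ℚ.+-assoc (seq w n ℚ.* ι (φ B)) _ _) (cong (seq w n ℚ.* ι (φ B) ℚ.+_) (eq φ n))

  one-sided : ∀ {L} → NonNeg L → Carried (Basis (enlarge S k A r)) L →
              ¬ ¬ ∃ λ L′ → NonNeg L′ × (Carried AtLeast L′ ⊎ Carried (Basis S) L′) ×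
                           (∀ j n → total (feature j) L′ n ≡ total (feature j) L n)
  one-sided {L} 0≤L rs continue = split (sort 0≤L rs)
    where
    split : (∃₂ λ Cs Bs → NonNeg Cs × NonNeg Bs × Carried AtLeast Cs × Carried (Basis S) Bs ×
             (∀ φ n → total φ Cs n ℚ.+ total φ Bs n ≡ total φ L n)) → 𝟘
    split (Cs , Bs , 0≤Cs , 0≤Bs , cs , bs , eq) = resolve (length Cs + length Bs) Cs Bs ℕ.≤-refl 0≤Cs 0≤Bs cs bs
      λ (L′ , 0≤L′ , carried , eq′) → continue (L′ , 0≤L′ , carried , λ j n →
        trans (eq′ j n) (trans (total-++ (feature j) Cs Bs n) (eq (feature j) n)))

-- Base polytopes in terms of weighted lists.

_≈ₛ_ : (u v : ℕ → ℚ) → Set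
u ≈ₛ v = u ≼ v × v ≼ u

≡⇒≈ₛ : ∀ {u v} → (∀ n → u n ≡ v n) → u ≈ₛ v
≡⇒≈ₛ eq = ≡⇒≼ eq , ≡⇒≼ (sym ∘ eq)

≈ₛ-sym : ∀ {u v} → u ≈ₛ v → v ≈ₛ u
≈ₛ-sym (u≼v , v≼u) = v≼u , u≼v

≈ₛ-trans : ∀ {u v w} → u ≈ₛ v → v ≈ₛ w → u ≈ₛ w
≈ₛ-trans (u≼v , v≼u) (v≼w , w≼v) = ≼-trans u≼v v≼w , ≼-trans w≼v v≼u

-- The base polytope with its convex combinations given by weighted lists; the i-th coordinate is
-- the total weight of the sets containing i.
InHull : ∀ {N} {E : Subset N} → SetSystem E → Point E → Set
InHull {N} {E} S x = ∃ λ (L : Weighted N) → NonNeg L × Carried (Basis S) L ×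
  total (feature nothing) L ≈ₛ seq 1ℝ × (∀ i (i∈E : i ∈ E) → seq (x i i∈E) ≈ₛ total (feature (just ⁅ i ⁆)) L)

module _ {N : ℕ} where

  sumℚ : (Subset N → ℚ) → List (Subset N) → ℚ
  sumℚ f []       = 0ℚ
  sumℚ f (B ∷ Bs) = f B ℚ.+ sumℚ f Bs

  sumℚ-cong : ∀ {f g : Subset N → ℚ} Bs → (∀ B → f B ≡ g B) → sumℚ f Bs ≡ sumℚ g Bs
  sumℚ-cong []       eq = refl
  sumℚ-cong (B ∷ Bs) eq = cong₂ ℚ._+_ (eq B) (sumℚ-cong Bs eq)

  sumℚ-+ : ∀ (f g : Subset N → ℚ) Bs → sumℚ (λ B → f B ℚ.+ g B) Bs ≡ sumℚ f Bs ℚ.+ sumℚ g Bs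
  sumℚ-+ f g []       = sym (ℚ.+-identityˡ 0ℚ)
  sumℚ-+ f g (B ∷ Bs) = trans (cong (f B ℚ.+ g B ℚ.+_) (sumℚ-+ f g Bs))
    (rearrange (f B) (g B) (sumℚ f Bs) (sumℚ g Bs))
    where
    open ℚ-Solver
    rearrange : ∀ a b c d → (a ℚ.+ b) ℚ.+ (c ℚ.+ d) ≡ (a ℚ.+ c) ℚ.+ (b ℚ.+ d)
    rearrange = solve 4 (λ a b c d → (a :+ b) :+ (c :+ d) := (a :+ c) :+ (b :+ d)) refl

  seq-sumℝ : ∀ (g : Subset N → ℝ) Bs n → seq (sumℝ (List.map g Bs)) n ≡ sumℚ (λ B → seq (g B) n) Bs
  seq-sumℝ g []       n = refl
  seq-sumℝ g (B ∷ Bs) n = cong (seq (g B) n ℚ.+_) (seq-sumℝ g Bs n)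

  total-functional : ∀ (c : Subset N → ℝ) φ Bs n →
                     total φ (List.map (λ B → c B , B) Bs) n ≡ sumℚ (λ B → seq (c B) n ℚ.* ι (φ B)) Bs
  total-functional c φ []       n = refl
  total-functional c φ (B ∷ Bs) n = cong (seq (c B) n ℚ.* ι (φ B) ℚ.+_) (total-functional c φ Bs n)

  weightOf : Weighted N → Subset N → ℝ
  weightOf []            B = 0ℝ
  weightOf ((w , C) ∷ L) B = if does (C ≟ˢ B) then w +ℝ weightOf L B else weightOf L B

  pick : ℚ → Subset N → Subset N → ℚ
  pick q C B = if does (C ≟ˢ B) then q else 0ℚ

  seq-weightOf : ∀ w C L B n → seq (weightOf ((w , C) ∷ L) B) n ≡ pick (seq w n) C B ℚ.+ seq (weightOf L B) n
  seq-weightOf w C L B n with does (C ≟ˢ B)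
  ... | true  = refl
  ... | false = sym (ℚ.+-identityˡ _)

  pick-∉ : ∀ q C (f : Subset N → ℚ) Bs → All (C ≢_) Bs → sumℚ (λ B → pick q C B ℚ.* f B) Bs ≡ 0ℚ
  pick-∉ q C f []       []        = refl
  pick-∉ q C f (B ∷ Bs) (C≢ ∷ C∉) with C ≟ˢ B
  ... | yes C≡ = ⊥-elim (C≢ C≡)
  ... | no _   = trans (cong₂ ℚ._+_ (ℚ.*-zeroˡ (f B)) (pick-∉ q C f Bs C∉)) (ℚ.+-identityˡ 0ℚ)

  pick-∈ : ∀ q C (f : Subset N → ℚ) {Bs} → Unique Bs → C List.∈ Bs → sumℚ (λ B → pick q C B ℚ.* f B) Bs ≡ q ℚ.* f C
  pick-∈ q C f {B ∷ Bs} (B∉ ∷ unique) C∈ with C ≟ˢ B | C∈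
  ... | yes refl | _             = trans (cong (q ℚ.* f C ℚ.+_) (pick-∉ q C f Bs B∉)) (ℚ.+-identityʳ _)
  ... | no C≢    | Any.here C≡   = ⊥-elim (C≢ C≡)
  ... | no _     | Any.there C∈′ =
    trans (cong₂ ℚ._+_ (ℚ.*-zeroˡ (f B)) (pick-∈ q C f unique C∈′)) (ℚ.+-identityˡ _)

  -- Collecting the weights of repeated sets preserves totals: each entry of L is counted at exactly
  -- one place of Bs, which contains it and has no repetitions.
  sum-weightOf : ∀ φ {Bs} L → Unique Bs → Carried (List._∈ Bs) L → ∀ n →
                 sumℚ (λ B → seq (weightOf L B) n ℚ.* ι (φ B)) Bs ≡ total φ L n
  sum-weightOf φ {Bs} [] _ [] n = zeros Bs
    where
    zeros : ∀ Bs → sumℚ (λ B → 0ℚ ℚ.* ι (φ B)) Bs ≡ 0ℚ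
    zeros []       = refl
    zeros (B ∷ Bs) = trans (cong₂ ℚ._+_ (ℚ.*-zeroˡ (ι (φ B))) (zeros Bs)) (ℚ.+-identityˡ 0ℚ)
  sum-weightOf φ {Bs} ((w , C) ∷ L) unique (C∈ ∷ L∈) n = begin
    sumℚ (λ B → seq (weightOf ((w , C) ∷ L) B) n ℚ.* ι (φ B)) Bs
      ≡⟨ sumℚ-cong Bs (λ B → trans (cong (ℚ._* ι (φ B)) (seq-weightOf w C L B n)) (ℚ.*-distribʳ-+ (ι (φ B)) (pick (seq w n) C B) _)) ⟩
    sumℚ (λ B → pick (seq w n) C B ℚ.* ι (φ B) ℚ.+ seq (weightOf L B) n ℚ.* ι (φ B)) Bs
      ≡⟨ sumℚ-+ (λ B → pick (seq w n) C B ℚ.* ι (φ B)) (λ B → seq (weightOf L B) n ℚ.* ι (φ B)) Bs ⟩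
    sumℚ (λ B → pick (seq w n) C B ℚ.* ι (φ B)) Bs ℚ.+ sumℚ (λ B → seq (weightOf L B) n ℚ.* ι (φ B)) Bs
      ≡⟨ cong₂ ℚ._+_ (pick-∈ (seq w n) C (ι ∘ φ) unique C∈) (sum-weightOf φ L unique L∈ n) ⟩
    total φ ((w , C) ∷ L) n ∎
    where open ≡-Reasoning

  weightOf-nonneg : ∀ {L} → NonNeg L → ∀ B → seq 0ℝ ≼ seq (weightOf L B)
  weightOf-nonneg [] B = ≡⇒≼ λ _ → refl
  weightOf-nonneg (_∷_ {x = w , C} 0≤w 0≤L) B with does (C ≟ˢ B)
  ... | true  = ≼-trans (≡⇒≼ λ _ → sym (ℚ.+-identityˡ 0ℚ)) (+-mono-≼ 0≤w (weightOf-nonneg 0≤L B))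
  ... | false = weightOf-nonneg 0≤L B

  seq-vertex : ∀ {E : Subset N} B i (i∈E : i ∈ E) n → seq (vertex E B i i∈E) n ≡ ι ∣ ⁅ i ⁆ ∩ B ∣
  seq-vertex B i i∈E n with i ∈? B
  ... | yes i∈B = cong ι (sym (trans (counting 2 0 (λ i B → i ⊆ᶠ B ∷ [] ⊢ ∣ i ∩ᶠ B ∣ᵉ ≡ᵉ ∣ i ∣ᵉ)
                    ⁅ i ⁆ B (∈⇒⁅⁆⊆ i∈B)) (∣⁅x⁆∣≡1 i)))
  ... | no i∉B  = cong ι (sym (counting 2 0 (λ i B → i ⊆ᶠ ∁ᶠ B ∷ [] ⊢ ∣ i ∩ᶠ B ∣ᵉ ≡ᵉ lit 0)
                    ⁅ i ⁆ B (∉⇒⁅⁆⊆∁ i∉B)))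

subsets-unique : ∀ N → Unique (subsets N)
subsets-unique zero    = [] ∷ []
subsets-unique (suc N) = Unique.++⁺
  (Unique.map⁺ Vec.∷-injectiveʳ (subsets-unique N)) (Unique.map⁺ Vec.∷-injectiveʳ (subsets-unique N))
  λ (∈outside , ∈inside) →
    let _ , _ , eq = List.∈-map⁻ (outside ∷_) ∈outside
        _ , _ , eq′ = List.∈-map⁻ (inside ∷_) ∈inside
    in case Vec.∷-injectiveˡ (trans (sym eq) eq′) of λ ()

module _ {N : ℕ} {E : Subset N} (M : Matroid E) where

  private
    S = system M

    bases-unique : Unique (bases S)
    bases-unique = Unique.filter⁺ (Basis? S) (subsets-unique N)

  polytope⇒hull : ∀ {x} → basePolytope M x → InHull S x
  polytope⇒hull {x} (c , 0≤c , (mass≤ , mass≥) , coordinates) =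
    List.map (λ B → c B , B) (bases S) ,
    All.map⁺ (All.map (λ {B} b → ⟨ 0≤c {B} b ⟩) (All.all-filter (Basis? S) (subsets N))) ,
    All.map⁺ (All.all-filter (Basis? S) (subsets N)) ,
    ≈ₛ-trans (≡⇒≈ₛ λ n → trans (total-functional c (feature nothing) (bases S) n)
        (trans (sumℚ-cong (bases S) λ B → trans (cong (seq (c B) n ℚ.*_) (ℚ.+-identityʳ 1ℚ)) (ℚ.*-identityʳ (seq (c B) n)))
          (sym (seq-sumℝ c (bases S) n))))
      (⟨ mass≤ ⟩ , ⟨ mass≥ ⟩) ,
    λ i i∈E → ≈ₛ-trans (⟨ proj₁ (coordinates i i∈E) ⟩ , ⟨ proj₂ (coordinates i i∈E) ⟩)
      (≡⇒≈ₛ λ n → trans (seq-sumℝ (λ B → c B *ℝ vertex E B i i∈E) (bases S) n)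
        (trans (sumℚ-cong (bases S) (λ B → cong (seq (c B) n ℚ.*_) (seq-vertex B i i∈E n)))
          (sym (total-functional c (feature (just ⁅ i ⁆)) (bases S) n))))

  hull⇒polytope : ∀ {x} → InHull S x → basePolytope M x
  hull⇒polytope {x} (L , 0≤L , bs , mass , coordinates) =
    weightOf L , (λ {B} _ → bound-within (weightOf-nonneg 0≤L B)) ,
    (bound-within (proj₁ mass′) , bound-within (proj₂ mass′)) ,
    λ i i∈E → bound-within (proj₁ (coordinate i i∈E)) , bound-within (proj₂ (coordinate i i∈E))
    where
    L∈ : Carried (List._∈ bases S) L
    L∈ = All.map (λ {(_ , B)} b → List.∈-filter⁺ (Basis? S) (∈-subsets B) b) bs
    mass′ : seq (sumℝ (List.map (weightOf L) (bases S))) ≈ₛ seq 1ℝ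
    mass′ = ≈ₛ-trans (≡⇒≈ₛ λ n → trans (seq-sumℝ (weightOf L) (bases S) n)
      (trans (sumℚ-cong (bases S) λ B → sym (trans (cong (seq (weightOf L B) n ℚ.*_) (ℚ.+-identityʳ 1ℚ)) (ℚ.*-identityʳ (seq (weightOf L B) n))))
        (sum-weightOf (feature nothing) L bases-unique L∈ n))) mass
    coordinate : ∀ i i∈E → seq (x i i∈E) ≈ₛ seq (sumℝ (List.map (λ B → weightOf L B *ℝ vertex E B i i∈E) (bases S)))
    coordinate i i∈E = ≈ₛ-trans (coordinates i i∈E)
      (≡⇒≈ₛ λ n → sym (trans (seq-sumℝ (λ B → weightOf L B *ℝ vertex E B i i∈E) (bases S) n)
        (trans (sumℚ-cong (bases S) (λ B → cong (seq (weightOf L B) n ℚ.*_) (seq-vertex B i i∈E n)))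
          (sum-weightOf (feature (just ⁅ i ⁆)) L bases-unique L∈ n))))

hull-mono : ∀ {N} {E : Subset N} {S S′ : SetSystem E} → (∀ {B} → Basis S B → Basis S′ B) → ∀ {x} → InHull S x → InHull S′ x
hull-mono S⊆S′ (L , 0≤L , bs , mass , coordinates) = L , 0≤L , All.map S⊆S′ bs , mass , coordinates

-- Points of a polytope are compared coordinate by coordinate; removing one point of Z at a time
-- carries the comparison to coordinate sums.
total-mono-⊆ : ∀ {N} {L L′ : Weighted N} Z → (∀ i → i ∈ Z → total (feature (just ⁅ i ⁆)) L ≼ total (feature (just ⁅ i ⁆)) L′) →
               total (feature (just Z)) L ≼ total (feature (just Z)) L′
total-mono-⊆ {N} {L} {L′} Z = go ∣ Z ∣ Z ℕ.≤-refl
  where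
  go : ∀ fuel Z → ∣ Z ∣ ≤ fuel → (∀ i → i ∈ Z → total (feature (just ⁅ i ⁆)) L ≼ total (feature (just ⁅ i ⁆)) L′) →
       total (feature (just Z)) L ≼ total (feature (just Z)) L′
  go fuel Z ≤fuel pointwise with nonempty? Z
  go fuel Z ≤fuel pointwise | no e = ≡⇒≼ λ n → trans (vanishes L n) (sym (vanishes L′ n))
    where
    vanishes : ∀ L n → total (feature (just Z)) L n ≡ 0ℚ
    vanishes L n = trans (total-cong (All.universal (λ (_ , B) → counting 2 0 (λ Z B → ∣ Z ∣ᵉ ≡ᵉ lit 0 ∷ [] ⊢ ∣ Z ∩ᶠ B ∣ᵉ ≡ᵉ lit 0) Z B
        (trans (cong ∣_∣ (Empty-unique e)) (∣⊥∣≡0 N))) L) n)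
      (trans (total-const 0 L n) (ℚ.*-zeroˡ (total (λ _ → 1) L n)))
  go zero Z ≤0 pointwise | yes ne = ⊥-elim (ℕ.<⇒≱ (Nonempty⇒0<∣p∣ {p = Z} ne) ≤0)
  go (suc fuel) Z ≤fuel pointwise | yes (i , i∈Z) =
    ≼-trans (≡⇒≼ (split L)) (≼-trans
      (+-mono-≼ (pointwise i i∈Z) (go fuel (Z - i) (ℕ.≤-pred (subst (_≤ suc fuel) (sym (∣p-x∣ {B = Z} i∈Z)) ≤fuel))
        (λ l l∈ → pointwise l (p─q⊆p Z ⁅ i ⁆ l∈))))
      (≡⇒≼ (sym ∘ split L′)))
    where
    split : ∀ L n → total (feature (just Z)) L n ≡ total (feature (just ⁅ i ⁆)) L n ℚ.+ total (feature (just (Z - i))) L n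
    split L n = trans (total-cong (All.universal (λ (_ , B) → counting 3 0 (λ Z i B → i ⊆ᶠ Z ∷ [] ⊢ ∣ Z ∩ᶠ B ∣ᵉ ≡ᵉ ∣ i ∩ᶠ B ∣ᵉ +ᵉ ∣ (Z ─ᶠ i) ∩ᶠ B ∣ᵉ) Z ⁅ i ⁆ B (∈⇒⁅⁆⊆ i∈Z)) L) n)
      (total-+ (feature (just ⁅ i ⁆)) (feature (just (Z - i))) L n)

-- δ has values in ℕ, so its vanishing is decidable even though that of a weight is not. Where δ is
-- positive, w is at most w times δ, which is at most the total because all terms are nonnegative.
total≼0⇒weight≼0 : ∀ {N} (δ : Subset N → ℕ) {L} → NonNeg L → total δ L ≼ seq 0ℝ →
                   All (λ (w , B) → δ B ≡ 0 ⊎ seq w ≼ seq 0ℝ) L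
total≼0⇒weight≼0 δ [] _ = []
total≼0⇒weight≼0 δ (_∷_ {x = w , B} {xs = L} 0≤w 0≤L) ≼0 = first (δ B) refl ∷ total≼0⇒weight≼0 δ 0≤L
  (≼-trans (≡⇒≼ λ n → sym (ℚ.+-identityˡ (total δ L n)))
    (≼-trans (+-mono-≼ (0≼term w (δ B) 0≤w) (≡⇒≼ {total δ L} λ _ → refl)) ≼0))
  where
  term≼ : (λ n → seq w n ℚ.* ι (δ B)) ≼ seq 0ℝ
  term≼ = ≼-trans (≡⇒≼ λ n → sym (ℚ.+-identityʳ (seq w n ℚ.* ι (δ B))))
    (≼-trans (+-mono-≼ (≡⇒≼ {λ n → seq w n ℚ.* ι (δ B)} λ _ → refl) (0≼total δ 0≤L)) ≼0)
  first : ∀ m → δ B ≡ m → δ B ≡ 0 ⊎ seq w ≼ seq 0ℝ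
  first zero    eq = inj₁ eq
  first (suc m) eq = inj₂ (≼-trans (≡⇒≼ λ n → trans (sym (ℚ.+-identityʳ (seq w n))) (cong (seq w n ℚ.+_) (sym (ℚ.*-zeroʳ (ι m)))))
    (≼-trans (+-mono-≼ (≡⇒≼ {seq w} λ _ → refl) (scale-≼ (ι m) (0≤ι m) 0≤w))
      (≼-trans (≡⇒≼ λ n → trans (distrib (seq w n) (ι m)) (cong (λ k → seq w n ℚ.* ι k) (sym eq))) term≼)))
    where
    open ℚ-Solver
    distrib : ∀ w m → w ℚ.+ m ℚ.* w ≡ w ℚ.* (1ℚ ℚ.+ m)
    distrib = solve 2 (λ w m → w :+ m :* w := w :* (con 1ℚ :+ m)) refl

-- A weight that is nonnegative and at most 0 need not be represented by the zero sequence, so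
-- dropping its entry preserves totals as real numbers and not index by index.
keep : ∀ {N} {Q : Subset N → Set} {L : Weighted N} → NonNeg L → All (λ (w , B) → Q B ⊎ seq w ≼ seq 0ℝ) L →
       ∃ λ L′ → NonNeg L′ × Carried Q L′ × (∀ φ → total φ L′ ≈ₛ total φ L)
keep [] [] = [] , [] , [] , λ φ → ≡⇒≈ₛ λ _ → refl
keep (_∷_ {x = w , B} 0≤w 0≤L) (inj₁ q ∷ qs) =
  let L′ , 0≤L′ , qs′ , eq = keep 0≤L qs
  in (w , B) ∷ L′ , 0≤w ∷ 0≤L′ , q ∷ qs′ , λ φ →
     +-mono-≼ (≡⇒≼ {λ n → seq w n ℚ.* ι (φ B)} λ _ → refl) (proj₁ (eq φ)) ,
     +-mono-≼ (≡⇒≼ {λ n → seq w n ℚ.* ι (φ B)} λ _ → refl) (proj₂ (eq φ))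
keep (_∷_ {x = w , B} {xs = L} 0≤w 0≤L) (inj₂ w≼0 ∷ qs) =
  let L′ , 0≤L′ , qs′ , eq = keep 0≤L qs
  in L′ , 0≤L′ , qs′ , λ φ →
     ≼-trans (≡⇒≼ λ n → sym (ℚ.+-identityˡ (total φ L′ n))) (+-mono-≼ (0≼term w (φ B) 0≤w) (proj₁ (eq φ))) ,
     ≼-trans (+-mono-≼ (term≼0 w (φ B) w≼0) (proj₂ (eq φ))) (≡⇒≼ λ n → ℚ.+-identityˡ (total φ L′ n))

-- The two sides of the hyperplane x(A) = r.

module _ {N : ℕ} {E : Subset N} {S : SetSystem E} {k : ℕ} {A : Subset N} {r : ℕ}
         (matroid : IsMatroid S) (rel : Relaxable S k A r) where

  private
    X = exactly E k A r

    enlarge-X⇒AtLeast : ∀ {B} → Basis (enlarge X k A r) B → r ≤ ∣ B ∩ A ∣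
    enlarge-X⇒AtLeast (inj₁ (_ , _ , ∣B∩A∣)) = ℕ.≤-reflexive (sym ∣B∩A∣)
    enlarge-X⇒AtLeast (inj₂ (_ , _ , r<))    = ℕ.<⇒≤ r<

  hull-enlarge : ∀ {x} → InHull (enlarge S k A r) x → ¬ ¬ (InHull S x ⊎ InHull (enlarge X k A r) x)
  hull-enlarge {x} (L , 0≤L , bs , mass , coordinates) continue =
    Relaxation.one-sided matroid rel 0≤L bs λ (L′ , 0≤L′ , carried , eq) →
      let mass′ = ≈ₛ-trans (≡⇒≈ₛ (eq nothing)) mass
          coordinates′ : ∀ i (i∈E : i ∈ E) → seq (x i i∈E) ≈ₛ total (feature (just ⁅ i ⁆)) L′
          coordinates′ i i∈E = ≈ₛ-trans (coordinates i i∈E) (≡⇒≈ₛ (sym ∘ eq (just ⁅ i ⁆)))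
      in continue ([ (λ cs → inj₂ (L′ , 0≤L′ ,
                       All.map (λ (C⊆E , ∣C∣ , r≤) → r≤⇒enlarge (exactly-relaxable rel) C⊆E ∣C∣ r≤) cs , mass′ , coordinates′))
                   , (λ bs → inj₁ (L′ , 0≤L′ , bs , mass′ , coordinates′)) ]′ carried)

  -- The first combination gives x(A) ≤ r, while every set in the second meets A in at least r
  -- elements. Their total excess over r is therefore at most 0, so sets with positive excess have
  -- null weight and the others are bases of X.
  hull-intersection : ∀ {x} → InHull S x → InHull (enlarge X k A r) x → InHull X x
  hull-intersection {x} (L , 0≤L , bs , mass , coordinates) (L′ , 0≤L′ , bs′ , mass′ , coordinates′) =
    let L″ , 0≤L″ , xs , eq = keep 0≤L′ (tight-or-null bs′ (total≼0⇒weight≼0 (λ B → ∣ A ∩ B ∣ ∸ r) 0≤L′ excess≼0))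
    in L″ , 0≤L″ , xs , ≈ₛ-trans (eq (feature nothing)) mass′ ,
       λ i i∈E → ≈ₛ-trans (coordinates′ i i∈E) (≈ₛ-sym (eq (feature (just ⁅ i ⁆))))
    where
    ∩-swap : ∀ B → ∣ A ∩ B ∣ ≡ ∣ B ∩ A ∣
    ∩-swap B = cong ∣_∣ (∩-comm A B)

    tight-or-null : ∀ {L : Weighted N} → Carried (Basis (enlarge X k A r)) L →
                    All (λ (w , B) → ∣ A ∩ B ∣ ∸ r ≡ 0 ⊎ seq w ≼ seq 0ℝ) L → All (λ (w , B) → Basis X B ⊎ seq w ≼ seq 0ℝ) L
    tight-or-null []                         []               = []
    tight-or-null (b ∷ bs)                   (inj₂ null ∷ ps) = inj₂ null ∷ tight-or-null bs ps
    tight-or-null (inj₁ xB ∷ bs)             (inj₁ _ ∷ ps)    = inj₁ xB ∷ tight-or-null bs ps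
    tight-or-null (_∷_ {x = w , B} (inj₂ (_ , _ , r<)) bs) (inj₁ eq ∷ ps) =
      ⊥-elim (ℕ.<⇒≱ r< (subst (_≤ r) (∩-swap B) (ℕ.m∸n≡0⇒m≤n eq)))

    L≼L′ : total (feature (just A)) L′ ≼ total (feature (just A)) L
    L≼L′ = total-mono-⊆ {L = L′} {L} A λ i i∈A →
      ≼-trans (proj₂ (coordinates′ i (A⊆E rel i∈A))) (proj₁ (coordinates i (A⊆E rel i∈A)))

    L≼r : total (feature (just A)) L ≼ (λ n → ι r ℚ.* total (feature nothing) L n)
    L≼r = ≼-trans (≡⇒≼ λ n → sym (ℚ.+-identityˡ (total (feature (just A)) L n)))
      (≼-trans (+-mono-≼ (0≼total (λ B → r ∸ ∣ A ∩ B ∣) 0≤L) (≡⇒≼ {total (feature (just A)) L} λ _ → refl))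
        (≡⇒≼ λ n → trans (sym (total-+ (λ B → r ∸ ∣ A ∩ B ∣) (feature (just A)) L n))
          (trans (total-cong (All.map (λ {(_ , B)} b → ℕ.m∸n+n≡m (subst (_≤ r) (sym (∩-swap B)) (bound rel b))) bs) n)
            (total-const r L n))))

    r≼r′ : (λ n → ι r ℚ.* total (feature nothing) L n) ≼ (λ n → ι r ℚ.* total (feature nothing) L′ n)
    r≼r′ = scale-≼ (ι r) (0≤ι r) (≼-trans (proj₁ mass) (proj₂ mass′))

    excess+r : ∀ n → total (λ B → ∣ A ∩ B ∣ ∸ r) L′ n ℚ.+ ι r ℚ.* total (feature nothing) L′ n ≡ total (feature (just A)) L′ n
    excess+r n = trans (cong (total (λ B → ∣ A ∩ B ∣ ∸ r) L′ n ℚ.+_) (sym (total-const r L′ n)))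
      (trans (sym (total-+ (λ B → ∣ A ∩ B ∣ ∸ r) (λ _ → r) L′ n))
        (total-cong (All.map (λ {(_ , B)} b → ℕ.m∸n+n≡m (subst (r ≤_) (sym (∩-swap B)) (enlarge-X⇒AtLeast b))) bs′) n))

    excess≼0 : total (λ B → ∣ A ∩ B ∣ ∸ r) L′ ≼ seq 0ℝ
    excess≼0 = ≼-trans
      (≡⇒≼ λ n → sym (trans (cong (ℚ._+ (ℚ.- rest n)) (sym (excess+r n))) (cancel (total (λ B → ∣ A ∩ B ∣ ∸ r) L′ n) (rest n))))
      (≼-trans (+-mono-≼ (≼-trans L≼L′ (≼-trans L≼r r≼r′)) (≡⇒≼ {λ n → ℚ.- rest n} λ _ → refl))
        (≡⇒≼ λ n → ℚ.+-inverseʳ (rest n)))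
      where
      rest : ℕ → ℚ
      rest n = ι r ℚ.* total (feature nothing) L′ n
      open ℚ-Solver
      cancel : ∀ a b → a ℚ.+ b ℚ.+ (ℚ.- b) ≡ a
      cancel = solve 2 (λ a b → a :+ b :+ (:- b) := a) refl

-- Isomorphisms between set systems described by cardinalities.

Elements : ∀ {N} → Subset N → Set
Elements p = ∃ λ i → i ∈ p

∈-irrelevant : ∀ {N} {p : Subset N} {i} (m m′ : i ∈ p) → m ≡ m′
∈-irrelevant here      here       = refl
∈-irrelevant (there m) (there m′) = cong there (∈-irrelevant m m′)

Elements-≡ : ∀ {N} {p : Subset N} {e e′ : Elements p} → proj₁ e ≡ proj₁ e′ → e ≡ e′
Elements-≡ {e = i , m} {.i , m′} refl = cong (i ,_) (∈-irrelevant m m′)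

enumerate : ∀ {N} (p : Subset N) → Elements p ↔ Fin ∣ p ∣
enumerate p = mk↔ₛ′ (to p) (from p) (to∘from p) (from∘to p)
  where
  to : ∀ {N} (p : Subset N) → Elements p → Fin ∣ p ∣
  to (inside  ∷ p) (zero  , here)    = zero
  to (inside  ∷ p) (suc i , there m) = suc (to p (i , m))
  to (outside ∷ p) (suc i , there m) = to p (i , m)
  from : ∀ {N} (p : Subset N) → Fin ∣ p ∣ → Elements p
  from (inside  ∷ p) zero    = zero , here
  from (inside  ∷ p) (suc j) = let i , m = from p j in suc i , there m
  from (outside ∷ p) j       = let i , m = from p j in suc i , there m
  to∘from : ∀ {N} (p : Subset N) j → to p (from p j) ≡ j
  to∘from (inside  ∷ p) zero    = refl
  to∘from (inside  ∷ p) (suc j) = cong suc (to∘from p j)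
  to∘from (outside ∷ p) j       = to∘from p j
  from∘to : ∀ {N} (p : Subset N) e → from p (to p e) ≡ e
  from∘to (inside  ∷ p) (zero  , here)    = refl
  from∘to (inside  ∷ p) (suc i , there m) = cong (λ (i , m) → suc i , there m) (from∘to p (i , m))
  from∘to (outside ∷ p) (suc i , there m) = cong (λ (i , m) → suc i , there m) (from∘to p (i , m))

module _ {N} {E A : Subset N} (A⊆E : A ⊆ E) where

  partition-to : Elements E → Elements A ⊎ Elements (E ─ A)
  partition-to (i , i∈E) with i ∈? A
  ... | yes i∈A = inj₁ (i , i∈A)
  ... | no i∉A  = inj₂ (i , x∈p∧x∉q⇒x∈p─q i∈E i∉A)

  partition-from : Elements A ⊎ Elements (E ─ A) → Elements E
  partition-from (inj₁ (i , i∈A)) = i , A⊆E i∈A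
  partition-from (inj₂ (i , i∈))  = i , p─q⊆p E A i∈

  partition-to-cases : ∀ e → (proj₁ e ∈ A × ∃ λ a → partition-to e ≡ inj₁ a) ⊎ (proj₁ e ∉ A × ∃ λ b → partition-to e ≡ inj₂ b)
  partition-to-cases (i , i∈E) with i ∈? A
  ... | yes i∈A = inj₁ (i∈A , _ , refl)
  ... | no i∉A  = inj₂ (i∉A , _ , refl)

  partition : Elements E ↔ (Elements A ⊎ Elements (E ─ A))
  partition = mk↔ₛ′ partition-to partition-from to∘from from∘to
    where
    to∘from : ∀ e → partition-to (partition-from e) ≡ e
    to∘from (inj₁ (i , i∈A)) with i ∈? A
    ... | yes _  = cong inj₁ (Elements-≡ refl)
    ... | no i∉A = ⊥-elim (i∉A i∈A)
    to∘from (inj₂ (i , i∈)) with i ∈? A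
    ... | yes i∈A = ⊥-elim (proj₂ (x∈p─q⁻ E A i∈) i∈A)
    ... | no _    = cong inj₂ (Elements-≡ refl)
    from∘to : ∀ e → partition-from (partition-to e) ≡ e
    from∘to (i , i∈E) with i ∈? A
    ... | yes _ = Elements-≡ refl
    ... | no _  = Elements-≡ refl

same-size : ∀ {N N′} {p : Subset N} {q : Subset N′} → ∣ p ∣ ≡ ∣ q ∣ → Elements p ↔ Elements q
same-size {p = p} {q} eq = ↔-trans (enumerate p) (↔-sym (subst (λ m → Elements q ↔ Fin m) (sym eq) (enumerate q)))

module _ {N N′} {E A : Subset N} {E′ A′ : Subset N′} (A⊆E : A ⊆ E) (A′⊆E′ : A′ ⊆ E′)
         (∣A∣≡ : ∣ A ∣ ≡ ∣ A′ ∣) (∣E∣≡ : ∣ E ∣ ≡ ∣ E′ ∣) where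

  private
    ∣E─A∣≡ : ∣ E ─ A ∣ ≡ ∣ E′ ─ A′ ∣
    ∣E─A∣≡ = ℕ.+-cancelˡ-≡ ∣ A ∣ _ _ (trans (sym (whole E A A⊆E)) (trans ∣E∣≡ (trans (whole E′ A′ A′⊆E′) (cong (_+ ∣ E′ ─ A′ ∣) (sym ∣A∣≡)))))
      where
      whole : ∀ {N} (E A : Subset N) → A ⊆ E → ∣ E ∣ ≡ ∣ A ∣ + ∣ E ─ A ∣
      whole E A = counting 2 0 (λ E A → A ⊆ᶠ E ∷ [] ⊢ ∣ E ∣ᵉ ≡ᵉ ∣ A ∣ᵉ +ᵉ ∣ E ─ᶠ A ∣ᵉ) E A

    inner : (Elements A ⊎ Elements (E ─ A)) ↔ (Elements A′ ⊎ Elements (E′ ─ A′))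
    inner = same-size {p = A} {A′} ∣A∣≡ ⊎-↔ same-size {p = E ─ A} {E′ ─ A′} ∣E─A∣≡

  -- Glued from a bijection of A with A′ and one of their complements, so that sizes of sets and of
  -- their intersections with A are both preserved.
  matching : Elements E ↔ Elements E′
  matching = ↔-trans (partition A⊆E) (↔-trans inner (↔-sym (partition A′⊆E′)))

  matching-∈ : ∀ e → proj₁ e ∈ A ⇔ proj₁ (Inverse.to matching e) ∈ A′
  matching-∈ e = [ in-A , outside-A ]′ (partition-to-cases A⊆E e)
    where
    InA′ : Elements A ⊎ Elements (E ─ A) → Set
    InA′ s = proj₁ (partition-from A′⊆E′ (Inverse.to inner s)) ∈ A′
    in-A : (proj₁ e ∈ A × ∃ λ a → partition-to A⊆E e ≡ inj₁ a) → proj₁ e ∈ A ⇔ InA′ (partition-to A⊆E e)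
    in-A (i∈A , a , eq) = mk⇔ (λ _ → subst InA′ (sym eq) (proj₂ (Inverse.to (same-size {p = A} {A′} ∣A∣≡) a))) (λ _ → i∈A)
    outside-A : (proj₁ e ∉ A × ∃ λ b → partition-to A⊆E e ≡ inj₂ b) → proj₁ e ∈ A ⇔ InA′ (partition-to A⊆E e)
    outside-A (i∉A , b , eq) = mk⇔ (λ i∈A → ⊥-elim (i∉A i∈A)) (λ j∈A′ → ⊥-elim
      (proj₂ (x∈p─q⁻ E′ A′ (proj₂ (Inverse.to (same-size {p = E ─ A} {E′ ─ A′} ∣E─A∣≡) b))) (subst InA′ eq j∈A′)))

  private
    Corresponds : Subset N → Subset N′ → Set
    Corresponds B B′ = ∀ e → proj₁ e ∈ B ⇔ proj₁ (Inverse.to matching e) ∈ B′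

    ∣B∣≤ : ∀ {B B′} → B ⊆ E → B′ ⊆ E′ → Corresponds B B′ → ∣ B ∣ ≤ ∣ B′ ∣
    ∣B∣≤ {B} {B′} B⊆E B′⊆E′ corr = Fin.injective⇒≤ {f = Inverse.to (enumerate B′) ∘ g ∘ Inverse.from (enumerate B)}
      λ eq → injective-from (g-injective (injective-to eq))
      where
      g : Elements B → Elements B′
      g (i , m) = _ , Equivalence.to (corr (i , B⊆E m)) m
      g-injective : ∀ {e e′} → g e ≡ g e′ → e ≡ e′
      g-injective {i , m} {i′ , m′} eq = Elements-≡ (cong proj₁
        (trans (sym (Inverse.strictlyInverseʳ matching (i , B⊆E m)))
          (trans (cong (Inverse.from matching) (Elements-≡ (cong proj₁ eq))) (Inverse.strictlyInverseʳ matching (i′ , B⊆E m′)))))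
      injective-to : ∀ {e e′} → Inverse.to (enumerate B′) e ≡ Inverse.to (enumerate B′) e′ → e ≡ e′
      injective-to {e} {e′} eq = trans (sym (Inverse.strictlyInverseʳ (enumerate B′) e))
        (trans (cong (Inverse.from (enumerate B′)) eq) (Inverse.strictlyInverseʳ (enumerate B′) e′))
      injective-from : ∀ {j j′} → Inverse.from (enumerate B) j ≡ Inverse.from (enumerate B) j′ → j ≡ j′
      injective-from {j} {j′} eq = trans (sym (Inverse.strictlyInverseˡ (enumerate B) j))
        (trans (cong (Inverse.to (enumerate B)) eq) (Inverse.strictlyInverseˡ (enumerate B) j′))

    ∣B′∣≤ : ∀ {B B′} → B ⊆ E → B′ ⊆ E′ → Corresponds B B′ → ∣ B′ ∣ ≤ ∣ B ∣
    ∣B′∣≤ {B} {B′} B⊆E B′⊆E′ corr = Fin.injective⇒≤ {f = Inverse.to (enumerate B) ∘ g ∘ Inverse.from (enumerate B′)}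
      λ eq → injective-from (g-injective (injective-to eq))
      where
      back : ∀ e → proj₁ e ∈ B′ → proj₁ (Inverse.from matching e) ∈ B
      back e m = Equivalence.from (corr (Inverse.from matching e))
        (subst (λ e → proj₁ e ∈ B′) (sym (Inverse.strictlyInverseˡ matching e)) m)
      g : Elements B′ → Elements B
      g (i , m) = _ , back (i , B′⊆E′ m) m
      g-injective : ∀ {e e′} → g e ≡ g e′ → e ≡ e′
      g-injective {i , m} {i′ , m′} eq = Elements-≡ (cong proj₁
        (trans (sym (Inverse.strictlyInverseˡ matching (i , B′⊆E′ m)))
          (trans (cong (Inverse.to matching) (Elements-≡ (cong proj₁ eq))) (Inverse.strictlyInverseˡ matching (i′ , B′⊆E′ m′)))))
      injective-to : ∀ {e e′} → Inverse.to (enumerate B) e ≡ Inverse.to (enumerate B) e′ → e ≡ e′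
      injective-to {e} {e′} eq = trans (sym (Inverse.strictlyInverseʳ (enumerate B) e))
        (trans (cong (Inverse.from (enumerate B)) eq) (Inverse.strictlyInverseʳ (enumerate B) e′))
      injective-from : ∀ {j j′} → Inverse.from (enumerate B′) j ≡ Inverse.from (enumerate B′) j′ → j ≡ j′
      injective-from {j} {j′} eq = trans (sym (Inverse.strictlyInverseˡ (enumerate B′) j))
        (trans (cong (Inverse.to (enumerate B′)) eq) (Inverse.strictlyInverseˡ (enumerate B′) j′))

  -- Membership among the bases depends only on two sizes that `matching` preserves. One choice of Q
  -- each serves the uniform matroid, U ⊕ U and Λ.
  profile-≅ : ∀ {M : Matroid E} {M′ : Matroid E′} (Q : ℕ → ℕ → Set) →
              (∀ {B} → Basis (system M) B ⇔ (B ⊆ E × Q ∣ B ∣ ∣ B ∩ A ∣)) →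
              (∀ {B} → Basis (system M′) B ⇔ (B ⊆ E′ × Q ∣ B ∣ ∣ B ∩ A′ ∣)) → M ≅ M′
  profile-≅ {M} {M′} Q M⇔ M′⇔ = matching , λ {B} {B′} B⊆E B′⊆E′ corr →
    let corr∩ : Corresponds (B ∩ A) (B′ ∩ A′)
        corr∩ e = mk⇔
          (λ m → let b , a = x∈p∩q⁻ B A m in x∈p∩q⁺ (Equivalence.to (corr e) b , Equivalence.to (matching-∈ e) a))
          (λ m → let b , a = x∈p∩q⁻ B′ A′ m in x∈p∩q⁺ (Equivalence.from (corr e) b , Equivalence.from (matching-∈ e) a))
        ⊆E : B ∩ A ⊆ E
        ⊆E m = B⊆E (p∩q⊆p B A m)
        ⊆E′ : B′ ∩ A′ ⊆ E′
        ⊆E′ m = B′⊆E′ (p∩q⊆p B′ A′ m)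
        ∣B∣≡ = ℕ.≤-antisym (∣B∣≤ {B} {B′} B⊆E B′⊆E′ corr) (∣B′∣≤ {B} {B′} B⊆E B′⊆E′ corr)
        ∣B∩A∣≡ = ℕ.≤-antisym (∣B∣≤ {B ∩ A} {B′ ∩ A′} ⊆E ⊆E′ corr∩) (∣B′∣≤ {B ∩ A} {B′ ∩ A′} ⊆E ⊆E′ corr∩)
    in mk⇔ (λ b → Equivalence.from M′⇔ ((λ {_} → B′⊆E′) , subst₂ Q ∣B∣≡ ∣B∩A∣≡ (proj₂ (Equivalence.to M⇔ b))))
           (λ b → Equivalence.from M⇔ ((λ {_} → B⊆E) , subst₂ Q (sym ∣B∣≡) (sym ∣B∩A∣≡) (proj₂ (Equivalence.to M′⇔ b))))

-- Summation over the stressed subsets.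

length-filter-∷ : ∀ {a p} {A : Set a} {P : Pred A p} (P? : Decidable P) x xs →
                  length (filter P? (x ∷ xs)) ≡ (if does (P? x) then 1 else 0) + length (filter P? xs)
length-filter-∷ P? x xs with does (P? x)
... | true  = refl
... | false = refl

module Summation {c ℓ} (G : AbelianGroup c ℓ) where

  open Invariants G
  module 𝔾 = AbelianGroup G
  open 𝔾 using (Carrier; ε; _∙_; _⁻¹) public
  open CommutativeMonoidSum 𝔾.commutativeMonoid using (∑-distrib-+)
  open MonoidSum 𝔾.monoid using (sum-cong-≋)
  open MonoidMult 𝔾.monoid using (×-homo-+; ×-homo-1; ×-congˡ)

  sum-ε : ∀ {n} {g : Fin n → Carrier} → (∀ i → g i ≈ ε) → sum g ≈ ε
  sum-ε {zero}  _  = 𝔾.refl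
  sum-ε {suc n} eq = 𝔾.trans (𝔾.∙-cong (eq zero) (sum-ε (eq ∘ suc))) (𝔾.identityˡ ε)

  sum-pick : ∀ {n} {g : Fin n → Carrier} i → (∀ l → l ≢ i → g l ≈ ε) → sum g ≈ g i
  sum-pick {suc n} {g} zero    eq =
    𝔾.trans (𝔾.∙-congˡ (sum-ε λ l → eq (suc l) λ ())) (𝔾.identityʳ (g zero))
  sum-pick {suc n} {g} (suc i) eq =
    𝔾.trans (𝔾.∙-cong (eq zero λ ()) (sum-pick i λ l l≢ → eq (suc l) (l≢ ∘ Fin.suc-injective))) (𝔾.identityˡ (g (suc i)))

  sumᴸ : ∀ {N} → (Subset N → Carrier) → List (Subset N) → Carrier
  sumᴸ τ = List.foldr (λ A s → τ A ∙ s) ε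

  module _ {N m n : ℕ} (τ : ℕ → ℕ → Carrier) (ρ σ : Subset N → ℕ)
           {Q : Subset N → Set} (Q? : Decidable Q) (bounds : ∀ {A} → Q A → ρ A < m × σ A < n)
           {P : ℕ → ℕ → Subset N → Set} (P? : ∀ r h → Decidable (P r h))
           (P⇒ : ∀ {r h A} → P r h A → Q A × ρ A ≡ r × σ A ≡ h) (⇒P : ∀ {A} → Q A → P (ρ A) (σ A) A) where

    private
      δ : Subset N → ℕ → ℕ → ℕ
      δ A r h = if does (P? r h A) then 1 else 0

      δ-no : ∀ A r h → ¬ P r h A → δ A r h ×ᴳ τ r h ≈ ε
      δ-no A r h ¬p with P? r h A
      ... | yes p = ⊥-elim (¬p p)
      ... | no _  = 𝔾.refl

      δ-yes : ∀ A r h → P r h A → δ A r h ×ᴳ τ r h ≈ τ r h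
      δ-yes A r h p with P? r h A
      ... | yes _ = ×-homo-1 (τ r h)
      ... | no ¬p = ⊥-elim (¬p p)

      ∑∑ : (ℕ → ℕ → Carrier) → Carrier
      ∑∑ g = ∑[ r < m ] ∑[ h < n ] g (toℕ r) (toℕ h)

      ∑∑-ε : ∀ {g : ℕ → ℕ → Carrier} → (∀ r h → g r h ≈ ε) → ∑∑ g ≈ ε
      ∑∑-ε eq = sum-ε {m} λ r → sum-ε {n} λ h → eq (toℕ r) (toℕ h)

      ∑∑-pick : ∀ {A} → Q A → ∑∑ (λ r h → δ A r h ×ᴳ τ r h) ≈ τ (ρ A) (σ A)
      ∑∑-pick {A} q = 𝔾.trans
        (sum-pick {g = λ r → ∑[ h < n ] (δ A (toℕ r) (toℕ h) ×ᴳ τ (toℕ r) (toℕ h))} r₀ λ r r≢ → sum-ε {n} λ h → δ-no A (toℕ r) (toℕ h) λ p →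
          r≢ (Fin.toℕ-injective (trans (sym (proj₁ (proj₂ (P⇒ p)))) (sym r₀≡))))
        (𝔾.trans
          (sum-pick {g = λ h → δ A (toℕ r₀) (toℕ h) ×ᴳ τ (toℕ r₀) (toℕ h)} h₀ λ h h≢ → δ-no A (toℕ r₀) (toℕ h) λ p →
            h≢ (Fin.toℕ-injective (trans (sym (proj₂ (proj₂ (P⇒ p)))) (sym h₀≡))))
          (subst₂ (λ r h → δ A r h ×ᴳ τ r h ≈ τ (ρ A) (σ A)) (sym r₀≡) (sym h₀≡) (δ-yes A (ρ A) (σ A) (⇒P q))))
        where
        r₀ = fromℕ< (proj₁ (bounds q))
        h₀ = fromℕ< (proj₂ (bounds q))
        r₀≡ : toℕ r₀ ≡ ρ A
        r₀≡ = Fin.toℕ-fromℕ< (proj₁ (bounds q))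
        h₀≡ : toℕ h₀ ≡ σ A
        h₀≡ = Fin.toℕ-fromℕ< (proj₂ (bounds q))

      ∑∑-∷ : ∀ A As → ∑∑ (λ r h → length (filter (P? r h) (A ∷ As)) ×ᴳ τ r h) ≈
                      ∑∑ (λ r h → δ A r h ×ᴳ τ r h) ∙ ∑∑ (λ r h → length (filter (P? r h) As) ×ᴳ τ r h)
      ∑∑-∷ A As = 𝔾.trans
        (sum-cong-≋ {m} λ r → 𝔾.trans
          (sum-cong-≋ {n} λ h → 𝔾.trans (×-congˡ (length-filter-∷ (P? (toℕ r) (toℕ h)) A As))
            (×-homo-+ (τ (toℕ r) (toℕ h)) (δ A (toℕ r) (toℕ h)) (length (filter (P? (toℕ r) (toℕ h)) As))))
          (∑-distrib-+ {n} (λ h → δ A (toℕ r) (toℕ h) ×ᴳ τ (toℕ r) (toℕ h))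
                       (λ h → length (filter (P? (toℕ r) (toℕ h)) As) ×ᴳ τ (toℕ r) (toℕ h))))
        (∑-distrib-+ {m} (λ r → ∑[ h < n ] (δ A (toℕ r) (toℕ h) ×ᴳ τ (toℕ r) (toℕ h)))
                     (λ r → ∑[ h < n ] (length (filter (P? (toℕ r) (toℕ h)) As) ×ᴳ τ (toℕ r) (toℕ h))))

    -- Induction on the list: a further subset A with Q adds 1 to a single multiplicity, the one at
    -- (ρ A, σ A), and hence one copy of the corresponding term; any other subset adds nothing.
    sum-by-invariants : ∀ As → ∑[ r < m ] ∑[ h < n ] (length (filter (P? (toℕ r) (toℕ h)) As) ×ᴳ τ (toℕ r) (toℕ h)) ≈
                               sumᴸ (λ A → τ (ρ A) (σ A)) (filter Q? As)
    sum-by-invariants [] = ∑∑-ε λ _ _ → 𝔾.refl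
    sum-by-invariants (A ∷ As) with Q? A
    ... | yes q = 𝔾.trans (∑∑-∷ A As) (𝔾.∙-cong (∑∑-pick q) (sum-by-invariants As))
    ... | no ¬q = 𝔾.trans (∑∑-∷ A As) (𝔾.trans
      (𝔾.∙-cong (∑∑-ε λ r h → δ-no A r h λ p → ¬q (proj₁ (P⇒ p))) (sum-by-invariants As)) (𝔾.identityˡ _))

-- Relaxing one stressed subset, and all of them.

-- Signs of the relaxed matroid, of M, of Λ and of U ⊕ U, in the order of `relaxationMatroids`.
relaxationSigns : Fin 4 → ℤ
relaxationSigns zero                   = 1ℤ
relaxationSigns (suc zero)             = ℤ.-1ℤ
relaxationSigns (suc (suc zero))       = ℤ.-1ℤ
relaxationSigns (suc (suc (suc zero))) = 1ℤ

module _ {N : ℕ} {E : Subset N} {k : ℕ} {A : Subset N} {r : ℕ} where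

  enlarged : (M : Matroid E) → Relaxable (system M) k A r → Matroid E
  enlarged M rel = record { system = enlarge (system M) k A r ; isMatroid = enlarge-isMatroid rel (isMatroid M) }

  exactlyᴹ : {S : SetSystem E} → Relaxable S k A r → Matroid E
  exactlyᴹ rel = record { system = exactly E k A r ; isMatroid = exactly-isMatroid rel }

  atLeastᴹ : {S : SetSystem E} → Relaxable S k A r → Matroid E
  atLeastᴹ rel = enlarged (exactlyᴹ rel) (exactly-relaxable rel)

  relaxationMatroids : (M : Matroid E) → Relaxable (system M) k A r → Fin 4 → Matroid E
  relaxationMatroids M rel zero                   = enlarged M rel
  relaxationMatroids M rel (suc zero)             = M
  relaxationMatroids M rel (suc (suc zero))       = atLeastᴹ rel
  relaxationMatroids M rel (suc (suc (suc zero))) = exactlyᴹ rel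

  module _ (M : Matroid E) (rel : Relaxable (system M) k A r) {x : Point E} where

    private
      R = enlarged M rel
      L = atLeastᴹ rel
      X = exactlyᴹ rel

      via : ∀ {M M′ : Matroid E} → (∀ {B} → Basis (system M) B → Basis (system M′) B) → basePolytope M x → basePolytope M′ x
      via {M} {M′} M⊆M′ p =
        hull⇒polytope M′ {x} (hull-mono {S = system M} {S′ = system M′} M⊆M′ {x} (polytope⇒hull M {x} p))

      M⇒R : basePolytope M x → basePolytope R x
      M⇒R = via {M} {R} inj₁

      X⇒M : basePolytope X x → basePolytope M x
      X⇒M = via {X} {M} λ (B⊆E , ∣B∣ , ∣B∩A∣) → full rel B⊆E ∣B∣ ∣B∩A∣

      X⇒L : basePolytope X x → basePolytope L x
      X⇒L = via {X} {L} inj₁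

      L⇒R : basePolytope L x → basePolytope R x
      L⇒R = via {L} {R} λ { (inj₁ (B⊆E , ∣B∣ , ∣B∩A∣)) → inj₁ (full rel B⊆E ∣B∣ ∣B∩A∣) ; (inj₂ cover) → inj₂ cover }

      M∧L⇒X : basePolytope M x → basePolytope L x → basePolytope X x
      M∧L⇒X m l = hull⇒polytope X {x} (hull-intersection (isMatroid M) rel {x} (polytope⇒hull M {x} m) (polytope⇒hull L {x} l))

      R⇒M∨L : basePolytope R x → ¬ basePolytope M x → ¬ basePolytope L x → 𝟘
      R⇒M∨L p ¬m ¬l = hull-enlarge (isMatroid M) rel {x} (polytope⇒hull R {x} p)
        [ ¬m ∘ hull⇒polytope M {x} , ¬l ∘ hull⇒polytope L {x} ]′

    -- Inclusion and exclusion: P(X) is the intersection of P(M) and P(L), and P(R) is their union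
    -- up to double negation. The union is only used to refute the pattern of a point in P(R)
    -- outside both.
    indicators-cancel : (R? : Dec (basePolytope R x)) (M? : Dec (basePolytope M x))
                        (L? : Dec (basePolytope L x)) (X? : Dec (basePolytope X x)) →
                        1ℤ ℤ.* indicator R? ℤ.+ (ℤ.-1ℤ ℤ.* indicator M? ℤ.+
                          (ℤ.-1ℤ ℤ.* indicator L? ℤ.+ (1ℤ ℤ.* indicator X? ℤ.+ 0ℤ))) ≡ 0ℤ
    indicators-cancel (yes _) (yes _) (yes _) (yes _) = refl
    indicators-cancel (yes _) (yes m) (yes l) (no ¬x) = ⊥-elim (¬x (M∧L⇒X m l))
    indicators-cancel (yes _) (yes _) (no ¬l) (yes p) = ⊥-elim (¬l (X⇒L p))
    indicators-cancel (yes _) (yes _) (no _)  (no _)  = refl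
    indicators-cancel (yes _) (no ¬m) (yes _) (yes p) = ⊥-elim (¬m (X⇒M p))
    indicators-cancel (yes _) (no _)  (yes _) (no _)  = refl
    indicators-cancel (yes p) (no ¬m) (no ¬l) _       = ⊥-elim (R⇒M∨L p ¬m ¬l)
    indicators-cancel (no ¬r) (yes m) _       _       = ⊥-elim (¬r (M⇒R m))
    indicators-cancel (no ¬r) (no _)  (yes l) _       = ⊥-elim (¬r (L⇒R l))
    indicators-cancel (no _)  (no ¬m) (no _)  (yes p) = ⊥-elim (¬m (X⇒M p))
    indicators-cancel (no _)  (no _)  (no _)  (no _)  = refl

  relaxation-relation : (M : Matroid E) (rel : Relaxable (system M) k A r) → IndicatorRelation relaxationSigns (relaxationMatroids M rel)
  relaxation-relation M rel x x∈? =
    indicators-cancel M rel {x} (x∈? zero) (x∈? (suc zero)) (x∈? (suc (suc zero))) (x∈? (suc (suc (suc zero))))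

module _ {N : ℕ} {E : Subset N} {S : SetSystem E} {k : ℕ} {A : Subset N} {r : ℕ} (rel : Relaxable S k A r) where

  relaxable⇒admissible : Admissible r k ∣ A ∣ ∣ E ∣
  relaxable⇒admissible = ℕ.<⇒≤ (r<k rel) , p⊆q⇒∣p∣≤∣q∣ (A⊆E rel) , ℕ.<⇒≤ (r<∣A∣ rel) ,
    ℕ.m≤n+o⇒m∸n≤o k r (subst (λ s → k ≤ r + s) ∣E─A∣≡ (room rel))
    where
    ∣E─A∣≡ : ∣ E ─ A ∣ ≡ ∣ E ∣ ∸ ∣ A ∣
    ∣E─A∣≡ = sym (trans (cong (_∸ ∣ A ∣) (counting 2 0 (λ E A → A ⊆ᶠ E ∷ [] ⊢ ∣ E ∣ᵉ ≡ᵉ ∣ E ─ᶠ A ∣ᵉ +ᵉ ∣ A ∣ᵉ)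
      E A (A⊆E rel))) (ℕ.m+n∸n≡m ∣ E ─ A ∣ ∣ A ∣))

  module _ (adm : Admissible r k ∣ A ∣ ∣ E ∣) where

    private
      n = ∣ E ∣
      F = initial ∣ A ∣ n

      ∣F∣≡ : ∣ F ∣ ≡ ∣ A ∣
      ∣F∣≡ = ∣initial∣ (proj₁ (proj₂ adm))

      ∁F∪F≡⊤ : ∁ F ∪ F ≡ ⊤
      ∁F∪F≡⊤ = trans (∪-comm (∁ F) F) (p∪∁p≡⊤ F)

      k≡ : (k ∸ r) + r ≡ k
      k≡ = ℕ.m∸n+n≡m (proj₁ adm)

      ∣E∣≡ : ∣ E ∣ ≡ ∣ ∁ F ∪ F ∣
      ∣E∣≡ = sym (trans (cong ∣_∣ ∁F∪F≡⊤) (∣⊤∣≡n n))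

      ⊆∁F∪F : ∀ {B} → B ⊆ ∁ F ∪ F
      ⊆∁F∪F _ = subst (_ ∈_) (sym ∁F∪F≡⊤) ∈⊤

      r≤∣F∣ : r ≤ ∣ F ∣
      r≤∣F∣ = subst (r ≤_) (sym ∣F∣≡) (proj₁ (proj₂ (proj₂ adm)))

      k∸r≤ : k ∸ r ≤ ∣ ∁ F ∣
      k∸r≤ = subst (k ∸ r ≤_) (sym (trans (∣∁p∣≡n∸∣p∣ F) (cong (n ∸_) ∣F∣≡))) (proj₂ (proj₂ (proj₂ adm)))

      U⊕U⇒ : ∀ {B} → Basis (system (U⊕U r k ∣ A ∣ n adm)) B → ∣ B ∣ ≡ k × ∣ B ∩ F ∣ ≡ r
      U⊕U⇒ (B₁ , B₂ , (B₁⊆ , ∣B₁∣) , (B₂⊆ , ∣B₂∣) , refl) =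
        counting 3 3 (λ B₁ B₂ F a r k → B₁ ⊆ᶠ ∁ᶠ F ∷ B₂ ⊆ᶠ F ∷ ∣ B₁ ∣ᵉ ≡ᵉ a ∷ ∣ B₂ ∣ᵉ ≡ᵉ r ∷ a +ᵉ r ≡ᵉ k ∷ [] ⊢
            ∣ B₁ ∪ᶠ B₂ ∣ᵉ ≡ᵉ k) B₁ B₂ F (k ∸ r) r k B₁⊆ B₂⊆ ∣B₁∣ ∣B₂∣ k≡ ,
        counting 3 1 (λ B₁ B₂ F r → B₁ ⊆ᶠ ∁ᶠ F ∷ B₂ ⊆ᶠ F ∷ ∣ B₂ ∣ᵉ ≡ᵉ r ∷ [] ⊢ ∣ (B₁ ∪ᶠ B₂) ∩ᶠ F ∣ᵉ ≡ᵉ r)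
          B₁ B₂ F r B₁⊆ B₂⊆ ∣B₂∣

      ⇒U⊕U : ∀ {B} → ∣ B ∣ ≡ k → ∣ B ∩ F ∣ ≡ r → Basis (system (U⊕U r k ∣ A ∣ n adm)) B
      ⇒U⊕U {B} ∣B∣ ∣B∩F∣ = B ∩ ∁ F , B ∩ F ,
        (p∩q⊆q B (∁ F) ,
         counting 2 3 (λ B F a r k → ∣ B ∣ᵉ ≡ᵉ k ∷ ∣ B ∩ᶠ F ∣ᵉ ≡ᵉ r ∷ a +ᵉ r ≡ᵉ k ∷ [] ⊢ ∣ B ∩ᶠ ∁ᶠ F ∣ᵉ ≡ᵉ a)
           B F (k ∸ r) r k ∣B∣ ∣B∩F∣ k≡) ,
        (p∩q⊆q B F , ∣B∩F∣) ,
        counting 2 0 (λ B F → [] ⊢ B ≡ᶠ (B ∩ᶠ ∁ᶠ F) ∪ᶠ (B ∩ᶠ F)) B F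

    exactly≅U⊕U : exactlyᴹ rel ≅ U⊕U r k ∣ A ∣ ∣ E ∣ adm
    exactly≅U⊕U = profile-≅ {A = A} {A′ = F} (A⊆E rel) (⊆∁F∪F {F}) (sym ∣F∣≡) ∣E∣≡
      {M = exactlyᴹ rel} {M′ = U⊕U r k ∣ A ∣ ∣ E ∣ adm} (λ b a → b ≡ k × a ≡ r) (mk⇔ id id)
      (λ {B} → mk⇔ (λ b → (λ {_} → ⊆∁F∪F {B}) , U⊕U⇒ b) (λ (_ , ∣B∣ , ∣B∩F∣) → ⇒U⊕U ∣B∣ ∣B∩F∣))

    atLeast≅Λ : atLeastᴹ rel ≅ Λ r k ∣ A ∣ ∣ E ∣ adm
    atLeast≅Λ = profile-≅ {A = A} {A′ = F} (A⊆E rel) (⊆∁F∪F {F}) (sym ∣F∣≡) ∣E∣≡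
      {M = atLeastᴹ rel} {M′ = Λ r k ∣ A ∣ ∣ E ∣ adm} (λ b a → b ≡ k × r ≤ a)
      (λ {B} → mk⇔ (λ { (inj₁ (B⊆E , ∣B∣ , ∣B∩A∣)) → B⊆E , ∣B∣ , ℕ.≤-reflexive (sym ∣B∩A∣)
                      ; (inj₂ (B⊆E , ∣B∣ , r<))    → B⊆E , ∣B∣ , ℕ.<⇒≤ r< })
                   (λ (B⊆E , ∣B∣ , r≤) → r≤⇒enlarge (exactly-relaxable rel) {B} B⊆E ∣B∣ r≤))
      (λ {B} → mk⇔ (λ b → let ∣B∣ , r≤ = relax⇒ F k∸r≤ r≤∣F∣ {B} b in (λ {_} → ⊆∁F∪F {B}) , trans ∣B∣ k≡ , r≤)
                   (λ (_ , ∣B∣ , r≤) → relax⇐ F k∸r≤ r≤∣F∣ {B} (trans ∣B∣ (sym k≡)) r≤))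

module _ {c ℓ} (G : AbelianGroup c ℓ) where

  open Invariants G
  open Summation G
  private module GP = AbelianGroupProperties G

  -- The valuation identity solved for M; the scattered ε are left by the multiples `1ℤ ·` and
  -- `ℤ.-1ℤ ·` and by the sum over `Fin 4`.
  difference : ∀ R M L X → 1ℤ · R ∙ (ℤ.-1ℤ · M ∙ (ℤ.-1ℤ · L ∙ (1ℤ · X ∙ ε))) ≈ ε → M ≈ R -ᴳ (L -ᴳ X)
  difference R M L X eq = 𝔾.sym (GP.x∙y⁻¹≈ε⇒x≈y _ M (𝔾.trans
    (𝔾.∙-congʳ (𝔾.∙-congˡ (GP.⁻¹-anti-homo‿- L X)))
    (𝔾.trans (rearrange R (M ⁻¹) (L ⁻¹) X)
      (𝔾.trans (𝔾.∙-congˡ (𝔾.∙-cong (unit M) (𝔾.∙-congʳ (unit L)))) eq))))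
    where
    unit : ∀ Y → Y ⁻¹ ≈ (Y ∙ ε) ⁻¹
    unit Y = 𝔾.⁻¹-cong (𝔾.sym (𝔾.identityʳ Y))
    open CommutativeMonoidSolver 𝔾.commutativeMonoid using (solve; _⊜_) renaming (_⊕_ to _⊛_; id to 𝟏)
    rearrange : ∀ r m l x → (r ∙ (x ∙ l)) ∙ m ≈ (r ∙ ε) ∙ (m ∙ (l ∙ ((x ∙ ε) ∙ ε)))
    rearrange = solve 4 (λ r m l x → ((r ⊛ (x ⊛ l)) ⊛ m) ⊜ ((r ⊛ 𝟏) ⊛ (m ⊛ (l ⊛ ((x ⊛ 𝟏) ⊛ 𝟏))))) 𝔾.refl

  -- k and ρ are to be the rank and rank function of the initial matroid; they remain the reference
  -- for every later matroid in the chain.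
  module Relaxing (f : MatroidMap) (valuation : IsValuation f) (invariant : IsInvariant f)
                  {N : ℕ} {E : Subset N} (k : ℕ) (ρ : Subset N → ℕ) where

    τ : Subset N → Carrier
    τ A = relaxationTerm f (ρ A) k ∣ A ∣ ∣ E ∣

    relaxationTerm-≈ : ∀ {S : SetSystem E} {A} (rel : Relaxable S k A (ρ A)) → f (atLeastᴹ rel) -ᴳ f (exactlyᴹ rel) ≈ τ A
    relaxationTerm-≈ {A = A} rel with admissible? (ρ A) k ∣ A ∣ ∣ E ∣
    ... | yes adm = 𝔾.∙-cong (invariant _ _ (atLeast≅Λ rel adm)) (𝔾.⁻¹-cong (invariant _ _ (exactly≅U⊕U rel adm)))
    ... | no ¬adm = ⊥-elim (¬adm (relaxable⇒admissible rel))

    relaxation-step : ∀ (M : Matroid E) {A} (rel : Relaxable (system M) k A (ρ A)) → f M ≈ f (enlarged M rel) -ᴳ τ A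
    relaxation-step M rel = 𝔾.trans
      (difference (f (enlarged M rel)) (f M) (f (atLeastᴹ rel)) (f (exactlyᴹ rel))
        (valuation relaxationSigns (relaxationMatroids M rel) (relaxation-relation M rel)))
      (𝔾.∙-congˡ (𝔾.⁻¹-cong (relaxationTerm-≈ rel)))

    CoveredBy : List (Subset N) → Subset N → Set
    CoveredBy As B = B ⊆ E × ∣ B ∣ ≡ k × Any (λ A → ρ A < ∣ B ∩ A ∣) As

    -- Each relaxation contributes one term and, by `enlarge-relaxable`, leaves the remaining
    -- subsets relaxable with unchanged numbers. Distinctness of the subsets is what that lemma asks
    -- for.
    relax-all : ∀ (M : Matroid E) As → Unique As → All (λ A → Relaxable (system M) k A (ρ A)) As →
                ∃ λ (M′ : Matroid E) → (∀ {B} → Basis (system M′) B ⇔ (Basis (system M) B ⊎ CoveredBy As B)) ×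
                                        f M ≈ f M′ -ᴳ sumᴸ τ As
    relax-all M [] [] [] = M , mk⇔ inj₁ [ id , (λ { (_ , _ , ()) }) ]′ ,
      𝔾.sym (𝔾.trans (𝔾.∙-congˡ GP.ε⁻¹≈ε) (𝔾.identityʳ (f M)))
    relax-all M (A ∷ As) (A∉ ∷ unique) (rel ∷ rels) =
      let M′ , M′⇔ , eq = relax-all (enlarged M rel) As unique
                            (All.zipWith (λ (A≢A′ , rel′) → enlarge-relaxable rel A≢A′ rel′) (A∉ , rels))
      in M′ ,
         (λ {B} → mk⇔ (split ∘ Equivalence.to (M′⇔ {B})) (Equivalence.from (M′⇔ {B}) ∘ join)) ,
         𝔾.trans (relaxation-step M rel) (𝔾.trans (𝔾.∙-congʳ eq)
           (𝔾.trans (𝔾.assoc (f M′) _ _) (𝔾.∙-congˡ (𝔾.trans (GP.⁻¹-∙-comm (sumᴸ τ As) (τ A)) (𝔾.⁻¹-cong (𝔾.comm (sumᴸ τ As) (τ A)))))))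
      where
      split : ∀ {B} → Basis (enlarge (system M) k A (ρ A)) B ⊎ CoveredBy As B → Basis (system M) B ⊎ CoveredBy (A ∷ As) B
      split (inj₁ (inj₁ b))                  = inj₁ b
      split (inj₁ (inj₂ (B⊆E , ∣B∣ , ρ<)))   = inj₂ (B⊆E , ∣B∣ , Any.here ρ<)
      split (inj₂ (B⊆E , ∣B∣ , any))         = inj₂ (B⊆E , ∣B∣ , Any.there any)
      join : ∀ {B} → Basis (system M) B ⊎ CoveredBy (A ∷ As) B → Basis (enlarge (system M) k A (ρ A)) B ⊎ CoveredBy As B
      join (inj₁ b)                          = inj₁ (inj₁ b)
      join (inj₂ (B⊆E , ∣B∣ , Any.here ρ<))  = inj₁ (inj₂ (B⊆E , ∣B∣ , ρ<))
      join (inj₂ (B⊆E , ∣B∣ , Any.there any)) = inj₂ (B⊆E , ∣B∣ , any)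

theorem1p4 : ∀ {c ℓ} (G : AbelianGroup c ℓ) → let open Invariants G in
             (f : MatroidMap) → IsValuation f → IsInvariant f →
             ∀ {N} {E : Subset N} (M : Matroid E) → ElementarySplit M →
             let k = rank (system M)
                 n = ∣ E ∣
             in f M ≈ f (U k n (rank≤∣E∣ (system M))) -ᴳ
                      (∑[ r < suc k ] ∑[ h < suc n ]
                        (stressedCount (system M) (toℕ r) (toℕ h) ×ᴳ relaxationTerm f (toℕ r) k (toℕ h) n))
theorem1p4 G f valuation invariant {N} {E} M split =
  let M′ , M′⇔ , fM≈ = relax-all M As (Unique.filter⁺ Q? (subsets-unique N)) relaxables
  in 𝔾.trans fM≈ (𝔾.∙-cong (invariant M′ (U k n (rank≤∣E∣ S)) (M′≅U M′ M′⇔)) (𝔾.⁻¹-cong (𝔾.sym sum≈)))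
  where
  open Invariants G
  open Summation G
  S = system M
  k = rank S
  n = ∣ E ∣
  open Relaxing G f valuation invariant {E = E} k (rk S)

  Q? : Decidable (λ A → Stressed S A × ∃ (Cover S A))
  Q? A = stressed? S A ×-dec anySubset? (cover? S A)

  As : List (Subset N)
  As = filter Q? (subsets N)

  relaxables : All (λ A → Relaxable S k A (rk S A)) As
  relaxables = All.map (λ (stressed , cover) → stressed⇒relaxable (isMatroid M) stressed cover) (All.all-filter Q? (subsets N))

  -- The only place where the elementary split hypothesis enters: it guarantees that no k-subset is
  -- missed by the covers.
  basis-or-covered : ∀ {B} → Dec (Basis S B) → B ⊆ E × ∣ B ∣ ≡ k → Basis S B ⊎ CoveredBy As B
  basis-or-covered     (yes b) _           = inj₁ b
  basis-or-covered {B} (no ¬b) (B⊆E , ∣B∣) =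
    let A , stressed , cover@(_ , _ , rk<) = nonbasis-covered M split {B} B⊆E ∣B∣ ¬b
    in inj₂ ((λ {_} → B⊆E) , ∣B∣ ,
         List.lose (List.∈-filter⁺ Q? (∈-subsets A) (stressed , B , cover)) (subst (_≤ ∣ B ∩ A ∣) (ℕ.+-comm (rk S A) 1) rk<))

  M′≅U : ∀ M′ → (∀ {B} → Basis (system M′) B ⇔ (Basis S B ⊎ CoveredBy As B)) → M′ ≅ U k n (rank≤∣E∣ S)
  M′≅U M′ M′⇔ = profile-≅ {A = E} {A′ = ⊤} (λ {_} x∈ → x∈) (λ {_} x∈ → x∈) (sym (∣⊤∣≡n n)) (sym (∣⊤∣≡n n))
    {M = M′} {M′ = U k n (rank≤∣E∣ S)} (λ b _ → b ≡ k)
    (λ {B} → mk⇔ (to {B}) (from {B})) (mk⇔ id id)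
    where
    to : ∀ {B} → Basis (system M′) B → B ⊆ E × ∣ B ∣ ≡ k
    to {B} b = Basis⊆ (system M′) b , [ ∣basis∣≡rank S (isMatroid M) , (λ (_ , ∣B∣ , _) → ∣B∣) ]′ (Equivalence.to (M′⇔ {B}) b)
    from : ∀ {B} → B ⊆ E × ∣ B ∣ ≡ k → Basis (system M′) B
    from {B} p = Equivalence.from (M′⇔ {B}) (basis-or-covered (Basis? S B) p)

  bounds : ∀ {A} → Stressed S A × ∃ (Cover S A) → rk S A < suc k × ∣ A ∣ < suc n
  bounds {A} ((A⊆E , _) , _) = s≤s (rk-mono S (isMatroid M) {A} {E} A⊆E) , s≤s (p⊆q⇒∣p∣≤∣q∣ A⊆E)

  sum≈ : ∑[ r < suc k ] ∑[ h < suc n ] (stressedCount S (toℕ r) (toℕ h) ×ᴳ relaxationTerm f (toℕ r) k (toℕ h) n) ≈ sumᴸ τ As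
  sum≈ = sum-by-invariants (λ r h → relaxationTerm f r k h n) (rk S) ∣_∣ Q?
    bounds
    -- This repeats the decision procedure local to `stressedCount`, so that the filtered lists
    -- agree by computation.
    (λ r h A → stressed? S A ×-dec anySubset? (cover? S A) ×-dec (∣ A ∣ ℕ.≟ h) ×-dec (rk S A ℕ.≟ r))
    (λ (stressed , cover , ∣A∣ , rkA) → (stressed , cover) , rkA , ∣A∣)
    (λ (stressed , cover) → stressed , cover , refl , refl)
    (subsets N)
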